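{- Let $\mathcal{P} \subset \mathbb{R}^N$ be an integral convex polytope of dimension $d$. Then \[ 1 \leq \mu_{\mathrm{va}}(\mathcal{P}) \leq \mu_{\mathrm{midp}}(\mathcal{P}) \leq \mu_{\mathrm{idp}}(\mathcal{P}) \leq \mu_{\mathrm{hole}}(\mathcal{P}) \leq \mu_{\mathrm{Ehr}}(\mathcal{P}) \leq d \] and \[ 1 \leq \mu_{\mathrm{va}}(\mathcal{P}) \leq \mu_{\mathrm{Hilb}}(\mathcal{P}) \leq \mu_{\mathrm{hole}}(\mathcal{P}) \leq d-1. \]
   Context: An integral convex polytope is a convex polytope all of whose vertices lie in $\mathbb{Z}^N$. For $k \ge 1$, $k\mathcal{P} = \{k\alpha : \alpha \in \mathcal{P}\}$. An integral polytope $\mathcal{Q}$ has the integer decomposition property (IDP) if for every integer $k \geq 1$ and every $\alpha \in k\mathcal{Q} \cap \mathbb{Z}^N$ there are $\alpha_1,\dots,\alpha_k \in \mathcal{Q}\cap\mathbb{Z}^N$ with $\alpha = \alpha_1+\cdots+\alpha_k$. $\mathcal{Q}$ is very ample if the same holds for all sufficiently large $k$. Let $\widetilde{\mathcal{P}} = \{(\alpha,1) : \alpha \in \mathcal{P}\} \subset \mathbb{R}^{N+1}$ and let $\mathcal{C}(\mathcal{P})$ be the cone generated by the vertices of $\widetilde{\mathcal{P}}$; the degree of $(\alpha,n) \in \mathcal{C}(\mathcal{P}) \cap \mathbb{Z}^{N+1}$ is $n$. $\mathcal{H}(\mathcal{C}(\mathcal{P}))$ denotes the unique minimal Hilbert basis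 of $\mathcal{C}(\mathcal{P})$, i.e. the minimal finite set of integer vectors whose nonnegative integer combinations are exactly $\mathcal{C}(\mathcal{P}) \cap \mathbb{Z}^{N+1}$. A simplex $\mathcal{S}$ is empty if $\mathcal{S}\cap \mathbb{Z}^N$ is its vertex set. For an empty simplex $\mathcal{S}$ with vertices $v_i$, $\mathrm{Box}(\mathcal{S}) = \{\sum_i r_i (v_i,1) \in \mathbb{Z}^{N+1} : 0 \le r_i < 1\}$, and $\mathrm{Box}(\mathcal{P}) = \bigcup_{\mathcal{S}} \mathrm{Box}(\mathcal{S}) \setminus \mathbb{Z}_{\geq 0}(\widetilde{\mathcal{P}} \cap \mathbb{Z}^{N+1})$, the union over all empty $d$-dimensional simplices $\mathcal{S} \subset \mathcal{P}$ with integer vertices, where $\mathbb{Z}_{\ge 0}(X)$ denotes the set of nonnegative integer combinations of elements of $X$. The $\delta$-vector $(\delta_0,\dots,\delta_d)$ of $\mathcal{P}$ is defined by $\sum_{n\ge 0} |n\mathcal{P}\cap\mathbb{Z}^N| t^n = (\sum_{i=0}^d \delta_i t^i)/(1-t)^{d+1}$. The invariants are: $\mu_{\mathrm{va}}(\mathcal{P})$ = smallest $k>0$ with $k\mathcal{P}$ very ample; $\mu_{\mathrm{midp}}(\mathcal{P})$ = smallest $k>0$ with $k\mathcal{P}$ having IDP; $\mu_{\mathrm{idp}}(\mathcal{P})$ = smallest $k>0$ such that $n\mathcal{P}$ has IDP for all $n \ge k$; $\mu_{\mathrm{Hilb}}(\mathcal{P})$ = maximal degree of an element of $\mathcal{H}(\mathcal{C}(\mathcal{P}))$;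 $\mu_{\mathrm{hole}}(\mathcal{P})$ = maximal degree of an element of $\mathrm{Box}(\mathcal{P})$, with $\mu_{\mathrm{hole}}(\mathcal{P})=1$ if $\mathrm{Box}(\mathcal{P})=\emptyset$; $\mu_{\mathrm{Ehr}}(\mathcal{P})$ = largest $i>0$ with $\delta_i \neq 0$.
   Formalization: The first chain is asserted only for d ≥ 1 and the second only for d ≥ 2 (each is false in lower dimension, e.g. for a point or a unit segment), and μ_Ehr is set to 1 when δ_i = 0 for all i > 0 (e.g. unimodular simplices), where it is otherwise undefined. -}

module Defs where

open import Data.Nat as ℕ using (ℕ; zero; suc; _∸_)
open import Data.Nat.Combinatorics using (_C_)
open import Data.Integer as ℤ using (ℤ; +_)
open import Data.Rational as ℚ using (ℚ; 0ℚ; 1ℚ)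
open import Data.Fin using (Fin; zero; suc; toℕ)
open import Data.Vec as V using (Vec; []; _∷_)
open import Data.Product using (Σ; Σ-syntax; ∃; ∃-syntax; _×_; _,_; proj₁; proj₂)
open import Data.Sum using (_⊎_)
open import Relation.Nullary using (¬_)
open import Relation.Binary.PropositionalEquality using (_≡_)

sumℚ : ∀ {k} → (Fin k → ℚ) → ℚ
sumℚ {zero}  f = 0ℚ
sumℚ {suc k} f = f zero ℚ.+ sumℚ (λ i → f (suc i))

sumℤ : ∀ {k} → (Fin k → ℤ) → ℤ
sumℤ {zero}  f = + 0
sumℤ {suc k} f = f zero ℤ.+ sumℤ (λ i → f (suc i))

zerosℚ : ∀ {N} → Vec ℚ N
zerosℚ = V.replicate _ 0ℚ

zerosℤ : ∀ {N} → Vec ℤ N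
zerosℤ = V.replicate _ (+ 0)

sumVℚ : ∀ {k N} → (Fin k → Vec ℚ N) → Vec ℚ N
sumVℚ {zero}  f = zerosℚ
sumVℚ {suc k} f = V.zipWith ℚ._+_ (f zero) (sumVℚ (λ i → f (suc i)))

sumVℤ : ∀ {k N} → (Fin k → Vec ℤ N) → Vec ℤ N
sumVℤ {zero}  f = zerosℤ
sumVℤ {suc k} f = V.zipWith ℤ._+_ (f zero) (sumVℤ (λ i → f (suc i)))

ℤ→ℚ : ℤ → ℚ
ℤ→ℚ z = z ℚ./ 1

toℚv : ∀ {N} → Vec ℤ N → Vec ℚ N
toℚv = V.map ℤ→ℚ

_·ℚ_ : ∀ {N} → ℚ → Vec ℚ N → Vec ℚ N
r ·ℚ v = V.map (r ℚ.*_) v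

-- Integral convex polytopes: P = conv of finitely many (≥ 1) points of ℤ^N

record Polytope (N : ℕ) : Set where
  constructor polytope
  field
    m    : ℕ
    vert : Fin (suc m) → Vec ℤ N

open Polytope public

InConv : ∀ {k N} → (Fin k → Vec ℤ N) → Vec ℚ N → Set
InConv {k} w x =
  Σ[ c ∈ (Fin k → ℚ) ] (∀ i → 0ℚ ℚ.≤ c i) × (sumℚ c ≡ 1ℚ)
                        × (sumVℚ (λ i → c i ·ℚ toℚv (w i)) ≡ x)

Lattice : ∀ {N} → Polytope N → Vec ℤ N → Set
Lattice P a = InConv (vert P) (toℚv a)

dilate : ∀ {N} → ℕ → Polytope N → Polytope N
dilate k P = polytope (m P) (λ i → V.map (λ z → + k ℤ.* z) (vert P i))

DecompAt : ∀ {N} → Polytope N → ℕ → Set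
DecompAt {N} Q k = ∀ a → Lattice (dilate k Q) a →
  Σ[ as ∈ (Fin k → Vec ℤ N) ] (∀ i → Lattice Q (as i)) × (sumVℤ as ≡ a)

IDP : ∀ {N} → Polytope N → Set
IDP Q = ∀ k → 1 ℕ.≤ k → DecompAt Q k

VeryAmple : ∀ {N} → Polytope N → Set
VeryAmple Q = ∃[ k₀ ] ∀ k → k₀ ℕ.≤ k → DecompAt Q k

IsLeastPos : (ℕ → Set) → ℕ → Set
IsLeastPos Q m = (1 ℕ.≤ m) × Q m × (∀ k → 1 ℕ.≤ k → k ℕ.< m → ¬ Q k)

MuVa : ∀ {N} → Polytope N → ℕ → Set
MuVa P = IsLeastPos (λ k → VeryAmple (dilate k P))

MuMidp : ∀ {N} → Polytope N → ℕ → Set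
MuMidp P = IsLeastPos (λ k → IDP (dilate k P))

MuIdp : ∀ {N} → Polytope N → ℕ → Set
MuIdp P = IsLeastPos (λ k → ∀ n → k ℕ.≤ n → IDP (dilate n P))

AffInd : ∀ {k N} → (Fin k → Vec ℚ N) → Set
AffInd {k} x = ∀ (c : Fin k → ℚ) → sumℚ c ≡ 0ℚ →
  sumVℚ (λ i → c i ·ℚ x i) ≡ zerosℚ → ∀ i → c i ≡ 0ℚ

IsDim : ∀ {N} → Polytope N → ℕ → Set
IsDim P d =
  (Σ[ f ∈ (Fin (suc d) → Fin (suc (m P))) ] AffInd (λ i → toℚv (vert P (f i))))
  × (∀ (f : Fin (suc (suc d)) → Fin (suc (m P))) →
       ¬ AffInd (λ i → toℚv (vert P (f i))))

-- The cone C(P) and its Hilbert basis.  Integer vectors of ℤ^{N+1} are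
-- pairs (α , n) ∈ ℤ^N × ℤ; the degree is n.

ZVec : ℕ → Set
ZVec N = Vec ℤ N × ℤ

deg : ∀ {N} → ZVec N → ℤ
deg = proj₂

-- (α , n) ∈ C(P): nonnegative rational combination of the (v_i , 1)
InCone : ∀ {N} → Polytope N → ZVec N → Set
InCone P (a , n) =
  Σ[ c ∈ (Fin (suc (m P)) → ℚ) ] (∀ i → 0ℚ ℚ.≤ c i) × (sumℚ c ≡ ℤ→ℚ n)
     × (sumVℚ (λ i → c i ·ℚ toℚv (vert P i)) ≡ toℚv a)

ZComb : ∀ {h N} → (Fin h → ZVec N) → ZVec N → Set
ZComb {h} H x = Σ[ c ∈ (Fin h → ℕ) ]
  (sumVℤ (λ i → V.map (λ z → + c i ℤ.* z) (proj₁ (H i))) ≡ proj₁ x)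
  × (sumℤ (λ i → + c i ℤ.* proj₂ (H i)) ≡ proj₂ x)

IsHilbBasis : ∀ {h N} → Polytope N → (Fin h → ZVec N) → Set
IsHilbBasis P H = ∀ x → (ZComb H x → InCone P x) × (InCone P x → ZComb H x)

IsMinHilbBasis : ∀ {h N} → Polytope N → (Fin h → ZVec N) → Set
IsMinHilbBasis {h} {N} P H = IsHilbBasis P H ×
  (∀ {h'} (H' : Fin h' → ZVec N) → (∀ i → ∃[ j ] H' i ≡ H j) →
     IsHilbBasis P H' → ∀ j → ∃[ i ] H j ≡ H' i)

MuHilb : ∀ {N} → Polytope N → ℕ → Set
MuHilb {N} P μ = Σ[ h ∈ ℕ ] Σ[ H ∈ (Fin h → ZVec N) ] IsMinHilbBasis P H
  × (∀ j → deg (H j) ℤ.≤ + μ) × (∃[ j ] deg (H j) ≡ + μ)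

EmptySimplex : ∀ {N} → Polytope N → (d : ℕ) → (Fin (suc d) → Vec ℤ N) → Set
EmptySimplex P d w = (∀ i → Lattice P (w i)) × AffInd (λ i → toℚv (w i))
  × (∀ a → InConv w (toℚv a) → ∃[ i ] a ≡ w i)

InBoxS : ∀ {N d} → (Fin (suc d) → Vec ℤ N) → ZVec N → Set
InBoxS {N} {d} w x = Σ[ r ∈ (Fin (suc d) → ℚ) ]
  (∀ i → (0ℚ ℚ.≤ r i) × (r i ℚ.< 1ℚ))
  × (sumVℚ (λ i → r i ·ℚ toℚv (w i)) ≡ toℚv (proj₁ x))
  × (sumℚ r ≡ ℤ→ℚ (proj₂ x))

-- x ∈ ℤ_{≥0}( P̃ ∩ ℤ^{N+1} ): a sum of k points (p , 1), p ∈ P ∩ ℤ^N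
InZSpan : ∀ {N} → Polytope N → ZVec N → Set
InZSpan {N} P x = Σ[ k ∈ ℕ ] Σ[ ps ∈ (Fin k → Vec ℤ N) ]
  (∀ i → Lattice P (ps i)) × (sumVℤ ps ≡ proj₁ x) × (+ k ≡ proj₂ x)

InBox : ∀ {N} → Polytope N → ℕ → ZVec N → Set
InBox {N} P d x =
  (Σ[ w ∈ (Fin (suc d) → Vec ℤ N) ] EmptySimplex P d w × InBoxS w x)
  × ¬ InZSpan P x

MuHole : ∀ {N} → Polytope N → ℕ → ℕ → Set
MuHole P d μ =
  ((∀ x → ¬ InBox P d x) × μ ≡ 1)
  ⊎ ((∀ x → InBox P d x → deg x ℤ.≤ + μ) × (∃[ x ] InBox P d x × deg x ≡ + μ))

IsCount : ∀ {N} → Polytope N → ℕ → ℕ → Set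
IsCount {N} P n c = Σ[ xs ∈ (Fin c → Vec ℤ N) ]
  (∀ i j → xs i ≡ xs j → i ≡ j)
  × (∀ i → Lattice (dilate n P) (xs i))
  × (∀ a → Lattice (dilate n P) a → ∃[ i ] xs i ≡ a)

sgn : ℕ → ℤ
sgn zero    = + 1
sgn (suc j) = ℤ.- sgn j

-- coefficient of t^i in (1-t)^{d+1} · Σ_n L(n) t^n
delta : ℕ → (ℕ → ℕ) → ℕ → ℤ
delta d L i = sumℤ {suc i} (λ j →
  sgn (toℕ j) ℤ.* (+ ((suc d) C (toℕ j)) ℤ.* + L (i ∸ toℕ j)))

MuEhr : ℕ → (ℕ → ℕ) → ℕ → Set
MuEhr d L μ =
  ((1 ℕ.≤ μ) × ¬ (delta d L μ ≡ + 0) × (∀ i → μ ℕ.< i → delta d L i ≡ + 0))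
  ⊎ ((μ ≡ 1) × (∀ i → 1 ℕ.≤ i → delta d L i ≡ + 0))

{-# OPTIONS --safe #-}

-- A lattice point of k P becomes an element of degree k of the cone over P.  Each such element lies in
-- the cone of an empty d-simplex of lattice points, and subtracting vertices of the simplex as long as
-- possible leaves an element of its box, which is a sum of lattice points of P or has degree at most
-- μ_hole.  Distributing the subtracted vertices gives μ_idp ≤ μ_hole.  An irreducible element of degree
-- at least 2 must itself be such a box element, so μ_Hilb ≤ μ_hole; multiples of a vertex raise
-- irreducible elements to degree exactly μ_Hilb, so μ_va ≤ μ_Hilb.  A box element of degree d would be
-- the reflection of an interior lattice point of an empty simplex, so μ_hole ≤ d - 1.
--
-- For μ_hole ≤ μ_Ehr, start the dual simplex method at a given simplex, with generic costs and
-- with right-hand sides pushed towards a generic interior point of that simplex.  The dual feasible bases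
-- then split the cone into half-open simplicial cones, and δ_i counts the elements of degree i of
-- their half-open boxes.  So δ_i vanishes for i > d, and since the half-open cone of the starting simplex
-- is closed, the degrees of its box elements occur in δ.
--
-- The invariants have to be computed, so each property is decided: cone membership by Farkas' lemma, and
-- very ampleness at irredundant generators of the cone, where a functional exposing the
-- generator bounds the search.

module Submission where

open import Defs
open import Data.Empty using (⊥; ⊥-elim)
open import Data.Fin using (Fin; zero; suc; toℕ; punchIn)
open import Data.Fin.Properties using (any?; all?; injective⇒≤; punchIn-injective; punchInᵢ≢i) renaming (_≟_ to _≟ᶠ_)
open import Data.Integer as ℤ using (ℤ; -[1+_])
import Data.Integer.Properties as ℤP
import Data.Integer.Tactic.RingSolver as ℤR
open import Data.List as L using (List; []; _∷_; _++_; map; concatMap; allFin; filter; length; upTo; cartesianProductWith; deduplicate)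
open import Data.List.Membership.Propositional using (_∈_; _∉_; find; lose)
open import Data.List.Membership.Propositional.Properties
  using (∈-allFin; ∈-cartesianProductWith⁺; ∈-cartesianProductWith⁻; ∈-concat⁺′; ∈-concat⁻′; ∈-deduplicate⁺; ∈-deduplicate⁻;
         ∈-filter⁺; ∈-filter⁻; ∈-lookup; ∈-map⁺; ∈-map⁻; ∈-upTo⁺; ∈-upTo⁻; ∈-++⁺ˡ; ∈-++⁺ʳ; ∈-++⁻)
open import Data.List.Properties using (length-tabulate; filter-all)
open import Data.List.Relation.Unary.All as All using (All; []; _∷_)
import Data.List.Relation.Unary.All.Properties as All
open import Data.List.Relation.Unary.AllPairs using ([]; _∷_)
open import Data.List.Relation.Unary.Any as Any using (Any; here; there; index)
open import Data.List.Relation.Unary.Any.Properties as Any using (lookup-index)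
open import Data.List.Relation.Unary.Unique.DecPropositional.Properties using (deduplicate-!)
open import Data.List.Relation.Unary.Unique.Propositional using (Unique)
import Data.List.Relation.Unary.Unique.Propositional.Properties as Unique
open import Data.Maybe using (Maybe; just; nothing)
open import Data.Nat as ℕ using (ℕ; zero; suc)
open import Data.Nat.Combinatorics using (nCk+nC[k+1]≡[n+1]C[k+1]; nCk≡nC[n∸k]; nCn≡1) renaming (_C_ to _choose_)
import Data.Nat.Coprimality as Coprimality
open import Data.Nat.Induction using (<-wellFounded; Acc; acc)
import Data.Nat.Properties as ℕP
import Data.Nat.Tactic.RingSolver as ℕR
open import Data.Product using (Σ; Σ-syntax; ∃; ∃-syntax; _×_; _,_; proj₁; proj₂)
open import Data.Rational as ℚ using (ℚ)
import Data.Rational.Properties as ℚP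
import Data.Rational.Unnormalised as ℚᵘ
import Data.Rational.Unnormalised.Properties as ℚᵘP
open import Data.Sum using (_⊎_; inj₁; inj₂; [_,_])
open import Data.Vec as V using (Vec; []; _∷_; lookup)
import Data.Vec.Properties as V
open import Function using (_∘_; id)
open import Level using (0ℓ)
open import Relation.Binary.Definitions using (DecidableEquality; tri<; tri≈; tri>)
open import Relation.Binary.PropositionalEquality hiding ([_])
open import Relation.Nullary using (¬_; Dec; yes; no; ¬?; _×-dec_; _⊎-dec_)
open import Relation.Nullary.Decidable using (decidable-stable; map′)
open import Relation.Unary using (Pred; Decidable)
open import Tactic.RingSolver using (solve-∀)
import Tactic.RingSolver.Core.AlmostCommutativeRing as ACR

-- Each invariant is an extremum over an infinite range, so its existence needs a decision at single
-- values and a bound on the search. The boxes provide the bound: their degrees are at most d, so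
-- μ_hole is a maximum over a finite list, and it limits the searches for μ_midp, μ_idp and μ_Hilb.
--
-- Genericity takes the place of symbolic perturbation. There are finitely many bases, hence
-- finitely many hyperplanes to avoid, and explicit small ε keep the strict inequalities already
-- obtained.
--
-- The simplex of a hole of maximal degree need not occur in a decomposition fixed in advance. The
-- decomposition is therefore constructed for an arbitrary starting simplex; since δ depends only on
-- the numbers of lattice points, all these decompositions have the same numerator.
--
-- P may lie in a proper affine subspace. The coordinate functionals of a simplex are then
-- determined only on the span of the lattice points, and functionals are compared only there.

infixr 5 _∙_
_∙_ : ∀ {X : Set} {x y z : X} → x ≡ y → y ≡ z → x ≡ z
_∙_ = trans

-- Ordered field arithmetic of the rationals, integers among them, finite sums

module Rationals where

  open import Data.Rational using (mkℚ; 0ℚ; 1ℚ; _+_; _*_; _-_; -_; _≤_; _<_; 1/_; *≤*; *<*; ≢-nonZero; positive; nonNegative)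
  open ℚP

  zero-test : ∀ x → Maybe (0ℚ ≡ x)
  zero-test x with 0ℚ ≟ x
  ... | yes p = just p
  ... | no _  = nothing

  ringℚ : ACR.AlmostCommutativeRing 0ℓ 0ℓ
  ringℚ = ACR.fromCommutativeRing +-*-commutativeRing zero-test

  0≤-+ : ∀ {p q} → 0ℚ ≤ p → 0ℚ ≤ q → 0ℚ ≤ p + q
  0≤-+ = +-mono-≤ {0ℚ} {_} {0ℚ} {_}

  0<-+ : ∀ {p q} → 0ℚ < p → 0ℚ ≤ q → 0ℚ < p + q
  0<-+ = +-mono-<-≤ {0ℚ} {_} {0ℚ} {_}

  0≤-* : ∀ {p q} → 0ℚ ≤ p → 0ℚ ≤ q → 0ℚ ≤ p * q
  0≤-* {p} {q} hp hq = nonNegative⁻¹ (p * q) {{nonNeg*nonNeg⇒nonNeg p {{nonNegative hp}} q {{nonNegative hq}}}}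

  0<-* : ∀ {p q} → 0ℚ < p → 0ℚ < q → 0ℚ < p * q
  0<-* {p} {q} hp hq = positive⁻¹ (p * q) {{pos*pos⇒pos p {{positive hp}} q {{positive hq}}}}

  ≤⇒0≤- : ∀ {p q} → p ≤ q → 0ℚ ≤ q - p
  ≤⇒0≤- {p} {q} h = subst (_≤ q - p) (+-inverseʳ p) (+-monoˡ-≤ (- p) h)

  <⇒0<- : ∀ {p q} → p < q → 0ℚ < q - p
  <⇒0<- {p} {q} h = subst (_< q - p) (+-inverseʳ p) (+-monoˡ-< (- p) h)

  private
    cancel : ∀ p q → (q - p) + p ≡ q
    cancel = solve-∀ ringℚ

  0≤-⇒≤ : ∀ {p q} → 0ℚ ≤ q - p → p ≤ q
  0≤-⇒≤ {p} {q} h = subst₂ _≤_ (+-identityˡ p) (cancel p q) (+-monoˡ-≤ p h)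

  0<-⇒< : ∀ {p q} → 0ℚ < q - p → p < q
  0<-⇒< {p} {q} h = subst₂ _<_ (+-identityˡ p) (cancel p q) (+-monoˡ-< p h)

  -‿zero⇒≡ : ∀ {p q} → q - p ≡ 0ℚ → p ≡ q
  -‿zero⇒≡ {p} {q} h = sym (+-identityˡ p) ∙ cong (_+ p) (sym h) ∙ cancel p q

  neg⁺ : ∀ {p} → p < 0ℚ → 0ℚ < - p
  neg⁺ {p} = neg-antimono-<

  neg-involutive : ∀ p → - (- p) ≡ p
  neg-involutive = solve-∀ ringℚ

  neg⁻ : ∀ {p} → 0ℚ < p → - p < 0ℚ
  neg⁻ = neg-antimono-<

  neg⁻¹ : ∀ {p} → 0ℚ < - p → p < 0ℚ
  neg⁻¹ {p} h = subst (_< 0ℚ) (neg-involutive p) (neg⁻ h)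

  -- inv 0ℚ = 0ℚ
  abstract
    inv : ℚ → ℚ
    inv p with p ≟ 0ℚ
    ... | yes _ = 0ℚ
    ... | no h  = (1/ p) {{≢-nonZero h}}

    inv-* : ∀ {p} → p ≢ 0ℚ → p * inv p ≡ 1ℚ
    inv-* {p} h with p ≟ 0ℚ
    ... | yes e = ⊥-elim (h e)
    ... | no h′ = *-inverseʳ p {{≢-nonZero h′}}

  0<⇒≢0 : ∀ {p} → 0ℚ < p → p ≢ 0ℚ
  0<⇒≢0 h e = <⇒≢ h (sym e)

  <0⇒≢0 : ∀ {p} → p < 0ℚ → p ≢ 0ℚ
  <0⇒≢0 h e = <⇒≢ h e

  0<1 : 0ℚ < 1ℚ
  0<1 = *<* (ℤ.+<+ (ℕ.s≤s ℕ.z≤n))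

  0≤1 : 0ℚ ≤ 1ℚ
  0≤1 = <⇒≤ 0<1

  *-cancel-pos : ∀ {p q} → 0ℚ ≤ p → 0ℚ < p * q → 0ℚ < q
  *-cancel-pos {p} {q} hp h with <-cmp 0ℚ q
  ... | tri< a _ _ = a
  ... | tri≈ _ e _ = ⊥-elim (<-irrefl refl (subst (0ℚ <_) (cong (p *_) (sym e) ∙ *-zeroʳ p) h))
  ... | tri> _ _ q<0 = ⊥-elim (<-irrefl refl (<-≤-trans h (subst₂ _≤_ (eq p q) refl
          (neg-antimono-≤ (0≤-* hp (<⇒≤ (neg⁺ q<0)))))))
    where eq : ∀ p q → - (p * (- q)) ≡ p * q
          eq = solve-∀ ringℚ

  0<-inv : ∀ {p} → 0ℚ < p → 0ℚ < inv p
  0<-inv {p} h = *-cancel-pos (<⇒≤ h) (subst (0ℚ <_) (sym (inv-* (0<⇒≢0 h))) 0<1)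

  ≤∧≢⇒< : ∀ {p q} → p ≤ q → p ≢ q → p < q
  ≤∧≢⇒< {p} {q} h ne with <-cmp p q
  ... | tri< a _ _ = a
  ... | tri≈ _ e _ = ⊥-elim (ne e)
  ... | tri> _ _ q<p = ⊥-elim (<-irrefl refl (<-≤-trans q<p h))

  no-zero-divisor : ∀ {p q} → p * q ≡ 0ℚ → p ≢ 0ℚ → q ≡ 0ℚ
  no-zero-divisor {p} {q} e h = begin
    q               ≡⟨ eq p q (inv p) ⟩
    (q - p * inv p * q) + inv p * (p * q)   ≡⟨ cong₂ (λ a b → (q - a * q) + inv p * b) (inv-* h) e ⟩
    (q - 1ℚ * q) + inv p * 0ℚ ≡⟨ eq′ q (inv p) ⟩
    0ℚ ∎
    where open ≡-Reasoning
          eq : ∀ p q i → q ≡ (q - p * i * q) + i * (p * q)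
          eq = solve-∀ ringℚ
          eq′ : ∀ q i → (q - 1ℚ * q) + i * 0ℚ ≡ 0ℚ
          eq′ = solve-∀ ringℚ

  -- Integers inside the rationals

  private
    -- The fraction `z / 1` is normalised through a gcd, which does not compute for a variable `z`.
    -- This is the normal form it reaches, on which numerators and comparisons do compute.
    int : ℤ → ℚ
    int z = mkℚ z 0 (Coprimality.sym (Coprimality.1-coprimeTo ℤ.∣ z ∣))

    ℤ→ℚ-int : ∀ z → ℤ→ℚ z ≡ int z
    ℤ→ℚ-int z = ↥p/↧p≡p (int z)

  ℤ→ℚ-+ : ∀ z w → ℤ→ℚ (z ℤ.+ w) ≡ ℤ→ℚ z + ℤ→ℚ w
  ℤ→ℚ-+ z w = sym (cong₂ _+_ (ℤ→ℚ-int z) (ℤ→ℚ-int w)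
    ∙ cong ℤ→ℚ (cong₂ ℤ._+_ (ℤP.*-identityʳ z) (ℤP.*-identityʳ w)))

  ℤ→ℚ-* : ∀ z w → ℤ→ℚ (z ℤ.* w) ≡ ℤ→ℚ z * ℤ→ℚ w
  ℤ→ℚ-* z w = sym (cong₂ _*_ (ℤ→ℚ-int z) (ℤ→ℚ-int w))

  ℤ→ℚ-neg : ∀ z → ℤ→ℚ (ℤ.- z) ≡ - ℤ→ℚ z
  ℤ→ℚ-neg z = -‿zero⇒≡ (eq (ℤ→ℚ z) (ℤ→ℚ (ℤ.- z))
      ∙ cong -_ (sym (ℤ→ℚ-+ z (ℤ.- z)) ∙ cong ℤ→ℚ (ℤP.+-inverseʳ z)))
    where eq : ∀ a b → - a - b ≡ - (a + b)
          eq = solve-∀ ringℚ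

  ℤ→ℚ-injective : ∀ {z w} → ℤ→ℚ z ≡ ℤ→ℚ w → z ≡ w
  ℤ→ℚ-injective {z} {w} e = cong ℚ.↥_ (sym (ℤ→ℚ-int z) ∙ e ∙ ℤ→ℚ-int w)

  ℤ→ℚ-mono-≤ : ∀ {z w} → z ℤ.≤ w → ℤ→ℚ z ≤ ℤ→ℚ w
  ℤ→ℚ-mono-≤ {z} {w} h = subst₂ _≤_ (sym (ℤ→ℚ-int z)) (sym (ℤ→ℚ-int w))
    (*≤* (subst₂ ℤ._≤_ (sym (ℤP.*-identityʳ z)) (sym (ℤP.*-identityʳ w)) h))

  ℤ→ℚ-mono-< : ∀ {z w} → z ℤ.< w → ℤ→ℚ z < ℤ→ℚ w
  ℤ→ℚ-mono-< {z} {w} h = subst₂ _<_ (sym (ℤ→ℚ-int z)) (sym (ℤ→ℚ-int w))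
    (*<* (subst₂ ℤ._<_ (sym (ℤP.*-identityʳ z)) (sym (ℤP.*-identityʳ w)) h))

  ℤ→ℚ-cancel-≤ : ∀ {z w} → ℤ→ℚ z ≤ ℤ→ℚ w → z ℤ.≤ w
  ℤ→ℚ-cancel-≤ {z} {w} h with z ℤ.≤? w
  ... | yes p = p
  ... | no np = ⊥-elim (<-irrefl refl (<-≤-trans (ℤ→ℚ-mono-< (ℤP.≰⇒> np)) h))

  ℤ→ℚ-cancel-< : ∀ {z w} → ℤ→ℚ z < ℤ→ℚ w → z ℤ.< w
  ℤ→ℚ-cancel-< {z} {w} h with z ℤ.<? w
  ... | yes p = p
  ... | no np = ⊥-elim (<-irrefl refl (<-≤-trans h (ℤ→ℚ-mono-≤ (ℤP.≮⇒≥ np))))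

  *-denominator : ∀ q → q * ℤ→ℚ (ℚ.↧ q) ≡ ℤ→ℚ (ℚ.↥ q)
  *-denominator q@(mkℚ n d-1 _) = toℚᵘ-injective (ℚᵘP.≃-trans (toℚᵘ-homo-* q (ℤ→ℚ (ℤ.+ suc d-1)))
    (subst₂ (λ a b → ℚ.toℚᵘ q ℚᵘ.* ℚ.toℚᵘ a ℚᵘ.≃ ℚ.toℚᵘ b) (sym (ℤ→ℚ-int (ℤ.+ suc d-1))) (sym (ℤ→ℚ-int n))
      (ℚᵘ.*≡* (ℤP.*-identityʳ (n ℤ.* ℤ.+ suc d-1) ∙ cong (n ℤ.*_) (cong ℤ.+_ (sym (ℕP.*-identityʳ (suc d-1))))))))

  -- Finite sums

  sum-cong : ∀ {k} {f g : Fin k → ℚ} → (∀ i → f i ≡ g i) → sumℚ f ≡ sumℚ g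
  sum-cong {zero}  h = refl
  sum-cong {suc k} h = cong₂ _+_ (h zero) (sum-cong (h ∘ suc))

  sum-zero : ∀ {k} {f : Fin k → ℚ} → (∀ i → f i ≡ 0ℚ) → sumℚ f ≡ 0ℚ
  sum-zero {zero}  h = refl
  sum-zero {suc k} h = cong₂ _+_ (h zero) (sum-zero (h ∘ suc))

  sum-+ : ∀ {k} (f g : Fin k → ℚ) → sumℚ (λ i → f i + g i) ≡ sumℚ f + sumℚ g
  sum-+ {zero}  f g = refl
  sum-+ {suc k} f g = cong ((f zero + g zero) +_) (sum-+ (f ∘ suc) (g ∘ suc))
    ∙ eq (f zero) (g zero) (sumℚ (f ∘ suc)) (sumℚ (g ∘ suc))
    where eq : ∀ a b c d → (a + b) + (c + d) ≡ (a + c) + (b + d)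
          eq = solve-∀ ringℚ

  sum-*ˡ : ∀ {k} c (f : Fin k → ℚ) → sumℚ (λ i → c * f i) ≡ c * sumℚ f
  sum-*ˡ {zero}  c f = sym (*-zeroʳ c)
  sum-*ˡ {suc k} c f = cong ((c * f zero) +_) (sum-*ˡ c (f ∘ suc))
    ∙ sym (*-distribˡ-+ c (f zero) (sumℚ (f ∘ suc)))

  sum-*ʳ : ∀ {k} c (f : Fin k → ℚ) → sumℚ (λ i → f i * c) ≡ sumℚ f * c
  sum-*ʳ c f = sum-cong (λ i → *-comm (f i) c) ∙ sum-*ˡ c f ∙ *-comm c (sumℚ f)

  sum-neg : ∀ {k} (f : Fin k → ℚ) → sumℚ (λ i → - f i) ≡ - sumℚ f
  sum-neg {zero}  f = refl
  sum-neg {suc k} f = cong ((- f zero) +_) (sum-neg (f ∘ suc))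
    ∙ sym (neg-distrib-+ (f zero) (sumℚ (f ∘ suc)))

  sum-- : ∀ {k} (f g : Fin k → ℚ) → sumℚ (λ i → f i - g i) ≡ sumℚ f - sumℚ g
  sum-- f g = sum-+ f (λ i → - g i) ∙ cong ((sumℚ f) +_) (sum-neg g)

  sum-swap : ∀ {k l} (f : Fin k → Fin l → ℚ) →
             sumℚ (λ i → sumℚ (λ j → f i j)) ≡ sumℚ (λ j → sumℚ (λ i → f i j))
  sum-swap {zero} {l} f = sym (sum-zero {l} (λ _ → refl))
  sum-swap {suc k} f = cong ((sumℚ (f zero)) +_) (sum-swap (f ∘ suc))
    ∙ sym (sum-+ (f zero) (λ j → sumℚ (λ i → f (suc i) j)))

  sum-nonneg : ∀ {k} {f : Fin k → ℚ} → (∀ i → 0ℚ ≤ f i) → 0ℚ ≤ sumℚ f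
  sum-nonneg {zero}  h = ≤-refl
  sum-nonneg {suc k} h = 0≤-+ (h zero) (sum-nonneg (h ∘ suc))

  sum-pos : ∀ {k} {f : Fin k → ℚ} → (∀ i → 0ℚ ≤ f i) → ∀ i → 0ℚ < f i → 0ℚ < sumℚ f
  sum-pos h zero    p = 0<-+ p (sum-nonneg (h ∘ suc))
  sum-pos {f = f} h (suc i) p = subst (0ℚ <_) (+-comm (sumℚ (f ∘ suc)) (f zero)) (0<-+ (sum-pos (h ∘ suc) i p) (h zero))

  sum-zero⇒zero : ∀ {k} {f : Fin k → ℚ} → (∀ i → 0ℚ ≤ f i) → sumℚ f ≡ 0ℚ → ∀ i → f i ≡ 0ℚ
  sum-zero⇒zero {f = f} h e i with f i ≟ 0ℚ
  ... | yes p = p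
  ... | no np = ⊥-elim (<-irrefl (sym e) (sum-pos h i (≤∧≢⇒< (h i) (λ e′ → np (sym e′)))))

  sum-mono : ∀ {k} {f g : Fin k → ℚ} → (∀ i → f i ≤ g i) → sumℚ f ≤ sumℚ g
  sum-mono {zero}  h = ≤-refl
  sum-mono {suc k} h = +-mono-≤ (h zero) (sum-mono (h ∘ suc))

  term≤sum : ∀ {k} {f : Fin k → ℚ} → (∀ i → 0ℚ ≤ f i) → ∀ i → f i ≤ sumℚ f
  term≤sum {f = f} h zero = subst (_≤ sumℚ f) (+-identityʳ (f zero))
    (+-monoʳ-≤ (f zero) (sum-nonneg (h ∘ suc)))
  term≤sum {f = f} h (suc i) = subst (_≤ sumℚ f) (+-identityˡ (f (suc i)))
    (+-mono-≤ (h zero) (term≤sum (h ∘ suc) i))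

  sum-const : ∀ k → sumℚ {k} (λ _ → 1ℚ) ≡ ℤ→ℚ (ℤ.+ k)
  sum-const zero    = refl
  sum-const (suc k) = cong (1ℚ +_) (sum-const k) ∙ sym (ℤ→ℚ-+ (ℤ.+ 1) (ℤ.+ k))

  -- Kronecker delta

  δ : ∀ {k} → Fin k → Fin k → ℚ
  δ zero    zero    = 1ℚ
  δ zero    (suc j) = 0ℚ
  δ (suc i) zero    = 0ℚ
  δ (suc i) (suc j) = δ i j

  δ-refl : ∀ {k} (i : Fin k) → δ i i ≡ 1ℚ
  δ-refl zero    = refl
  δ-refl (suc i) = δ-refl i

  δ-≢ : ∀ {k} {i j : Fin k} → i ≢ j → δ i j ≡ 0ℚ
  δ-≢ {i = zero}  {zero}  h = ⊥-elim (h refl)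
  δ-≢ {i = zero}  {suc j} h = refl
  δ-≢ {i = suc i} {zero}  h = refl
  δ-≢ {i = suc i} {suc j} h = δ-≢ (λ e → h (cong suc e))

  δ-sym : ∀ {k} (i j : Fin k) → δ i j ≡ δ j i
  δ-sym zero    zero    = refl
  δ-sym zero    (suc j) = refl
  δ-sym (suc i) zero    = refl
  δ-sym (suc i) (suc j) = δ-sym i j

  δ-nonneg : ∀ {k} (i j : Fin k) → 0ℚ ≤ δ i j
  δ-nonneg zero    zero    = 0≤1
  δ-nonneg zero    (suc j) = ≤-refl
  δ-nonneg (suc i) zero    = ≤-refl
  δ-nonneg (suc i) (suc j) = δ-nonneg i j

  sum-δ : ∀ {k} (f : Fin k → ℚ) j → sumℚ (λ i → f i * δ i j) ≡ f j
  sum-δ {suc k} f zero = cong₂ _+_ (*-identityʳ (f zero)) (sum-zero (λ i → *-zeroʳ (f (suc i))))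
    ∙ +-identityʳ (f zero)
  sum-δ {suc k} f (suc j) = cong₂ _+_ (*-zeroʳ (f zero)) (sum-δ (f ∘ suc) j)
    ∙ +-identityˡ (f (suc j))

  sum-δ′ : ∀ {k} (f : Fin k → ℚ) j → sumℚ (λ i → f i * δ j i) ≡ f j
  sum-δ′ f j = sum-cong (λ i → cong (f i *_) (δ-sym j i)) ∙ sum-δ f j

  δ-sum : ∀ {k} (j : Fin k) → sumℚ (λ i → δ i j) ≡ 1ℚ
  δ-sum {suc k} zero    = cong (1ℚ +_) (sum-zero {k} (λ _ → refl)) ∙ +-identityʳ 1ℚ
  δ-sum {suc k} (suc j) = +-identityˡ (sumℚ (λ i → δ i j)) ∙ δ-sum j

-- Cones, Farkas' lemma and linear independence

module LinearAlgebra where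

  open Rationals
  open import Data.Rational using (0ℚ; 1ℚ; _+_; _*_; _-_; -_; _≤_; _<_)
  open ℚP hiding (neg-pos)

  -- Vectors are functions, so coordinates compute and inner products are plain sums. In exchange,
  -- equations between vectors are stated coordinatewise throughout, and `cone-resp` transports
  -- along them.
  Vect : ℕ → Set
  Vect M = Fin M → ℚ

  dot : ∀ {M} → Vect M → Vect M → ℚ
  dot u v = sumℚ (λ t → u t * v t)

  lc : ∀ {k M} → (Fin k → ℚ) → (Fin k → Vect M) → Vect M
  lc c A t = sumℚ (λ i → c i * A i t)

  dot-congʳ : ∀ {M} (u : Vect M) {x y : Vect M} → (∀ t → x t ≡ y t) → dot u x ≡ dot u y
  dot-congʳ u h = sum-cong (λ t → cong (u t *_) (h t))

  dot-comm : ∀ {M} (u v : Vect M) → dot u v ≡ dot v u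
  dot-comm u v = sum-cong (λ t → *-comm (u t) (v t))

  dot-lcˡ : ∀ {k M} (c : Fin k → ℚ) (U : Fin k → Vect M) x → dot (lc c U) x ≡ sumℚ (λ i → c i * dot (U i) x)
  dot-lcˡ c U x = begin
    sumℚ (λ t → sumℚ (λ i → c i * U i t) * x t)
      ≡⟨ sum-cong (λ t → sym (sum-*ʳ (x t) (λ i → c i * U i t))) ⟩
    sumℚ (λ t → sumℚ (λ i → c i * U i t * x t))
      ≡⟨ sum-swap (λ t i → c i * U i t * x t) ⟩
    sumℚ (λ i → sumℚ (λ t → c i * U i t * x t))
      ≡⟨ sum-cong (λ i → sum-cong (λ t → *-assoc (c i) (U i t) (x t)) ∙ sum-*ˡ (c i) (λ t → U i t * x t)) ⟩
    sumℚ (λ i → c i * dot (U i) x) ∎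
    where open ≡-Reasoning

  dot-lcʳ : ∀ {k M} u (c : Fin k → ℚ) (A : Fin k → Vect M) → dot u (lc c A) ≡ sumℚ (λ i → c i * dot u (A i))
  dot-lcʳ u c A = dot-comm u (lc c A) ∙ dot-lcˡ c A u
    ∙ sum-cong (λ i → cong (c i *_) (dot-comm (A i) u))

  dot-subˡ : ∀ {M} (u v : Vect M) k x → dot (λ t → u t - k * v t) x ≡ dot u x - k * dot v x
  dot-subˡ u v k x = begin
    sumℚ (λ t → (u t - k * v t) * x t)        ≡⟨ sum-cong (λ t → eq (u t) k (v t) (x t)) ⟩
    sumℚ (λ t → u t * x t - k * (v t * x t))  ≡⟨ sum-- (λ t → u t * x t) (λ t → k * (v t * x t)) ⟩
    dot u x - sumℚ (λ t → k * (v t * x t))    ≡⟨ cong (λ z → dot u x - z) (sum-*ˡ k (λ t → v t * x t)) ⟩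
    dot u x - k * dot v x ∎
    where open ≡-Reasoning
          eq : ∀ a k b x → (a - k * b) * x ≡ a * x - k * (b * x)
          eq = solve-∀ ringℚ

  dot-subʳ : ∀ {M} u (x z : Vect M) k → dot u (λ t → x t - k * z t) ≡ dot u x - k * dot u z
  dot-subʳ u x z k = dot-comm u (λ t → x t - k * z t) ∙ dot-subˡ x z k u
    ∙ cong₂ (λ a b → a - k * b) (dot-comm x u) (dot-comm z u)

  dot-addʳ : ∀ {M} u (x z : Vect M) k → dot u (λ t → x t + k * z t) ≡ dot u x + k * dot u z
  dot-addʳ u x z k = begin
    dot u (λ t → x t + k * z t)        ≡⟨ dot-congʳ u (λ t → eq (x t) k (z t)) ⟩
    dot u (λ t → x t - (- k) * z t)    ≡⟨ dot-subʳ u x z (- k) ⟩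
    dot u x - (- k) * dot u z          ≡⟨ sym (eq (dot u x) k (dot u z)) ⟩
    dot u x + k * dot u z ∎
    where open ≡-Reasoning
          eq : ∀ a k b → a + k * b ≡ a - (- k) * b
          eq = solve-∀ ringℚ

  dot-scaleˡ : ∀ {M} k (u : Vect M) x → dot (λ t → k * u t) x ≡ k * dot u x
  dot-scaleˡ k u x = sum-cong (λ t → *-assoc k (u t) (x t)) ∙ sum-*ˡ k (λ t → u t * x t)

  dot-neg : ∀ {M} (u x : Vect M) → dot (λ t → - u t) x ≡ - dot u x
  dot-neg u x = sum-cong (λ t → sym (neg-distribˡ-* (u t) (x t))) ∙ sum-neg (λ t → u t * x t)

  dot-minus : ∀ {M} (u v x : Vect M) → dot (λ t → u t - v t) x ≡ dot u x - dot v x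
  dot-minus u v x = sum-cong (λ t → eq (u t) (v t) (x t)) ∙ sum-- (λ t → u t * x t) (λ t → v t * x t)
    where eq : ∀ a b x → (a - b) * x ≡ a * x - b * x
          eq = solve-∀ ringℚ

  dot-δ : ∀ {M} t (x : Vect M) → dot (λ s → δ s t) x ≡ x t
  dot-δ t x = sum-cong (λ s → *-comm (δ s t) (x s)) ∙ sum-δ x t

  lc-δ : ∀ {k M} (A : Fin k → Vect M) i t → lc (λ j → δ j i) A t ≡ A i t
  lc-δ A i t = sum-cong (λ j → *-comm (δ j i) (A j t)) ∙ sum-δ (λ j → A j t) i

  Cone : ∀ {m M} → (Fin m → Vect M) → Vect M → Set
  Cone {m} A x = Σ[ c ∈ (Fin m → ℚ) ] (∀ i → 0ℚ ≤ c i) × (∀ t → lc c A t ≡ x t)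

  cone-resp : ∀ {m M} {A : Fin m → Vect M} {x y} → (∀ t → x t ≡ y t) → Cone A x → Cone A y
  cone-resp h (c , c≥0 , e) = c , c≥0 , λ t → e t ∙ h t

  cone-gen : ∀ {m M} (A : Fin m → Vect M) i → Cone A (A i)
  cone-gen A i = (λ j → δ j i) , (λ j → δ-nonneg j i) , lc-δ A i

  lc-lc : ∀ {m p M} (A : Fin m → Vect M) (c : Fin p → ℚ) (d : Fin p → Fin m → ℚ) (G : Fin p → Vect M) →
          (∀ i t → lc (d i) A t ≡ G i t) → ∀ t → lc (λ j → sumℚ (λ i → c i * d i j)) A t ≡ lc c G t
  lc-lc A c d G h t = begin
    sumℚ (λ j → sumℚ (λ i → c i * d i j) * A j t)  ≡⟨ sum-cong (λ j → sym (sum-*ʳ (A j t) (λ i → c i * d i j))) ⟩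
    sumℚ (λ j → sumℚ (λ i → c i * d i j * A j t))  ≡⟨ sum-swap (λ j i → c i * d i j * A j t) ⟩
    sumℚ (λ i → sumℚ (λ j → c i * d i j * A j t))
      ≡⟨ sum-cong (λ i → sum-cong (λ j → *-assoc (c i) (d i j) (A j t)) ∙ sum-*ˡ (c i) (λ j → d i j * A j t)) ⟩
    sumℚ (λ i → c i * lc (d i) A t)                ≡⟨ sum-cong (λ i → cong (c i *_) (h i t)) ⟩
    lc c G t ∎
    where open ≡-Reasoning

  cone-trans : ∀ {m p M} {A : Fin m → Vect M} {G : Fin p → Vect M} → (∀ i → Cone A (G i)) → ∀ {x} → Cone G x → Cone A x
  cone-trans {A = A} {G} h (c , c≥0 , e) =
    (λ j → sumℚ (λ i → c i * proj₁ (h i) j)) ,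
    (λ j → sum-nonneg (λ i → 0≤-* (c≥0 i) (proj₁ (proj₂ (h i)) j))) ,
    (λ t → lc-lc A c (λ i → proj₁ (h i)) G (λ i → proj₂ (proj₂ (h i))) t ∙ e t)

  cone-+ : ∀ {m M} {A : Fin m → Vect M} {x y k} → 0ℚ ≤ k → Cone A x → Cone A y → Cone A (λ t → x t + k * y t)
  cone-+ {A = A} {k = k} k≥0 (c , c≥0 , e) (d , d≥0 , f) =
    (λ i → c i + k * d i) , (λ i → 0≤-+ (c≥0 i) (0≤-* k≥0 (d≥0 i))) , λ t →
    sum-cong (λ i → eq (c i) k (d i) (A i t))
    ∙ sum-+ (λ i → c i * A i t) (λ i → k * (d i * A i t))
    ∙ cong₂ _+_ (e t) (sum-*ˡ k (λ i → d i * A i t) ∙ cong (k *_) (f t))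
    where eq : ∀ c k d a → (c + k * d) * a ≡ c * a + k * (d * a)
          eq = solve-∀ ringℚ

  -- When a functional y separates x from all generators except A₀, project along A₀ onto the
  -- hyperplane y = 0 and recurse.
  farkas : ∀ {m M} (A : Fin m → Vect M) x →
           Cone A x ⊎ (Σ[ y ∈ Vect M ] (∀ i → 0ℚ ≤ dot y (A i)) × dot y x < 0ℚ)
  farkas {zero} A x with any? (λ t → ¬? (x t ≟ 0ℚ))
  ... | no all0 = inj₁ ((λ ()) , (λ ()) , λ t → sym (zero-at t))
    where zero-at : ∀ t → x t ≡ 0ℚ
          zero-at t with x t ≟ 0ℚ
          ... | yes e = e
          ... | no h  = ⊥-elim (all0 (t , h))
  ... | yes (t , h) = inj₂ ((λ s → - x t * δ s t) , (λ ()) , subst (_< 0ℚ) (sym (dot-scaleˡ (- x t) (λ s → δ s t) x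
          ∙ cong (- x t *_) (dot-δ t x) ∙ eq (x t))) (neg⁻ square-pos))
    where eq : ∀ a → - a * a ≡ - (a * a)
          eq = solve-∀ ringℚ
          eq′ : ∀ a → - a * - a ≡ a * a
          eq′ = solve-∀ ringℚ
          square-pos : 0ℚ < x t * x t
          square-pos with <-cmp 0ℚ (x t)
          ... | tri< p _ _ = 0<-* p p
          ... | tri≈ _ e _ = ⊥-elim (h (sym e))
          ... | tri> _ _ p = subst (0ℚ <_) (eq′ (x t)) (0<-* (neg⁺ p) (neg⁺ p))
  farkas {suc m} {M} A x with farkas (A ∘ suc) x
  ... | inj₁ (c , c≥0 , e) = inj₁ (c′ , c′≥0 , λ t → cong (_+ lc c (A ∘ suc) t) (*-zeroˡ (A zero t))
          ∙ +-identityˡ _ ∙ e t)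
    where c′ : Fin (suc m) → ℚ
          c′ zero    = 0ℚ
          c′ (suc i) = c i
          c′≥0 : ∀ i → 0ℚ ≤ c′ i
          c′≥0 zero    = ≤-refl
          c′≥0 (suc i) = c≥0 i
  ... | inj₂ (y , y≥0 , yx<0) with 0ℚ ≤? dot y (A zero)
  ... | yes h = inj₂ (y , (λ { zero → h ; (suc i) → y≥0 i }) , yx<0)
  ... | no  h = go (farkas A′ x′)
    where
    a r : ℚ
    a = dot y (A zero)
    a<0 : a < 0ℚ
    a<0 = ≰⇒> h
    r = inv a
    ar≡1 : a * r ≡ 1ℚ
    ar≡1 = inv-* (<0⇒≢0 a<0)
    A′ : Fin m → Vect M
    A′ i t = A (suc i) t - (dot y (A (suc i)) * r) * A zero t
    x′ : Vect M
    x′ t = x t - (dot y x * r) * A zero t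
    0≤-r : 0ℚ ≤ - r
    0≤-r = <⇒≤ (*-cancel-pos (<⇒≤ (neg⁺ a<0)) (subst (0ℚ <_) (sym ar≡1 ∙ eq a r) 0<1))
      where eq : ∀ a r → a * r ≡ - a * - r
            eq = solve-∀ ringℚ
    go : _ → _
    go (inj₁ (c , c≥0 , e)) = inj₁ (c′ , c′≥0 , eqn)
      where
      S : ℚ
      S = sumℚ (λ i → c i * dot y (A (suc i)))
      c₀ : ℚ
      c₀ = dot y x * r - S * r
      c′ : Fin (suc m) → ℚ
      c′ zero    = c₀
      c′ (suc i) = c i
      c′≥0 : ∀ i → 0ℚ ≤ c′ i
      c′≥0 (suc i) = c≥0 i
      c′≥0 zero = subst (0ℚ ≤_) (eq (dot y x) S r)
          (0≤-* (0≤-+ (<⇒≤ (neg⁺ yx<0)) (sum-nonneg (λ i → 0≤-* (c≥0 i) (y≥0 i)))) 0≤-r)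
        where eq : ∀ a s r → (- a + s) * - r ≡ a * r - s * r
              eq = solve-∀ ringℚ
      open ≡-Reasoning
      eqn : ∀ t → c₀ * A zero t + lc c (A ∘ suc) t ≡ x t
      eqn t = begin
        c₀ * A zero t + lc c (A ∘ suc) t
          ≡⟨ eq₁ (dot y x) r S (A zero t) (lc c (A ∘ suc) t) ⟩
        (dot y x * r) * A zero t + (lc c (A ∘ suc) t - S * (r * A zero t))
          ≡⟨ cong (λ z → (dot y x * r) * A zero t + (lc c (A ∘ suc) t - z))
              (sym (sum-*ʳ (r * A zero t) (λ i → c i * dot y (A (suc i))))) ⟩
        (dot y x * r) * A zero t + (lc c (A ∘ suc) t - sumℚ (λ i → c i * dot y (A (suc i)) * (r * A zero t)))
          ≡⟨ cong ((dot y x * r) * A zero t +_) (sym (sum-- (λ i → c i * A (suc i) t)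
              (λ i → c i * dot y (A (suc i)) * (r * A zero t)))) ⟩
        (dot y x * r) * A zero t + sumℚ (λ i → c i * A (suc i) t - c i * dot y (A (suc i)) * (r * A zero t))
          ≡⟨ cong ((dot y x * r) * A zero t +_) (sum-cong (λ i → eq₂ (c i) (A (suc i) t) (dot y (A (suc i))) r (A zero t))) ⟩
        (dot y x * r) * A zero t + lc c A′ t
          ≡⟨ cong ((dot y x * r) * A zero t +_) (e t) ⟩
        (dot y x * r) * A zero t + (x t - (dot y x * r) * A zero t)
          ≡⟨ eq₃ ((dot y x * r) * A zero t) (x t) ⟩
        x t ∎
        where eq₁ : ∀ d r s a l → (d * r - s * r) * a + l ≡ (d * r) * a + (l - s * (r * a))
              eq₁ = solve-∀ ringℚ
              eq₂ : ∀ c a d r z → c * a - c * d * (r * z) ≡ c * (a - (d * r) * z)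
              eq₂ = solve-∀ ringℚ
              eq₃ : ∀ a b → a + (b - a) ≡ b
              eq₃ = solve-∀ ringℚ
    go (inj₂ (y′ , y′≥0 , y′x<0)) = inj₂ (y″ , y″≥0 , subst (_< 0ℚ) (sym (value x)) y′x<0)
      where
      -- The pullback of `y′` along the projection: its value at z is that of `y′` at the projected
      -- z. In particular it vanishes at `A zero`, which is projected to 0.
      y″ : Vect M
      y″ t = y′ t - (dot y′ (A zero) * r) * y t
      value : ∀ z → dot y″ z ≡ dot y′ (λ t → z t - (dot y z * r) * A zero t)
      value z = dot-subˡ y′ y (dot y′ (A zero) * r) z
        ∙ eq (dot y′ z) (dot y′ (A zero)) r (dot y z) ∙ sym (dot-subʳ y′ z (A zero) (dot y z * r))
        where eq : ∀ a b r c → a - (b * r) * c ≡ a - (c * r) * b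
              eq = solve-∀ ringℚ
      y″≥0 : ∀ i → 0ℚ ≤ dot y″ (A i)
      y″≥0 (suc i) = subst (0ℚ ≤_) (sym (value (A (suc i)))) (y′≥0 i)
      y″≥0 zero = ≤-reflexive (sym (dot-subˡ y′ y (dot y′ (A zero) * r) (A zero)
        ∙ eq (dot y′ (A zero)) r a ∙ cong (λ z → dot y′ (A zero) - dot y′ (A zero) * z) ar≡1 ∙ eq′ (dot y′ (A zero))))
        where eq : ∀ b r a → b - (b * r) * a ≡ b - b * (a * r)
              eq = solve-∀ ringℚ
              eq′ : ∀ b → b - b * 1ℚ ≡ 0ℚ
              eq′ = solve-∀ ringℚ

  cone? : ∀ {m M} (A : Fin m → Vect M) x → Dec (Cone A x)
  cone? A x with farkas A x
  ... | inj₁ p = yes p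
  ... | inj₂ (y , y≥0 , yx<0) = no λ { (c , c≥0 , e) → <-irrefl refl (≤-<-trans
          (subst (0ℚ ≤_) (sym (dot-lcʳ y c A) ∙ dot-congʳ y e) (sum-nonneg (λ i → 0≤-* (c≥0 i) (y≥0 i)))) yx<0) }

  -- A witness of linear independence that can be computed with: pairing with `U i` reads off the
  -- i-th coordinate of a combination of the `b j`.
  Dual : ∀ {k M} → (U b : Fin k → Vect M) → Set
  Dual U b = ∀ i j → dot (U i) (b j) ≡ δ i j

  Dependent : ∀ {k M} → (Fin k → Vect M) → Set
  Dependent {k} b = Σ[ c ∈ (Fin k → ℚ) ] (∃[ i ] c i ≢ 0ℚ) × (∀ t → lc c b t ≡ 0ℚ)

  dual-lc : ∀ {k M} {U b : Fin k → Vect M} → Dual U b → ∀ c i → dot (U i) (lc c b) ≡ c i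
  dual-lc {U = U} {b} d c i = dot-lcʳ (U i) c b ∙ sum-cong (λ j → cong (c j *_) (d i j)) ∙ sum-δ′ c i

  dual⇒independent : ∀ {k M} {U b : Fin k → Vect M} → Dual U b → ∀ c → (∀ t → lc c b t ≡ 0ℚ) → ∀ i → c i ≡ 0ℚ
  dual⇒independent {U = U} {b} d c e i = sym (dual-lc {U = U} {b} d c i)
    ∙ dot-congʳ (U i) e ∙ sum-zero (λ t → *-zeroʳ (U i t))

  -- Gaussian elimination. With a dual family of the tail, subtract from `b zero` its expansion in
  -- the tail. A vanishing residual is a dependency; otherwise it has a nonzero coordinate `t`, and
  -- "the t-th coordinate of the residual", rescaled, is the functional `V` for `b zero`. It kills
  -- the tail, so the older functionals can be corrected by multiples of it.
  dual-or-dependent : ∀ {k M} (b : Fin k → Vect M) → (Σ[ U ∈ (Fin k → Vect M) ] Dual U b) ⊎ Dependent b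
  dual-or-dependent {zero}  b = inj₁ ((λ ()) , λ ())
  dual-or-dependent {suc k} {M} b with dual-or-dependent (b ∘ suc)
  ... | inj₂ (c , (i , h) , e) = inj₂ (c′ , (suc i , h) , λ t → cong (_+ lc c (b ∘ suc) t) (*-zeroˡ (b zero t))
          ∙ +-identityˡ _ ∙ e t)
    where c′ : Fin (suc k) → ℚ
          c′ zero    = 0ℚ
          c′ (suc i) = c i
  ... | inj₁ (U , dual) with any? (λ t → ¬? (residual t ≟ 0ℚ))
    where
    residual : Vect M
    residual t = b zero t - lc (λ i → dot (U i) (b zero)) (b ∘ suc) t
  ... | no all0 = inj₂ (c , (zero , λ ()) , eqn)
    where
    residual : Vect M
    residual t = b zero t - lc (λ i → dot (U i) (b zero)) (b ∘ suc) t
    c : Fin (suc k) → ℚ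
    c zero    = 1ℚ
    c (suc i) = - dot (U i) (b zero)
    zero-at : ∀ t → residual t ≡ 0ℚ
    zero-at t with residual t ≟ 0ℚ
    ... | yes e = e
    ... | no h  = ⊥-elim (all0 (t , h))
    eqn : ∀ t → lc c b t ≡ 0ℚ
    eqn t = cong₂ _+_ (*-identityˡ (b zero t))
        (sum-cong (λ i → sym (neg-distribˡ-* (dot (U i) (b zero)) (b (suc i) t)))
        ∙ sum-neg (λ i → dot (U i) (b zero) * b (suc i) t)) ∙ zero-at t
  ... | yes (t , r≢0) = inj₁ (U′ , dual′)
    where
    residual : Vect M
    residual t = b zero t - lc (λ i → dot (U i) (b zero)) (b ∘ suc) t
    s : ℚ
    s = inv (residual t)
    W V : Vect M
    W = lc (λ i → b (suc i) t) U
    V t′ = s * (δ t′ t - 1ℚ * W t′)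
    V-value : ∀ x → dot V x ≡ s * (x t - sumℚ (λ i → b (suc i) t * dot (U i) x))
    V-value x = dot-scaleˡ s (λ t′ → δ t′ t - 1ℚ * W t′) x ∙ cong (s *_)
      (dot-subˡ (λ t′ → δ t′ t) W 1ℚ x ∙ cong₂ _-_ (dot-δ t x)
      (*-identityˡ (dot W x) ∙ dot-lcˡ (λ i → b (suc i) t) U x))
    V-zero : dot V (b zero) ≡ 1ℚ
    V-zero = V-value (b zero) ∙ *-comm s _
      ∙ cong (λ z → (b zero t - z) * s) (sum-cong (λ i → *-comm (b (suc i) t) (dot (U i) (b zero)))) ∙ inv-* r≢0
    V-suc : ∀ j → dot V (b (suc j)) ≡ 0ℚ
    V-suc j = V-value (b (suc j)) ∙ cong (λ z → s * (b (suc j) t - z))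
      (sum-cong (λ i → cong (b (suc i) t *_) (dual i j)) ∙ sum-δ (λ i → b (suc i) t) j)
      ∙ eq s (b (suc j) t)
      where eq : ∀ s x → s * (x - x) ≡ 0ℚ
            eq = solve-∀ ringℚ
    U′ : Fin (suc k) → Vect M
    U′ zero    = V
    U′ (suc i) t′ = U i t′ - dot (U i) (b zero) * V t′
    dual′ : Dual U′ b
    dual′ zero    zero    = V-zero
    dual′ zero    (suc j) = V-suc j
    dual′ (suc i) zero    = dot-subˡ (U i) V (dot (U i) (b zero)) (b zero)
      ∙ cong (λ z → dot (U i) (b zero) - dot (U i) (b zero) * z) V-zero ∙ eq (dot (U i) (b zero))
      where eq : ∀ b → b - b * 1ℚ ≡ 0ℚ
            eq = solve-∀ ringℚ
    dual′ (suc i) (suc j) = dot-subˡ (U i) V (dot (U i) (b zero)) (b (suc j))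
      ∙ cong₂ (λ z w → z - dot (U i) (b zero) * w) (dual i j) (V-suc j) ∙ eq (δ i j) (dot (U i) (b zero))
      where eq : ∀ d b → d - b * 0ℚ ≡ d
            eq = solve-∀ ringℚ

  δ-punchIn : ∀ {k} (p : Fin (suc k)) i j → δ (punchIn p i) (punchIn p j) ≡ δ i j
  δ-punchIn p i j with i ≟ᶠ j
  ... | yes refl = δ-refl (punchIn p i) ∙ sym (δ-refl i)
  ... | no h = δ-≢ (λ e → h (punchIn-injective p i j e)) ∙ sym (δ-≢ h)

  -- Induction on the dimension. If some `U p` has a nonzero coordinate 0, multiples of it clear
  -- that coordinate in all other functionals, without changing their pairings with the `b j` for j
  -- ≠ p. The coordinate can then be deleted together with the pair at `p`.
  dual⇒≤ : ∀ {k M} (U b : Fin k → Vect M) → Dual U b → k ℕ.≤ M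
  dual⇒≤ {zero} U b d = ℕ.z≤n
  dual⇒≤ {suc k} {zero} U b d with () ← d zero zero
  dual⇒≤ {suc k} {suc M} U b d with any? (λ i → ¬? (U i zero ≟ 0ℚ))
  ... | yes (p , h) = ℕ.s≤s (dual⇒≤ (λ i t → U′ i (suc t)) (λ j t → b (punchIn p j) (suc t)) dual′)
    where
    f : Fin k → ℚ
    f i = U (punchIn p i) zero * inv (U p zero)
    U′ : Fin k → Vect (suc M)
    U′ i t = U (punchIn p i) t - f i * U p t
    U′-zero : ∀ i → U′ i zero ≡ 0ℚ
    U′-zero i = eq (U (punchIn p i) zero) (inv (U p zero)) (U p zero)
      ∙ cong (λ z → U (punchIn p i) zero - U (punchIn p i) zero * z) (inv-* h) ∙ eq′ (U (punchIn p i) zero)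
      where eq : ∀ u r v → u - (u * r) * v ≡ u - u * (v * r)
            eq = solve-∀ ringℚ
            eq′ : ∀ b → b - b * 1ℚ ≡ 0ℚ
            eq′ = solve-∀ ringℚ
    open ≡-Reasoning
    dual′ : Dual (λ i t → U′ i (suc t)) (λ j t → b (punchIn p j) (suc t))
    dual′ i j = begin
      dot (λ t → U′ i (suc t)) (λ t → b (punchIn p j) (suc t))
        ≡⟨ sym (+-identityˡ _) ⟩
      0ℚ + dot (λ t → U′ i (suc t)) (λ t → b (punchIn p j) (suc t))
        ≡⟨ cong (_+ dot (λ t → U′ i (suc t)) (λ t → b (punchIn p j) (suc t)))
             (sym (cong (_* b (punchIn p j) zero) (U′-zero i) ∙ *-zeroˡ (b (punchIn p j) zero))) ⟩
      dot (U′ i) (b (punchIn p j))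
        ≡⟨ dot-subˡ (U (punchIn p i)) (U p) (f i) (b (punchIn p j)) ⟩
      dot (U (punchIn p i)) (b (punchIn p j)) - f i * dot (U p) (b (punchIn p j))
        ≡⟨ cong₂ (λ z w → z - f i * w) (d _ _ ∙ δ-punchIn p i j)
             (d _ _ ∙ δ-≢ (λ e → punchInᵢ≢i p j (sym e))) ⟩
      δ i j - f i * 0ℚ ≡⟨ eq (δ i j) (f i) ⟩
      δ i j ∎
      where eq : ∀ d b → d - b * 0ℚ ≡ d
            eq = solve-∀ ringℚ
  ... | no all0 = ℕP.m≤n⇒m≤1+n (dual⇒≤ (λ i t → U i (suc t)) (λ j t → b j (suc t)) λ i j →
          sym (cong (_+ dot (λ t → U i (suc t)) (λ t → b j (suc t)))
            (cong (_* b j zero) (zero-at i) ∙ *-zeroˡ (b j zero)) ∙ +-identityˡ _) ∙ d i j)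
    where zero-at : ∀ i → U i zero ≡ 0ℚ
          zero-at i with U i zero ≟ 0ℚ
          ... | yes e = e
          ... | no h  = ⊥-elim (all0 (i , h))

  dimension : ∀ {n} (v : Fin (suc n) → Vect n) → Dependent v
  dimension {n} v with dual-or-dependent v
  ... | inj₁ (U , d) = ⊥-elim (ℕP.<-irrefl refl (dual⇒≤ U v d))
  ... | inj₂ dep = dep

-- Generic choices, simplex bases and pivots

module BasesOfCones where

  open Rationals
  open LinearAlgebra
  open import Data.Rational using (0ℚ; 1ℚ; _+_; _*_; _-_; -_; _≤_; _<_)
  open ℚP hiding (neg-pos)

  abstract
    minimum : ∀ {X : Set} (_≼_ : X → X → Set) → (∀ {x y z} → x ≼ y → y ≼ z → x ≼ z) → (∀ x y → x ≼ y ⊎ y ≼ x) →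
              ∀ {x} (xs : List X) → x ∈ xs → ∃[ z ] z ∈ xs × (∀ {y} → y ∈ xs → z ≼ y)
    minimum _≼_ tr total (x ∷ []) _ = x , here refl , λ { (here refl) → [ id , id ] (total x x) }
    minimum _≼_ tr total (x ∷ xs@(_ ∷ _)) _ with minimum _≼_ tr total xs (here refl)
    ... | z , z∈ , mn with total z x
    ...   | inj₁ z≼x = z , there z∈ , λ { (here refl) → z≼x ; (there y∈) → mn y∈ }
    ...   | inj₂ x≼z = x , here refl , λ { (here refl) → [ id , id ] (total x x) ; (there y∈) → tr x≼z (mn y∈) }

    argmin : ∀ {X : Set} (f : X → ℚ) {x} (xs : List X) → x ∈ xs → ∃[ z ] z ∈ xs × (∀ {y} → y ∈ xs → f z ≤ f y)
    argmin f = minimum (λ x y → f x ≤ f y) ≤-trans (λ x y → ≤-total (f x) (f y))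

    argmax : ∀ {X : Set} (f : X → ℚ) {x} (xs : List X) → x ∈ xs → ∃[ z ] z ∈ xs × (∀ {y} → y ∈ xs → f y ≤ f z)
    argmax f = minimum (λ x y → f y ≤ f x) (λ p q → ≤-trans q p) (λ x y → ≤-total (f y) (f x))

    least : ∀ {X : Set} (f : X → ℕ) {x} (xs : List X) → x ∈ xs → ∃[ z ] z ∈ xs × (∀ {y} → y ∈ xs → f z ℕ.≤ f y)
    least f = minimum (λ x y → f x ℕ.≤ f y) ℕP.≤-trans (λ x y → ℕP.≤-total (f x) (f y))

    greatest : ∀ {X : Set} (f : X → ℕ) {x} (xs : List X) → x ∈ xs → ∃[ z ] z ∈ xs × (∀ {y} → y ∈ xs → f y ℕ.≤ f z)
    greatest f = minimum (λ x y → f y ℕ.≤ f x) (λ p q → ℕP.≤-trans q p) (λ x y → ℕP.≤-total (f y) (f x))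

  tuples : ∀ n m → List (Fin n → Fin m)
  tuples zero    m = (λ ()) ∷ []
  tuples (suc n) m = concatMap (λ j → map (λ f → λ { zero → j ; (suc i) → f i }) (tuples n m)) (allFin m)

  -- Functions are compared pointwise, so the list contains each tuple only up to pointwise
  -- equality. For the same reason a listed basis is matched below with a given one through the
  -- values of `B`.
  tuples-complete : ∀ n m (f : Fin n → Fin m) → Any (λ g → ∀ i → g i ≡ f i) (tuples n m)
  tuples-complete zero    m f = here (λ ())
  tuples-complete (suc n) m f = Any.concatMap⁺ _ (lose (∈-allFin (f zero))
    (Any.map⁺ (Any.map (λ h → λ { zero → refl ; (suc i) → h i }) (tuples-complete n m (f ∘ suc)))))

  -- Generic points

  SignStable : ℚ → ℚ × ℚ → Set
  SignStable ε₀ (a , b) = ∀ ε → 0ℚ < ε → ε ≤ ε₀ → (0ℚ < a → 0ℚ < a + ε * b) × (a < 0ℚ → a + ε * b < 0ℚ)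

  private
    pos-stable : ∀ a b → 0ℚ < a → ∃[ ε₀ ] 0ℚ < ε₀ × (∀ ε → 0ℚ < ε → ε ≤ ε₀ → 0ℚ < a + ε * b)
    pos-stable a b a>0 with 0ℚ ≤? b
    ... | yes b≥0 = 1ℚ , 0<1 , λ ε ε>0 _ → 0<-+ a>0 (0≤-* (<⇒≤ ε>0) b≥0)
    ... | no b≱0 = ε₀ , 0<-* a>0 (0<-inv s>0) , λ ε ε>0 ε≤ →
          subst (0ℚ <_) (eq₁ a b ε (inv (a - b)) ∙ cong (λ z → a * z + ε * b) (inv-* (0<⇒≢0 s>0))
            ∙ cong (_+ ε * b) (*-identityʳ a))
            (0<-+ (0<-* (0<-* a>0 (0<-inv s>0)) a>0) (0≤-* (≤⇒0≤- ε≤) (<⇒≤ b<)))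
      where
      b< : 0ℚ < - b
      b< = neg⁺ (≰⇒> b≱0)
      s>0 : 0ℚ < a - b
      s>0 = 0<-+ a>0 (<⇒≤ b<)
      -- For this ε₀ the value a + ε₀ b equals a² / (a - b), which is positive, and smaller ε give
      -- larger values since b < 0.
      ε₀ = a * inv (a - b)
      eq₁ : ∀ a b ε r → (a * r) * a + (a * r - ε) * (- b) ≡ a * ((a - b) * r) + ε * b
      eq₁ = solve-∀ ringℚ

    sign-stable : ∀ p → ∃[ ε₀ ] 0ℚ < ε₀ × SignStable ε₀ p
    sign-stable (a , b) with <-cmp 0ℚ a
    ... | tri< a>0 _ ¬a<0 = let (ε₀ , p , h) = pos-stable a b a>0 in ε₀ , p , λ ε e₁ e₂ → (λ _ → h ε e₁ e₂) , λ a<0 → ⊥-elim (¬a<0 a<0)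
    ... | tri≈ ¬a>0 _ ¬a<0 = 1ℚ , 0<1 , λ ε _ _ → (λ h → ⊥-elim (¬a>0 h)) , λ h → ⊥-elim (¬a<0 h)
    ... | tri> ¬a>0 _ a<0 = let (ε₀ , p , h) = pos-stable (- a) (- b) (neg⁺ a<0) in
          ε₀ , p , λ ε e₁ e₂ → (λ a>0 → ⊥-elim (¬a>0 a>0)) , λ _ → neg⁻¹ (subst (0ℚ <_) (eq a ε b) (h ε e₁ e₂))
      where eq : ∀ a ε b → - a + ε * - b ≡ - (a + ε * b)
            eq = solve-∀ ringℚ

  abstract
    small-ε : ∀ xs → ∃[ ε₀ ] 0ℚ < ε₀ × All (SignStable ε₀) xs
    small-ε [] = 1ℚ , 0<1 , []
    small-ε (x ∷ xs) with sign-stable x | small-ε xs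
    ... | ε₁ , p₁ , h₁ | ε₂ , p₂ , h₂ with ≤-total ε₁ ε₂
    ... | inj₁ le = ε₁ , p₁ , h₁ ∷ All.map (λ h ε e₁ e₂ → h ε e₁ (≤-trans e₂ le)) h₂
    ... | inj₂ le = ε₂ , p₂ , (λ ε e₁ e₂ → h₁ ε e₁ (≤-trans e₂ le)) ∷ h₂

  -- If `F` vanishes at `t`, move `t` by ε along a coordinate k with F k ≠ 0. The value of `F`
  -- becomes ε F k, and a small ε preserves the finitely many strict inequalities.
  avoid : ∀ {K} (Gs : List (Vect K)) t → All (λ G → 0ℚ < dot G t) Gs → ∀ F → (∃[ k ] F k ≢ 0ℚ) →
          ∃[ t′ ] All (λ G → 0ℚ < dot G t′) Gs × dot F t′ ≢ 0ℚ
  avoid Gs t Gs>0 F (k , Fk≢0) with dot F t ≟ 0ℚ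
  ... | no h = t , Gs>0 , h
  ... | yes e with small-ε (map (λ G → dot G t , G k) Gs)
  ... | ε , ε>0 , stable = t′ , All.zipWith (λ {G} (h , g) → subst (0ℚ <_) (sym (value G)) (proj₁ (h ε ε>0 ≤-refl) g))
      (All.map⁻ stable , Gs>0)
      , λ z → Fk≢0 (no-zero-divisor ((sym (+-identityˡ _) ∙ cong (_+ ε * F k) (sym e) ∙ sym (value F)) ∙ z) (0<⇒≢0 ε>0))
    where
    t′ : Vect _
    t′ s = t s + ε * δ s k
    value : ∀ G → dot G t′ ≡ dot G t + ε * G k
    value G = dot-addʳ G t (λ s → δ s k) ε ∙ cong (λ z → dot G t + ε * z) (dot-comm G (λ s → δ s k) ∙ dot-δ k G)

  abstract
    -- Once `F` is nonzero, its sign is recorded by adding `F` or its negative to the strict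
    -- inequalities `Gs`. Later moves then cannot return to the hyperplane F = 0.
    avoid-all : ∀ {K} (Fs Gs : List (Vect K)) t → All (λ G → 0ℚ < dot G t) Gs → All (λ F → ∃[ k ] F k ≢ 0ℚ) Fs →
                ∃[ t′ ] All (λ G → 0ℚ < dot G t′) Gs × All (λ F → dot F t′ ≢ 0ℚ) Fs
    avoid-all [] Gs t Gs>0 [] = t , Gs>0 , []
    avoid-all (F ∷ Fs) Gs t Gs>0 (F≢0 ∷ Fs≢0) with avoid Gs t Gs>0 F F≢0
    ... | t₁ , Gs>0₁ , Ft₁≢0 with <-cmp 0ℚ (dot F t₁)
    ... | tri≈ _ e _ = ⊥-elim (Ft₁≢0 (sym e))
    ... | tri< F>0 _ _ with avoid-all Fs (F ∷ Gs) t₁ (F>0 ∷ Gs>0₁) Fs≢0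
    ...   | t₂ , F>0′ ∷ Gs>0₂ , Fs≢0₂ = t₂ , Gs>0₂ , 0<⇒≢0 F>0′ ∷ Fs≢0₂
    avoid-all {K} (F ∷ Fs) Gs t Gs>0 (F≢0 ∷ Fs≢0) | t₁ , Gs>0₁ , Ft₁≢0 | tri> _ _ F<0
      with avoid-all Fs ((λ k → - F k) ∷ Gs) t₁ (subst (0ℚ <_) (sym (dot-neg F t₁)) (neg⁺ F<0) ∷ Gs>0₁) Fs≢0
    ... | t₂ , F>0′ ∷ Gs>0₂ , Fs≢0₂ = t₂ , Gs>0₂ , (λ e → 0<⇒≢0 F>0′ (dot-neg F t₂ ∙ cong -_ e)) ∷ Fs≢0₂

  minus-zero : ∀ p → p - 0ℚ ≡ p
  minus-zero = solve-∀ ringℚ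

  module Bases {M m n : ℕ} (A : Fin m → Vect M) where

    -- A basis in the sense of the simplex method, for the span of the generators `A`, which may be
    -- smaller than ℚ^M. The pairings of `A l` with the `U i` are the entries of the tableau.
    record Basis : Set where
      field
        B    : Fin n → Fin m
        U    : Fin n → Vect M
        dual : Dual U (A ∘ B)
        span : ∀ l t → A l t ≡ lc (λ i → dot (U i) (A l)) (A ∘ B) t
    open Basis public

    InSpan : Vect M → Set
    InSpan x = Σ[ c ∈ (Fin m → ℚ) ] ∀ t → lc c A t ≡ x t

    cone⇒span : ∀ {x} → Cone A x → InSpan x
    cone⇒span (c , _ , e) = c , e

    gen-span : ∀ l → InSpan (A l)
    gen-span l = cone⇒span (cone-gen A l)

    expand-gen : ∀ b l y → dot y (A l) ≡ sumℚ (λ i → dot (U b i) (A l) * dot y (A (B b i)))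
    expand-gen b l y = dot-congʳ y (span b l) ∙ dot-lcʳ y (λ i → dot (U b i) (A l)) (A ∘ B b)

    expand : ∀ b {x} → InSpan x → ∀ y → dot y x ≡ sumℚ (λ i → dot (U b i) x * dot y (A (B b i)))
    expand b {x} (c , e) y = begin
      dot y x         ≡⟨ dot-congʳ y (λ t → sym (e t)) ⟩
      dot y (lc c A)  ≡⟨ dot-lcʳ y c A ⟩
      sumℚ (λ l → c l * dot y (A l))
        ≡⟨ sum-cong (λ l → cong (c l *_) (expand-gen b l y) ∙ sym (sum-*ˡ (c l) (λ i → dot (U b i) (A l) * dot y (A (B b i))))) ⟩
      sumℚ (λ l → sumℚ (λ i → c l * (dot (U b i) (A l) * dot y (A (B b i)))))
        ≡⟨ sum-swap (λ l i → c l * (dot (U b i) (A l) * dot y (A (B b i)))) ⟩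
      sumℚ (λ i → sumℚ (λ l → c l * (dot (U b i) (A l) * dot y (A (B b i)))))
        ≡⟨ sum-cong (λ i → sum-cong (λ l → sym (*-assoc (c l) (dot (U b i) (A l)) (dot y (A (B b i)))))
             ∙ sum-*ʳ (dot y (A (B b i))) (λ l → c l * dot (U b i) (A l))
               ∙ cong (_* dot y (A (B b i))) (sym (dot-lcʳ (U b i) c A) ∙ dot-congʳ (U b i) e)) ⟩
      sumℚ (λ i → dot (U b i) x * dot y (A (B b i))) ∎
      where open ≡-Reasoning

    agree : ∀ b y z → (∀ i → dot y (A (B b i)) ≡ dot z (A (B b i))) → ∀ {x} → InSpan x → dot y x ≡ dot z x
    agree b y z h {x} sp = expand b sp y
      ∙ sum-cong (λ i → cong (dot (U b i) x *_) (h i)) ∙ sym (expand b sp z)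

    B-injective : ∀ b {i j} → B b i ≡ B b j → i ≡ j
    B-injective b {i} {j} e with i ≟ᶠ j
    ... | yes p = p
    ... | no np = ⊥-elim (0<⇒≢0 0<1 (sym (δ-refl i) ∙ sym (dual b i i)
                    ∙ cong (λ l → dot (U b i) (A l)) e ∙ dual b i j ∙ δ-≢ np))

    -- The functionals are free off the span of `A`, so two bases with the same members can be
    -- compared only through their values on the span.
    U-unique : ∀ b b′ → (∀ i → B b i ≡ B b′ i) → ∀ {x} → InSpan x → ∀ i → dot (U b i) x ≡ dot (U b′ i) x
    U-unique b b′ h sp i = agree b (U b i) (U b′ i) (λ j → dual b i j
      ∙ sym (cong (λ l → dot (U b′ i) (A l)) (h j) ∙ dual b′ i j)) sp

    basis? : ∀ f → (Σ[ b ∈ Basis ] ∀ i → B b i ≡ f i) ⊎ (∀ b → ¬ (∀ i → B b i ≡ f i))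
    basis? f with dual-or-dependent (A ∘ f)
    ... | inj₂ (c , (i , ci≢0) , e) = inj₂ λ b h → ci≢0 (dual⇒independent {U = U b} {b = A ∘ B b} (dual b) c
            (λ t → sum-cong (λ j → cong (λ l → c j * A l t) (h j)) ∙ e t) i)
    ... | inj₁ (U′ , d) with all? (λ l → all? (λ t → A l t ≟ lc (λ i → dot (U′ i) (A l)) (A ∘ f) t))
    ...   | yes s = inj₁ (record { B = f ; U = U′ ; dual = d ; span = s } , λ _ → refl)
    ...   | no ¬s = inj₂ λ b h → ¬s λ l t → span b l t
              ∙ sum-cong (λ i → cong₂ (λ u k → u * A k t)
                (agree b (U b i) (U′ i) (λ j → dual b i j ∙ sym (cong (λ k → dot (U′ i) (A k)) (h j) ∙ d i j)) (gen-span l)) (h i))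

    private
      collect : List (Fin n → Fin m) → List Basis
      collect [] = []
      collect (f ∷ fs) with basis? f
      ... | inj₁ (b , _) = b ∷ collect fs
      ... | inj₂ _       = collect fs

      collect-complete : ∀ b fs → Any (λ f → ∀ i → f i ≡ B b i) fs → Any (λ b′ → ∀ i → B b′ i ≡ B b i) (collect fs)
      collect-complete b (f ∷ fs) (here h) with basis? f
      ... | inj₁ (b′ , e) = here (λ i → e i ∙ h i)
      ... | inj₂ none     = ⊥-elim (none b (λ i → sym (h i)))
      collect-complete b (f ∷ fs) (there p) with basis? f
      ... | inj₁ (b′ , e) = there (collect-complete b fs p)
      ... | inj₂ none     = collect-complete b fs p

    abstract
      bases : List Basis
      bases = collect (tuples n m)

      bases-complete : ∀ b → ∃[ b′ ] b′ ∈ bases × (∀ i → B b′ i ≡ B b i)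
      bases-complete b = find (collect-complete b (tuples n m) (tuples-complete n m (B b)))

    module Pivot (b : Basis) (i : Fin n) (j : Fin m) (a≢0 : dot (U b i) (A j) ≢ 0ℚ) where
      private
        a r : ℚ
        a = dot (U b i) (A j)
        r = inv a

      -- The multipliers of a Gauss-Jordan step. The term `δ k i` treats the pivot row together with
      -- the others: for k = i the new row U i - e i · U i is U i / a.
      e : Fin n → ℚ
      e k = (dot (U b k) (A j) - δ k i) * r

      B′ : Fin n → Fin m
      B′ k with k ≟ᶠ i
      ... | yes _ = j
      ... | no _  = B b k

      B′-eq : ∀ {k} → k ≡ i → B′ k ≡ j
      B′-eq {k} h with k ≟ᶠ i
      ... | yes _ = refl
      ... | no np = ⊥-elim (np h)

      B′-neq : ∀ {k} → k ≢ i → B′ k ≡ B b k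
      B′-neq {k} h with k ≟ᶠ i
      ... | yes p = ⊥-elim (h p)
      ... | no _ = refl

      U′ : Fin n → Vect M
      U′ k t = U b k t - e k * U b i t

      U′-value : ∀ k x → dot (U′ k) x ≡ dot (U b k) x - e k * dot (U b i) x
      U′-value k x = dot-subˡ (U b k) (U b i) (e k) x

      private
        dual′ : Dual U′ (A ∘ B′)
        dual′ k l with l ≟ᶠ i
        ... | yes refl = U′-value k (A j) ∙ eq (dot (U b k) (A j)) (δ k l) r a
                ∙ cong (λ z → dot (U b k) (A j) - (dot (U b k) (A j) - δ k l) * z) (inv-* a≢0) ∙ eq′ (dot (U b k) (A j)) (δ k l)
          where eq : ∀ u d r a → u - ((u - d) * r) * a ≡ u - (u - d) * (a * r)
                eq = solve-∀ ringℚ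
                eq′ : ∀ u d → u - (u - d) * 1ℚ ≡ d
                eq′ = solve-∀ ringℚ
        ... | no l≢i = U′-value k (A (B b l)) ∙ cong₂ (λ z w → z - e k * w) (dual b k l) (dual b i l ∙ δ-≢ (λ p → l≢i (sym p)))
                ∙ eq (δ k l) (e k)
          where eq : ∀ d b → d - b * 0ℚ ≡ d
                eq = solve-∀ ringℚ

        A-B′ : ∀ k t → A (B′ k) t ≡ A (B b k) t + (A j t - A (B b i) t) * δ k i
        A-B′ k t with k ≟ᶠ i
        ... | yes refl = sym (cong (λ z → A (B b k) t + (A j t - A (B b k) t) * z) (δ-refl k) ∙ eq (A (B b k) t) (A j t))
          where eq : ∀ x y → x + (y - x) * 1ℚ ≡ y
                eq = solve-∀ ringℚ
        ... | no np = sym (cong (λ z → A (B b k) t + (A j t - A (B b i) t) * z) (δ-≢ np) ∙ eq (A (B b k) t) (A j t - A (B b i) t))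
          where eq : ∀ x y → x + y * 0ℚ ≡ x
                eq = solve-∀ ringℚ

        span′ : ∀ l t → A l t ≡ lc (λ k → dot (U′ k) (A l)) (A ∘ B′) t
        span′ l t = sym (begin
          sumℚ (λ k → dot (U′ k) (A l) * A (B′ k) t)
            ≡⟨ sum-cong (λ k → cong₂ _*_ (U′-value k (A l)) (A-B′ k t)
                 ∙ eq₁ (u k) (dot (U b k) (A j)) (δ k i) r (u i) (A (B b k) t) Δ) ⟩
          sumℚ (λ k → (u k * A (B b k) t - (u i * r) * (dot (U b k) (A j) * A (B b k) t))
                      + ((u i * r) * A (B b k) t + (u k - ((dot (U b k) (A j) - δ k i) * r) * u i) * Δ) * δ k i)
            ≡⟨ sum-+ (λ k → u k * A (B b k) t - (u i * r) * (dot (U b k) (A j) * A (B b k) t))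
                 (λ k → ((u i * r) * A (B b k) t + (u k - ((dot (U b k) (A j) - δ k i) * r) * u i) * Δ) * δ k i) ⟩
          sumℚ (λ k → u k * A (B b k) t - (u i * r) * (dot (U b k) (A j) * A (B b k) t))
            + sumℚ (λ k → ((u i * r) * A (B b k) t + (u k - ((dot (U b k) (A j) - δ k i) * r) * u i) * Δ) * δ k i)
            ≡⟨ cong₂ _+_ (sum-- (λ k → u k * A (B b k) t) (λ k → (u i * r) * (dot (U b k) (A j) * A (B b k) t))
                 ∙ cong₂ _-_ (sym (span b l t))
                 (sum-*ˡ (u i * r) (λ k → dot (U b k) (A j) * A (B b k) t) ∙ cong ((u i * r) *_) (sym (span b j t))))
                 (sum-δ (λ k → (u i * r) * A (B b k) t + (u k - ((dot (U b k) (A j) - δ k i) * r) * u i) * Δ) i) ⟩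
          (A l t - (u i * r) * A j t) + ((u i * r) * A (B b i) t + (u i - ((a - δ i i) * r) * u i) * Δ)
            ≡⟨ cong (λ z → (A l t - (u i * r) * A j t) + ((u i * r) * A (B b i) t + (u i - ((a - z) * r) * u i) * Δ)) (δ-refl i) ⟩
          (A l t - (u i * r) * A j t) + ((u i * r) * A (B b i) t + (u i - ((a - 1ℚ) * r) * u i) * Δ)
            ≡⟨ eq₂ (A l t) (u i) r a (A j t) (A (B b i) t) ⟩
          A l t + (u i - u i * (a * r)) * (A j t - A (B b i) t)
            ≡⟨ cong (λ z → A l t + (u i - u i * z) * (A j t - A (B b i) t)) (inv-* a≢0) ⟩
          A l t + (u i - u i * 1ℚ) * (A j t - A (B b i) t)
            ≡⟨ eq₃ (A l t) (u i) (A j t - A (B b i) t) ⟩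
          A l t ∎)
          where
          open ≡-Reasoning
          u : Fin n → ℚ
          u k = dot (U b k) (A l)
          Δ : ℚ
          Δ = A j t - A (B b i) t
          eq₁ : ∀ u v d r w x D → (u - ((v - d) * r) * w) * (x + D * d)
                ≡ (u * x - (w * r) * (v * x)) + ((w * r) * x + (u - ((v - d) * r) * w) * D) * d
          eq₁ = solve-∀ ringℚ
          eq₂ : ∀ l u r a j x → (l - (u * r) * j) + ((u * r) * x + (u - ((a - 1ℚ) * r) * u) * (j - x))
                ≡ l + (u - u * (a * r)) * (j - x)
          eq₂ = solve-∀ ringℚ
          eq₃ : ∀ l u d → l + (u - u * 1ℚ) * d ≡ l
          eq₃ = solve-∀ ringℚ

      pivot : Basis
      pivot = record { B = B′ ; U = U′ ; dual = dual′ ; span = span′ }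

    -- Linear programming with costs c: Y is the dual solution of a basis, red its reduced costs

    Y : (Fin m → ℚ) → Basis → Vect M
    Y c b = lc (λ i → c (B b i)) (U b)

    Y-value : ∀ c b x → dot (Y c b) x ≡ sumℚ (λ i → c (B b i) * dot (U b i) x)
    Y-value c b x = dot-lcˡ (λ i → c (B b i)) (U b) x

    Y-basic : ∀ c b i → dot (Y c b) (A (B b i)) ≡ c (B b i)
    Y-basic c b i = Y-value c b (A (B b i)) ∙ sum-cong (λ k → cong (c (B b k) *_) (dual b k i))
      ∙ sum-δ (λ k → c (B b k)) i

    red : (Fin m → ℚ) → Basis → Fin m → ℚ
    red c b l = c l - dot (Y c b) (A l)

    Feasible : (Fin m → ℚ) → Basis → Set
    Feasible c b = ∀ l → 0ℚ ≤ red c b l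

    feasible? : ∀ c b → Dec (Feasible c b)
    feasible? c b = all? (λ l → 0ℚ ≤? red c b l)

    Y-tuple : ∀ c b b′ → (∀ i → B b i ≡ B b′ i) → ∀ {x} → InSpan x → dot (Y c b) x ≡ dot (Y c b′) x
    Y-tuple c b b′ h {x} sp = Y-value c b x ∙ sum-cong (λ i → cong₂ _*_ (cong c (h i)) (U-unique b b′ h sp i))
      ∙ sym (Y-value c b′ x)

    red-tuple : ∀ c b b′ → (∀ i → B b i ≡ B b′ i) → ∀ l → red c b l ≡ red c b′ l
    red-tuple c b b′ h l = cong (λ z → c l - z) (Y-tuple c b b′ h (gen-span l))

    -- Dual nondegeneracy. It makes every dual simplex step strictly improving, and lets a dual
    -- solution determine which generators are basic.
    GenericCost : (Fin m → ℚ) → Set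
    GenericCost c = ∀ b l → (∀ i → l ≢ B b i) → red c b l ≢ 0ℚ

    -- The point avoids the facet hyperplanes of all basic cones, so a direction towards it decides,
    -- for each facet, on which side a point of that facet is counted.
    GenericPoint : Vect M → Set
    GenericPoint q = ∀ b i → dot (U b i) q ≢ 0ℚ

    private
      -- The reduced cost of `l` is linear in the costs, and this is its coefficient vector. Generic
      -- costs thus have to avoid finitely many hyperplanes.
      F : Basis → Fin m → Vect m
      F b l k = δ k l - lc (λ i → dot (U b i) (A l)) (λ i k → δ k (B b i)) k

      F-value : ∀ b l c → dot (F b l) c ≡ red c b l
      F-value b l c = dot-minus (λ k → δ k l) (lc (λ i → dot (U b i) (A l)) (λ i k → δ k (B b i))) c
        ∙ cong₂ _-_ (dot-δ l c) ((dot-lcˡ (λ i → dot (U b i) (A l)) (λ i k → δ k (B b i)) c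
          ∙ sum-cong (λ i → *-comm (dot (U b i) (A l)) (dot (λ k → δ k (B b i)) c) ∙ cong (_* dot (U b i) (A l)) (dot-δ (B b i) c))
            ∙ sym (Y-value c b (A l))))

      basic? : ∀ b l → Dec (∃[ i ] l ≡ B b i)
      basic? b l = any? (λ i → l ≟ᶠ B b i)

      -- For basic `l` the reduced cost is identically zero and cannot be avoided. A coordinate
      -- functional stands in for it, so that all functionals in the list are nonzero.
      F⁺ : Basis → Fin m → Vect m
      F⁺ b l with basic? b l
      ... | yes _ = λ k → δ k l
      ... | no _  = F b l

      F⁺-nonzero : ∀ b l → ∃[ k ] F⁺ b l k ≢ 0ℚ
      F⁺-nonzero b l with basic? b l
      ... | yes _ = l , λ e → 0<⇒≢0 0<1 (sym (δ-refl l) ∙ e)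
      ... | no h  = l , λ e → 0<⇒≢0 0<1 (sym (cong₂ _-_ (δ-refl l)
                      (sum-zero (λ i → cong (dot (U b i) (A l) *_) (δ-≢ (λ p → h (i , p))) ∙ *-zeroʳ (dot (U b i) (A l)))) ∙
                          minus-zero 1ℚ) ∙ e)

      F⁺-value : ∀ b l c → (∀ i → l ≢ B b i) → dot (F⁺ b l) c ≡ red c b l
      F⁺-value b l c h with basic? b l
      ... | yes (i , e) = ⊥-elim (h i e)
      ... | no _ = F-value b l c

    generic-cost : ∀ b₀ → ∃[ c ] GenericCost c × Feasible c b₀
    generic-cost b₀ = c , gen , feas
      where
      nonbasic = filter (λ l → ¬? (basic? b₀ l)) (allFin m)
      Gs = map (F b₀) nonbasic
      -- With cost 0 on the basis and 1 elsewhere, the dual solution is 0 and every nonbasic reduced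
      -- cost is 1. These strict inequalities persist while the costs are made generic.
      c⁰ : Vect m
      c⁰ l with basic? b₀ l
      ... | yes _ = 0ℚ
      ... | no _  = 1ℚ
      c⁰-basic : ∀ i → c⁰ (B b₀ i) ≡ 0ℚ
      c⁰-basic i with basic? b₀ (B b₀ i)
      ... | yes _ = refl
      ... | no h  = ⊥-elim (h (i , refl))
      c⁰-nonbasic : ∀ l → ¬ (∃[ i ] l ≡ B b₀ i) → c⁰ l ≡ 1ℚ
      c⁰-nonbasic l h with basic? b₀ l
      ... | yes p = ⊥-elim (h p)
      ... | no _  = refl
      positive : ∀ l → ¬ (∃[ i ] l ≡ B b₀ i) → 0ℚ < dot (F b₀ l) c⁰
      positive l h = subst (0ℚ <_) (sym value) 0<1
        where
        open ≡-Reasoning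
        value : dot (F b₀ l) c⁰ ≡ 1ℚ
        value = begin
          dot (F b₀ l) c⁰           ≡⟨ F-value b₀ l c⁰ ⟩
          red c⁰ b₀ l               ≡⟨ cong (λ z → c⁰ l - z) (Y-value c⁰ b₀ (A l)) ⟩
          c⁰ l - sumℚ (λ i → c⁰ (B b₀ i) * dot (U b₀ i) (A l))
            ≡⟨ cong₂ _-_ (c⁰-nonbasic l h) (sum-zero (λ i → cong (_* dot (U b₀ i) (A l)) (c⁰-basic i) ∙ *-zeroˡ (dot (U b₀ i) (A l)))) ⟩
          1ℚ - 0ℚ                   ≡⟨ minus-zero 1ℚ ⟩
          1ℚ ∎
      Gs>0 : All (λ G → 0ℚ < dot G c⁰) Gs
      Gs>0 = All.tabulate λ {G} G∈ → let (l , l∈ , e) = ∈-map⁻ (F b₀) G∈ in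
        subst (λ G → 0ℚ < dot G c⁰) (sym e) (positive l (proj₂ (∈-filter⁻ (λ l → ¬? (basic? b₀ l)) {xs = allFin m} l∈)))
      Fs≢0⁰ : All (λ F → ∃[ k ] F k ≢ 0ℚ) (cartesianProductWith F⁺ bases (allFin m))
      Fs≢0⁰ = All.tabulate λ {G} G∈ → let (b , l , _ , _ , e) = ∈-cartesianProductWith⁻ F⁺ bases (allFin m) G∈ in
          subst (λ G → ∃[ k ] G k ≢ 0ℚ) (sym e) (F⁺-nonzero b l)
      solution = avoid-all (cartesianProductWith F⁺ bases (allFin m)) Gs c⁰ Gs>0 Fs≢0⁰
      c = proj₁ solution
      gen : GenericCost c
      gen b l h e = let (b′ , b′∈ , eq) = bases-complete b in
        All.lookup (proj₂ (proj₂ solution)) (∈-cartesianProductWith⁺ F⁺ b′∈ (∈-allFin l))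
          (F⁺-value b′ l c (λ i p → h i (p ∙ eq i)) ∙ red-tuple c b′ b eq l ∙ e)
      feas : Feasible c b₀
      feas l = by-cases (basic? b₀ l)
        where
        by-cases : Dec (∃[ i ] l ≡ B b₀ i) → 0ℚ ≤ red c b₀ l
        by-cases (yes (i , refl)) = ≤-reflexive (sym (cong (λ z → c (B b₀ i) - z) (Y-basic c b₀ i) ∙ +-inverseʳ (c (B b₀ i))))
        by-cases (no h) = subst (0ℚ ≤_) (F-value b₀ l c) (<⇒≤ (All.lookup (proj₁ (proj₂ solution)) (∈-map⁺ (F b₀)
                     (∈-filter⁺ (λ l → ¬? (basic? b₀ l)) (∈-allFin l) h))))

    private
      row : Basis → Fin n → Vect m
      row b i k = dot (U b i) (A k)

    -- The point is sought through its coefficients τ, which keeps it in the span. The functional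
    -- `U b i` becomes a row of the tableau, nonzero because its entry at `B b i` is 1. The search
    -- starts from the sum of the generators of `b₀`, where all coordinates with respect to `b₀` are
    -- 1.
    generic-point : ∀ b₀ → ∃[ q ] InSpan q × GenericPoint q × (∀ i → 0ℚ < dot (U b₀ i) q)
    generic-point b₀ with avoid-all (cartesianProductWith row bases (allFin n)) (map (row b₀) (allFin n)) τ⁰
        (All.tabulate λ {G} G∈ → let (i , _ , e) = ∈-map⁻ (row b₀) G∈ in subst (λ G → 0ℚ < dot G τ⁰) (sym e) (positive i))
        (All.tabulate λ {G} G∈ → let (b , i , _ , _ , e) = ∈-cartesianProductWith⁻ row bases (allFin n) G∈ in
          subst (λ G → ∃[ k ] G k ≢ 0ℚ) (sym e) (B b i , λ z → 0<⇒≢0 0<1 (sym (δ-refl i) ∙ sym (dual b i i) ∙ z)))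
      where
      τ⁰ : Vect m
      τ⁰ = lc (λ _ → 1ℚ) (λ i k → δ k (B b₀ i))
      positive : ∀ i → 0ℚ < dot (row b₀ i) τ⁰
      positive i = subst (0ℚ <_) (sym (dot-comm (row b₀ i) τ⁰ ∙ dot-lcˡ (λ _ → 1ℚ) (λ i k → δ k (B b₀ i)) (row b₀ i)
        ∙ sum-cong (λ j → cong (1ℚ *_) (dot-δ (B b₀ j) (row b₀ i) ∙ dual b₀ i j)) ∙ sum-δ′ (λ _ → 1ℚ) i)) 0<1
    ... | τ , Gs>0 , Fs≢0 = lc τ A , (τ , λ _ → refl) , gen , λ i → subst (0ℚ <_) (value b₀ i)
        (All.lookup Gs>0 (∈-map⁺ (row b₀) (∈-allFin i)))
      where
      value : ∀ b i → dot (λ k → dot (U b i) (A k)) τ ≡ dot (U b i) (lc τ A)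
      value b i = dot-comm (λ k → dot (U b i) (A k)) τ ∙ sym (dot-lcʳ (U b i) τ A)
      gen : GenericPoint (lc τ A)
      gen b i e = let (b′ , b′∈ , eq) = bases-complete b in
        All.lookup Fs≢0 (∈-cartesianProductWith⁺ row b′∈ (∈-allFin i))
          (value b′ i ∙ U-unique b′ b eq (τ , λ _ → refl) i ∙ e)

-- Half-open decompositions of cones and covers by empty simplices

module Triangulations where

  open Rationals
  open LinearAlgebra
  open BasesOfCones
  open import Data.Rational using (0ℚ; 1ℚ; _+_; _*_; _-_; -_; _≤_; _<_)
  open ℚP hiding (neg-pos)

  length-filter-≤ : ∀ {X : Set} {P Q : Pred X 0ℓ} (P? : Decidable P) (Q? : Decidable Q) → (∀ {x} → P x → Q x) →
                    ∀ xs → length (filter P? xs) ℕ.≤ length (filter Q? xs)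
  length-filter-≤ P? Q? h [] = ℕ.z≤n
  length-filter-≤ P? Q? h (x ∷ xs) with P? x | Q? x
  ... | yes p | yes q = ℕ.s≤s (length-filter-≤ P? Q? h xs)
  ... | yes p | no ¬q = ⊥-elim (¬q (h p))
  ... | no ¬p | yes q = ℕP.m≤n⇒m≤1+n (length-filter-≤ P? Q? h xs)
  ... | no ¬p | no ¬q = length-filter-≤ P? Q? h xs

  length-filter-< : ∀ {X : Set} {P Q : Pred X 0ℓ} (P? : Decidable P) (Q? : Decidable Q) → (∀ {x} → P x → Q x) →
                    ∀ {x} xs → x ∈ xs → Q x → ¬ P x → length (filter P? xs) ℕ.< length (filter Q? xs)
  length-filter-< P? Q? h (x ∷ xs) (here refl) q′ ¬p′ with P? x | Q? x
  ... | yes p | _     = ⊥-elim (¬p′ p)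
  ... | no ¬p | no ¬q = ⊥-elim (¬q q′)
  ... | no ¬p | yes q = ℕ.s≤s (length-filter-≤ P? Q? h xs)
  length-filter-< P? Q? h (x ∷ xs) (there x∈) q′ ¬p′ with P? x | Q? x
  ... | yes p | yes q = ℕ.s≤s (length-filter-< P? Q? h xs x∈ q′ ¬p′)
  ... | yes p | no ¬q = ⊥-elim (¬q (h p))
  ... | no ¬p | yes q = ℕP.m≤n⇒m≤1+n (length-filter-< P? Q? h xs x∈ q′ ¬p′)
  ... | no ¬p | no ¬q = length-filter-< P? Q? h xs x∈ q′ ¬p′

  module HalfOpen {M m n : ℕ} (A : Fin m → Vect M) where
    open Bases {M} {m} {n} A

    dot-cone : ∀ y {x} → (∀ j → 0ℚ ≤ dot y (A j)) → Cone A x → 0ℚ ≤ dot y x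
    dot-cone y h (c , c≥0 , e) = subst (0ℚ ≤_) (sym (dot-lcʳ y c A) ∙ dot-congʳ y e)
      (sum-nonneg (λ i → 0≤-* (c≥0 i) (h i)))

    record Generic : Set where
      field
        cost           : Fin m → ℚ
        point          : Vect M
        start          : Basis
        point-span     : InSpan point
        cost-generic   : GenericCost cost
        point-generic  : GenericPoint point
        start-feasible : Feasible cost start
        point-interior : ∀ i → 0ℚ < dot (U start i) point

    abstract
      generic : ∀ b₀ → Σ[ g ∈ Generic ] Generic.start g ≡ b₀
      generic b₀ = let (c , cg , feas) = generic-cost b₀ ; (q , sp , qg , int) = generic-point b₀ in
        record { cost = c ; point = q ; start = b₀ ; point-span = sp ; cost-generic = cg ; point-generic = qg
               ; start-feasible = feas ; point-interior = int } , refl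

    module Decomposition (g : Generic) where
      open Generic g renaming (cost to c; point to q)

      -- The half-open cone of b: the x such that x + ε q is interior to the cone of b for all small ε > 0.
      K : Basis → Vect M → Set
      K b x = ∀ i → (0ℚ < dot (U b i) x) ⊎ (dot (U b i) x ≡ 0ℚ × 0ℚ < dot (U b i) q)

      K⇒nonneg : ∀ {b x} → K b x → ∀ i → 0ℚ ≤ dot (U b i) x
      K⇒nonneg k i with k i
      ... | inj₁ p = <⇒≤ p
      ... | inj₂ (e , _) = ≤-reflexive (sym e)

      nudge : ℚ → Vect M → Vect M
      nudge ε x t = x t + ε * q t

      nudge-value : ∀ y ε x → dot y (nudge ε x) ≡ dot y x + ε * dot y q
      nudge-value y ε x = dot-addʳ y x q ε

      nudge-span : ∀ {ε x} → InSpan x → InSpan (nudge ε x)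
      nudge-span {ε} (c , e) = let (d , f) = point-span in (λ i → c i + ε * d i) , λ t →
        sum-cong (λ i → eq (c i) ε (d i) (A i t)) ∙ sum-+ (λ i → c i * A i t) (λ i → ε * (d i * A i t))
          ∙ cong₂ _+_ (e t) (sum-*ˡ ε (λ i → d i * A i t) ∙ cong (ε *_) (f t))
        where eq : ∀ c k d a → (c + k * d) * a ≡ c * a + k * (d * a)
              eq = solve-∀ ringℚ

      abstract
        stable : ∀ bs x → ∃[ ε ] 0ℚ < ε × (∀ {b} → b ∈ bs → ∀ i →
                 (0ℚ < dot (U b i) x → 0ℚ < dot (U b i) (nudge ε x)) × (dot (U b i) x < 0ℚ → dot (U b i) (nudge ε x) < 0ℚ))
        stable bs x =
          let (ε , ε>0 , st) = small-ε (cartesianProductWith (λ b i → dot (U b i) x , dot (U b i) q) bs (allFin n)) in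
          ε , ε>0 , λ {b} b∈ i →
            let (p , p′) = All.lookup st (∈-cartesianProductWith⁺ (λ b i → dot (U b i) x , dot (U b i) q) b∈ (∈-allFin i)) ε ε>0
                  ≤-refl in
            (λ h → subst (0ℚ <_) (sym (nudge-value (U b i) ε x)) (p h)) , (λ h → subst (_< 0ℚ) (sym (nudge-value (U b i) ε x)) (p′ h))

      nudge-zero : ∀ y ε x → dot y x ≡ 0ℚ → dot y (nudge ε x) ≡ ε * dot y q
      nudge-zero y ε x e = nudge-value y ε x ∙ cong (_+ ε * dot y q) e ∙ +-identityˡ (ε * dot y q)

      K⇒pos : ∀ {b x ε} → 0ℚ < ε → (∀ i → 0ℚ < dot (U b i) x → 0ℚ < dot (U b i) (nudge ε x)) →
              K b x → ∀ i → 0ℚ < dot (U b i) (nudge ε x)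
      K⇒pos {b} {x} {ε} ε>0 st k i with k i
      ... | inj₁ p = st i p
      ... | inj₂ (e , p) = subst (0ℚ <_) (sym (nudge-zero (U b i) ε x e)) (0<-* ε>0 p)

      -- One step of the dual simplex method.
      improve : ∀ b → Feasible c b → ∀ i → (∃[ j ] dot (U b i) (A j) < 0ℚ) →
                ∃[ b′ ] Feasible c b′ × (∀ {x} → InSpan x → dot (U b i) x < 0ℚ → dot (Y c b) x < dot (Y c b′) x)
      improve b feas i (j₀ , a₀<0) = b′ , feas′ , increase
        where
        u : Fin m → ℚ
        u l = dot (U b i) (A l)
        candidates : List (Fin m)
        candidates = filter (λ l → u l <? 0ℚ) (allFin m)
        -- The ratio test. Subtracting θ `U b i` from the dual solution adds θ u l to the reduced
        -- cost of l, so each l with u l < 0 limits θ to this ratio; the least one keeps all reduced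
        -- costs nonnegative.
        ratio : Fin m → ℚ
        ratio l = red c b l * inv (- u l)
        choice : ∃[ j ] j ∈ candidates × (∀ {l} → l ∈ candidates → ratio j ≤ ratio l)
        choice = argmin ratio candidates (∈-filter⁺ (λ l → u l <? 0ℚ) (∈-allFin j₀) a₀<0)
        j : Fin m
        j = proj₁ choice
        uj<0 : u j < 0ℚ
        uj<0 = proj₂ (∈-filter⁻ (λ l → u l <? 0ℚ) {xs = allFin m} (proj₁ (proj₂ choice)))
        θ : ℚ
        θ = ratio j
        open Pivot b i j (<0⇒≢0 uj<0)
        b′ : Basis
        b′ = pivot
        j-nonbasic : ∀ k → j ≢ B b k
        j-nonbasic k e = <-irrefl refl (<-≤-trans uj<0 (subst (0ℚ ≤_) (sym (dual b i k) ∙ cong u (sym e)) (δ-nonneg i k)))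
        -- Generic costs enter here: `j` is nonbasic, so its reduced cost is not zero and the step
        -- has positive length.
        θ>0 : 0ℚ < θ
        θ>0 = 0<-* (≤∧≢⇒< (feas j) (λ e → cost-generic b j j-nonbasic (sym e))) (0<-inv (neg⁺ uj<0))
        -- The new dual solution in closed form. It has the right values on the new basis, and so
        -- agrees with `Y c b′` on the span.
        z : Vect M
        z t = Y c b t - θ * U b i t
        z-value : ∀ x → dot z x ≡ dot (Y c b) x - θ * dot (U b i) x
        z-value x = dot-subˡ (Y c b) (U b i) θ x
        basic : ∀ k → dot (Y c b′) (A (B′ k)) ≡ dot z (A (B′ k))
        basic k = by-cases (k ≟ᶠ i)
         where
         by-cases : Dec (k ≡ i) → dot (Y c b′) (A (B′ k)) ≡ dot z (A (B′ k))
         by-cases (yes e) = Y-basic c b′ k ∙ cong c (B′-eq e) ∙ sym (z-value (A j)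
                ∙ eq (c j) (dot (Y c b) (A j)) (inv (- u j)) (u j)
                ∙ cong (λ w → dot (Y c b) (A j) + (c j - dot (Y c b) (A j)) * w) (inv-* (0<⇒≢0 (neg⁺ uj<0)))
                  ∙ eq′ (dot (Y c b) (A j)) (c j)) ∙ cong (λ l → dot z (A l)) (sym (B′-eq e))
          where eq : ∀ c y r u → y - ((c - y) * r) * u ≡ y + (c - y) * (- u * r)
                eq = solve-∀ ringℚ
                eq′ : ∀ y c → y + (c - y) * 1ℚ ≡ c
                eq′ = solve-∀ ringℚ
         by-cases (no k≢i) = Y-basic c b′ k ∙ cong c (B′-neq k≢i) ∙ sym (z-value (A (B b k))
                ∙ cong₂ (λ v w → v - θ * w) (Y-basic c b k) (dual b i k ∙ δ-≢ (λ e → k≢i (sym e)))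
                  ∙ eq (c (B b k)) θ) ∙ cong (λ l → dot z (A l)) (sym (B′-neq k≢i))
          where eq : ∀ c t → c - t * 0ℚ ≡ c
                eq = solve-∀ ringℚ
        Y′-value : ∀ {x} → InSpan x → dot (Y c b′) x ≡ dot (Y c b) x - θ * dot (U b i) x
        Y′-value {x} sp = agree b′ (Y c b′) z basic sp ∙ z-value x
        increase : ∀ {x} → InSpan x → dot (U b i) x < 0ℚ → dot (Y c b) x < dot (Y c b′) x
        increase {x} sp neg = 0<-⇒< (subst (0ℚ <_) (eq (dot (Y c b) x) θ (dot (U b i) x)
            ∙ cong (λ w → w - dot (Y c b) x) (sym (Y′-value sp))) (0<-* θ>0 (neg⁺ neg)))
          where eq : ∀ y t u → t * - u ≡ (y - t * u) - y
                eq = solve-∀ ringℚ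
        red′ : ∀ l → red c b′ l ≡ red c b l + θ * u l
        red′ l = cong (λ w → c l - w) (Y′-value (gen-span l)) ∙ eq (c l) (dot (Y c b) (A l)) θ (u l)
          where eq : ∀ c y t u → c - (y - t * u) ≡ (c - y) + t * u
                eq = solve-∀ ringℚ
        feas′ : Feasible c b′
        feas′ l with u l <? 0ℚ
        ... | no ul≥0 = subst (0ℚ ≤_) (sym (red′ l)) (0≤-+ (feas l) (0≤-* (<⇒≤ θ>0) (≮⇒≥ ul≥0)))
        ... | yes ul<0 = subst (0ℚ ≤_) (eq (red c b l) (inv (- u l)) θ (u l)
                ∙ cong (λ w → red c b l * w + θ * u l) (inv-* (0<⇒≢0 (neg⁺ ul<0)))
                  ∙ cong (_+ θ * u l) (*-identityʳ (red c b l)) ∙ sym (red′ l))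
                (0≤-* (≤⇒0≤- (proj₂ (proj₂ choice) (∈-filter⁺ (λ l → u l <? 0ℚ) (∈-allFin l) ul<0))) (<⇒≤ (neg⁺ ul<0)))
          where eq : ∀ r i t u → (r * i - t) * - u ≡ r * (- u * i) + t * u
                eq = solve-∀ ringℚ

      point-nonneg : ∀ y → (∀ j → 0ℚ ≤ dot y (A j)) → 0ℚ ≤ dot y q
      point-nonneg y h = subst (0ℚ ≤_) (sym (expand start point-span y))
        (sum-nonneg (λ k → 0≤-* (<⇒≤ (point-interior k)) (h (B start k))))

      feasible-bases : List Basis
      feasible-bases = filter (feasible? c) bases

      find-feasible : ∀ b → Feasible c b → ∃[ b′ ] b′ ∈ feasible-bases × (∀ i → B b′ i ≡ B b i)
      find-feasible b feas = let (b′ , b′∈ , e) = bases-complete b in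
        b′ , ∈-filter⁺ (feasible? c) b′∈ (λ l → subst (0ℚ ≤_) (sym (red-tuple c b′ b e l)) (feas l)) , e

      private
        nonneg⇒K : ∀ b x ε → 0ℚ < ε → (∀ i → dot (U b i) x < 0ℚ → dot (U b i) (nudge ε x) < 0ℚ) →
                   (∀ i → ¬ (dot (U b i) (nudge ε x) < 0ℚ)) → K b x
        nonneg⇒K b x ε ε>0 st nonneg i with <-cmp 0ℚ (dot (U b i) x)
        ... | tri< p _ _ = inj₁ p
        ... | tri> _ _ p = ⊥-elim (nonneg i (st i p))
        ... | tri≈ _ e _ with <-cmp 0ℚ (dot (U b i) q)
        ...   | tri< p _ _ = inj₂ (sym e , p)
        ...   | tri≈ _ e′ _ = ⊥-elim (point-generic b i (sym e′))
        ...   | tri> _ _ p = ⊥-elim (nonneg i (subst (_< 0ℚ) (sym (nudge-zero (U b i) ε x (sym e)))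
                  (neg⁻¹ (subst (0ℚ <_) (eq ε (dot (U b i) q)) (0<-* ε>0 (neg⁺ p))))))
          where eq : ∀ e u → e * - u ≡ - (e * u)
                eq = solve-∀ ringℚ

        -- Suppose coordinate `i` of the nudged point is negative. If row `i` is negative at some
        -- generator, a dual simplex step increases the objective, against maximality. If not, row
        -- `i` is nonnegative on the whole cone, which contains the nudged point.
        optimal⇒nonneg : ∀ b x ε → Cone A x → 0ℚ < ε → Feasible c b →
                         (∀ {b′} → b′ ∈ feasible-bases → dot (Y c b′) (nudge ε x) ≤ dot (Y c b) (nudge ε x)) →
                         ∀ i → ¬ (dot (U b i) (nudge ε x) < 0ℚ)
        optimal⇒nonneg b x ε cx ε>0 feas mx i neg = by-cases (any? (λ j → dot (U b i) (A j) <? 0ℚ))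
          where
          sp : InSpan (nudge ε x)
          sp = nudge-span {ε} (cone⇒span cx)
          by-cases : Dec (∃[ j ] dot (U b i) (A j) < 0ℚ) → ⊥
          by-cases (no none) = <-irrefl refl (<-≤-trans neg (subst (0ℚ ≤_) (sym (nudge-value (U b i) ε x))
                (0≤-+ (dot-cone (U b i) all≥0 cx) (0≤-* (<⇒≤ ε>0) (point-nonneg (U b i) all≥0)))))
            where all≥0 : ∀ j → 0ℚ ≤ dot (U b i) (A j)
                  all≥0 j = ≮⇒≥ (λ lt → none (j , lt))
          by-cases (yes p) = let (b′ , feas′ , inc) = improve b feas i p
                                 (b″ , b″∈ , e) = find-feasible b′ feas′ in
                <-irrefl refl (<-≤-trans (inc sp neg) (subst (_≤ dot (Y c b) (nudge ε x)) (Y-tuple c b″ b′ e sp) (mx b″∈)))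

      abstract
        -- A maximiser of the dual objective over the finite list of feasible bases takes the place
        -- of a terminating run of the simplex method. The list is nonempty because it contains a
        -- copy of `start`.
        covered : ∀ {x} → Cone A x → ∃[ b ] b ∈ feasible-bases × K b x
        covered {x} cx =
          let (ε , ε>0 , st) = stable bases x
              (b , b∈ , mx) = argmax (λ b → dot (Y c b) (nudge ε x)) feasible-bases (proj₁ (proj₂ (find-feasible start start-feasible)))
              (b∈bases , feas) = ∈-filter⁻ (feasible? c) {xs = bases} b∈ in
          b , b∈ , nonneg⇒K b x ε ε>0 (λ i → proj₂ (st b∈bases i)) (optimal⇒nonneg b x ε cx ε>0 feas mx)

      SameDual : Basis → Basis → Set
      SameDual b b′ = ∀ l → dot (Y c b) (A l) ≡ dot (Y c b′) (A l)

      sameDual? : ∀ b b′ → Dec (SameDual b b′)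
      sameDual? b b′ = all? (λ l → dot (Y c b) (A l) ≟ dot (Y c b′) (A l))

      -- Complementary slackness. At the nudged point both bases have positive coordinates, and the
      -- difference of the two objectives is the combination of reduced costs in `gap`. Used in both
      -- directions, it shows that the objectives are equal; then all terms vanish, so the reduced
      -- costs of `b` are zero on `b′`.
      overlap⇒sameDual : ∀ {b b′} → Feasible c b → Feasible c b′ → ∀ {x} → InSpan x → K b x → K b′ x → SameDual b b′
      overlap⇒sameDual {b} {b′} fb fb′ {x} sp k k′ l = agree b′ (Y c b) (Y c b′) (λ i → tight i ∙ sym (Y-basic c b′ i)) (gen-span l)
        where
        nudged = stable (b ∷ b′ ∷ []) x
        ε = proj₁ nudged
        st = proj₂ (proj₂ nudged)
        x′ = nudge ε x
        pos : ∀ i → 0ℚ < dot (U b i) x′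
        pos = K⇒pos {b} {x} {ε} (proj₁ (proj₂ nudged)) (λ i → proj₁ (st (here refl) i)) k
        pos′ : ∀ i → 0ℚ < dot (U b′ i) x′
        pos′ = K⇒pos {b′} {x} {ε} (proj₁ (proj₂ nudged)) (λ i → proj₁ (st (there (here refl)) i)) k′
        gap : ∀ b b′ → sumℚ (λ i → dot (U b′ i) x′ * red c b (B b′ i)) ≡ dot (Y c b′) x′ - dot (Y c b) x′
        gap b b′ = sum-cong (λ i → eq (dot (U b′ i) x′) (c (B b′ i)) (dot (Y c b) (A (B b′ i))))
          ∙ sum-- (λ i → c (B b′ i) * dot (U b′ i) x′) (λ i → dot (U b′ i) x′ * dot (Y c b) (A (B b′ i)))
            ∙ cong₂ _-_ (sym (Y-value c b′ x′)) (sym (expand b′ (nudge-span {ε} sp) (Y c b)))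
          where eq : ∀ u c y → u * (c - y) ≡ c * u - u * y
                eq = solve-∀ ringℚ
        terms : ∀ i → 0ℚ ≤ dot (U b′ i) x′ * red c b (B b′ i)
        terms i = 0≤-* (<⇒≤ (pos′ i)) (fb (B b′ i))
        equal : dot (Y c b) x′ ≡ dot (Y c b′) x′
        equal = ≤-antisym (0≤-⇒≤ (subst (0ℚ ≤_) (gap b b′) (sum-nonneg terms)))
          (0≤-⇒≤ (subst (0ℚ ≤_) (gap b′ b) (sum-nonneg (λ i → 0≤-* (<⇒≤ (pos i)) (fb′ (B b i))))))
        tight : ∀ i → dot (Y c b) (A (B b′ i)) ≡ c (B b′ i)
        tight i = -‿zero⇒≡ (no-zero-divisor (sum-zero⇒zero terms (gap b b′
          ∙ cong (λ w → dot (Y c b′) x′ - w) equal ∙ +-inverseʳ (dot (Y c b′) x′)) i) (0<⇒≢0 (pos′ i)))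

      private
        -- Under generic costs a zero reduced cost occurs only at basic generators. Equal dual
        -- solutions therefore belong to the same generators, possibly in a different order, and
        -- `sameDual-row` matches the rows accordingly.
        sameDual-basic : ∀ {b b′} → SameDual b b′ → ∀ k → ∃[ i ] B b′ k ≡ B b i
        sameDual-basic {b} {b′} s k with any? (λ i → B b′ k ≟ᶠ B b i)
        ... | yes p = p
        ... | no h = ⊥-elim (cost-generic b (B b′ k) (λ i e → h (i , e))
                (cong (λ w → c (B b′ k) - w) (s (B b′ k) ∙ Y-basic c b′ k) ∙ +-inverseʳ (c (B b′ k))))

        sameDual-row : ∀ {b b′} → SameDual b b′ → ∀ {k i} → B b′ k ≡ B b i → ∀ {x} → InSpan x → dot (U b′ k) x ≡ dot (U b i) x
        sameDual-row {b} {b′} s {k} {i} e = agree b (U b′ k) (U b i) (λ p → row p (sameDual-basic {b′} {b} (λ l → sym (s l)) p))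
          where
          row : ∀ p → ∃[ l ] B b p ≡ B b′ l → dot (U b′ k) (A (B b p)) ≡ dot (U b i) (A (B b p))
          row p (l , e′) = cong (λ w → dot (U b′ k) (A w)) e′ ∙ dual b′ k l ∙ δ≡δ ∙ sym (dual b i p)
            where
            δ≡δ : δ k l ≡ δ i p
            δ≡δ with k ≟ᶠ l
            ... | yes refl = δ-refl k ∙ sym (cong (δ i) (B-injective b (e′ ∙ e)) ∙ δ-refl i)
            ... | no k≢l = δ-≢ k≢l ∙ sym (δ-≢ (λ i≡p → k≢l (B-injective b′ (e ∙ cong (B b) i≡p ∙ e′))))

      sameDual⇒K : ∀ {b b′} → SameDual b b′ → ∀ {x} → InSpan x → K b x → K b′ x
      sameDual⇒K {b} {b′} s {x} sp k l with sameDual-basic {b} {b′} s l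
      ... | i , e with k i
      ...   | inj₁ p = inj₁ (subst (0ℚ <_) (sym (sameDual-row {b} {b′} s e sp)) p)
      ...   | inj₂ (z , p) = inj₂ (sameDual-row {b} {b′} s e sp ∙ z , subst (0ℚ <_) (sym (sameDual-row {b} {b′} s e point-span)) p)

    module Graded (D : Vect M) (deg-A : ∀ l → dot D (A l) ≡ 1ℚ) where

      degree-sum : ∀ b {x} → InSpan x → dot D x ≡ sumℚ (λ i → dot (U b i) x)
      degree-sum b {x} sp = expand b sp D ∙ sum-cong (λ i → cong (dot (U b i) x *_) (deg-A (B b i)) ∙ *-identityʳ (dot (U b i) x))

      -- In any basis the coordinates of the point sum to its degree, which is positive. So every
      -- half-open cone contains the relative interior of at least one of its facets; this is what
      -- keeps the degrees in its box below d + 1.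
      point-positive : (g : Generic) → Fin n → ∀ b → ∃[ i ] 0ℚ < dot (U b i) (Generic.point g)
      point-positive g i₀ b with any? (λ i → 0ℚ <? dot (U b i) (Generic.point g))
      ... | yes p = p
      ... | no none = ⊥-elim (<-irrefl refl (<-≤-trans
              (sum-pos (λ i → <⇒≤ (Generic.point-interior g i)) i₀ (Generic.point-interior g i₀))
              (subst₂ _≤_ (sym (degree-sum b (Generic.point-span g)) ∙ degree-sum (Generic.start g) (Generic.point-span g))
                (sum-zero {n} (λ _ → refl)) (sum-mono (λ i → ≮⇒≥ (λ lt → none (i , lt)))))))

      Empty : Basis → Set
      Empty b = ∀ l → (∀ i → 0ℚ ≤ dot (U b i) (A l)) → ∃[ i ] l ≡ B b i

      inside? : ∀ b l → Dec (∀ i → 0ℚ ≤ dot (U b i) (A l))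
      inside? b l = all? (λ i → 0ℚ ≤? dot (U b i) (A l))

      size : Basis → ℕ
      size b = length (filter (inside? b) (allFin m))

      -- Subdivide the simplex at the inner point `A l`. The piece containing `x` arises by
      -- replacing the vertex `i` with the least ratio of the coordinates of `x` and `A l`. It lies
      -- in the old simplex and misses the vertex `i`, because `A l` is not a vertex and so has
      -- another positive coordinate.
      stellar : (∀ l l′ → (∀ t → A l t ≡ A l′ t) → l ≡ l′) → ∀ b {x} → Cone A x → (∀ i → 0ℚ ≤ dot (U b i) x) →
                ∀ l → (∀ i → 0ℚ ≤ dot (U b i) (A l)) → ¬ (∃[ i ] l ≡ B b i) →
                ∃[ b′ ] b′ ∈ bases × (∀ i → 0ℚ ≤ dot (U b′ i) x) × size b′ ℕ.< size b
      stellar A-injective b {x} cx b-pos l inside l-nonbasic = b″ , proj₁ (proj₂ counterpart) , b″-pos , smaller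
        where
        λ′ : Fin n → ℚ
        λ′ k = dot (U b k) (A l)
        sum≡1 : sumℚ λ′ ≡ 1ℚ
        sum≡1 = sym (degree-sum b (gen-span l)) ∙ deg-A l
        support = filter (λ k → 0ℚ <? λ′ k) (allFin n)
        zero-or-pos : ∀ k → ¬ (0ℚ < λ′ k) → λ′ k ≡ 0ℚ
        zero-or-pos k h = ≤-antisym (≮⇒≥ h) (inside k)
        nonempty : ∃[ k ] k ∈ support
        nonempty with any? (λ k → 0ℚ <? λ′ k)
        ... | yes (k , p) = k , ∈-filter⁺ (λ k → 0ℚ <? λ′ k) (∈-allFin k) p
        ... | no none = ⊥-elim (0<⇒≢0 0<1 (sym sum≡1 ∙ sum-zero (λ k → zero-or-pos k (λ p → none (k , p)))))
        ratio : Fin n → ℚ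
        ratio k = dot (U b k) x * inv (λ′ k)
        choice = argmin ratio support (proj₂ nonempty)
        i = proj₁ choice
        λi>0 : 0ℚ < λ′ i
        λi>0 = proj₂ (∈-filter⁻ (λ k → 0ℚ <? λ′ k) {xs = allFin n} (proj₁ (proj₂ choice)))
        open Pivot b i l (0<⇒≢0 λi>0)
        other : ∃[ k ] k ≢ i × 0ℚ < λ′ k
        other with any? (λ k → ¬? (k ≟ᶠ i) ×-dec (0ℚ <? λ′ k))
        ... | yes p = p
        ... | no none = ⊥-elim (l-nonbasic (i , A-injective l (B b i) same))
          where
          off : ∀ k → λ′ k ≡ λ′ k * δ k i
          off k with k ≟ᶠ i
          ... | yes refl = sym (cong (λ′ k *_) (δ-refl k) ∙ *-identityʳ (λ′ k))
          ... | no k≢i = zero-or-pos k (λ p → none (k , k≢i , p)) ∙ sym (cong (λ′ k *_) (δ-≢ k≢i) ∙ *-zeroʳ (λ′ k))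
          λi≡1 : λ′ i ≡ 1ℚ
          λi≡1 = sym (sum-δ λ′ i) ∙ sym (sum-cong off) ∙ sum≡1
          same : ∀ t → A l t ≡ A (B b i) t
          same t = span b l t ∙ sum-cong (λ k → cong (_* A (B b k) t) (off k) ∙ eq (λ′ k) (δ k i) (A (B b k) t))
            ∙ sum-δ (λ k → λ′ k * A (B b k) t) i ∙ cong (_* A (B b i) t) λi≡1 ∙ *-identityˡ (A (B b i) t)
            where eq : ∀ a d x → (a * d) * x ≡ (a * x) * d
                  eq = solve-∀ ringℚ
        pivot-pos : ∀ k → 0ℚ ≤ dot (U′ k) x
        pivot-pos k with k ≟ᶠ i | 0ℚ <? λ′ k
        ... | yes refl | _ = subst (0ℚ ≤_) (sym (U′-value k x ∙ cong (λ d → dot (U b k) x - (λ′ k - d) * inv (λ′ k) * dot (U b k)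
            x) (δ-refl k)
                ∙ eq (dot (U b k) x) (λ′ k) (inv (λ′ k)) ∙ cong (λ w → dot (U b k) x * (1ℚ - w) + dot (U b k) x * inv (λ′ k))
                    (inv-* (0<⇒≢0 λi>0))
                  ∙ eq′ (dot (U b k) x) (inv (λ′ k)))) (0≤-* (b-pos k) (<⇒≤ (0<-inv λi>0)))
          where eq : ∀ u a r → u - (a - 1ℚ) * r * u ≡ u * (1ℚ - a * r) + u * r
                eq = solve-∀ ringℚ
                eq′ : ∀ u r → u * (1ℚ - 1ℚ) + u * r ≡ u * r
                eq′ = solve-∀ ringℚ
        ... | no k≢i | yes p = subst (0ℚ ≤_) (sym (U′-value k x ∙ cong
            (λ d → dot (U b k) x - (λ′ k - d) * inv (λ′ i) * dot (U b i) x) (δ-≢ k≢i)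
                ∙ eq (dot (U b k) x) (λ′ k) (inv (λ′ i)) (dot (U b i) x)
                  ∙ cong (λ w → w - λ′ k * (dot (U b i) x * inv (λ′ i)))
                      (sym (*-identityʳ (dot (U b k) x)) ∙ cong (dot (U b k) x *_) (sym (inv-* (0<⇒≢0 p))))
                    ∙ eq′ (dot (U b k) x) (λ′ k) (inv (λ′ k)) (dot (U b i) x * inv (λ′ i))))
                (0≤-* (inside k) (≤⇒0≤- (proj₂ (proj₂ choice) (∈-filter⁺ (λ k → 0ℚ <? λ′ k) (∈-allFin k) p))))
          where eq : ∀ v a r u → v - (a - 0ℚ) * r * u ≡ v - a * (u * r)
                eq = solve-∀ ringℚ
                eq′ : ∀ v a s w → v * (a * s) - a * w ≡ a * (v * s - w)
                eq′ = solve-∀ ringℚ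
        ... | no k≢i | no h = subst (0ℚ ≤_) (sym (U′-value k x ∙ cong₂
            (λ d e → dot (U b k) x - (e - d) * inv (λ′ i) * dot (U b i) x) (δ-≢ k≢i) (zero-or-pos k h)
                ∙ eq (dot (U b k) x) (inv (λ′ i)) (dot (U b i) x))) (b-pos k)
          where eq : ∀ v r u → v - (0ℚ - 0ℚ) * r * u ≡ v
                eq = solve-∀ ringℚ
        counterpart = bases-complete pivot
        b″ = proj₁ counterpart
        B″≡ : ∀ k → B b″ k ≡ B′ k
        B″≡ = proj₂ (proj₂ counterpart)
        b″-pos : ∀ k → 0ℚ ≤ dot (U b″ k) x
        b″-pos k = subst (0ℚ ≤_) (sym (U-unique b″ pivot B″≡ (cone⇒span cx) k)) (pivot-pos k)
        row : ∀ k k′ → 0ℚ ≤ dot (U b k) (A (B′ k′))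
        row k k′ = by-cases (k′ ≟ᶠ i)
          where
          by-cases : Dec (k′ ≡ i) → 0ℚ ≤ dot (U b k) (A (B′ k′))
          by-cases (yes e) = subst (λ w → 0ℚ ≤ dot (U b k) (A w)) (sym (B′-eq e)) (inside k)
          by-cases (no h) = subst (λ w → 0ℚ ≤ dot (U b k) (A w)) (sym (B′-neq h)) (subst (0ℚ ≤_) (sym (dual b k k′)) (δ-nonneg k k′))
        shrink : ∀ {p} → (∀ k → 0ℚ ≤ dot (U b″ k) (A p)) → ∀ k → 0ℚ ≤ dot (U b k) (A p)
        shrink {p} h k = subst (0ℚ ≤_) (sym (expand-gen b″ p (U b k)))
          (sum-nonneg (λ k′ → 0≤-* (h k′) (subst (λ w → 0ℚ ≤ dot (U b k) (A w)) (sym (B″≡ k′)) (row k k′))))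
        -- At another k with λ k > 0, the old vertex `i` has new coordinate - λ k / λ i, which is
        -- negative.
        lost : ¬ (∀ k → 0ℚ ≤ dot (U b″ k) (A (B b i)))
        lost h = let (k , k≢i , p) = other in <-irrefl refl (<-≤-trans (0<-* p (0<-inv λi>0))
          (0≤-⇒≤ (subst (0ℚ ≤_) (U-unique b″ pivot B″≡ (gen-span (B b i)) k ∙ U′-value k (A (B b i))
            ∙ cong₂ (λ v w → v - (λ′ k - δ k i) * inv (λ′ i) * w) (dual b k i ∙ δ-≢ k≢i) (dual b i i ∙ δ-refl i)
              ∙ cong (λ d → 0ℚ - (λ′ k - d) * inv (λ′ i) * 1ℚ) (δ-≢ k≢i) ∙ eq (λ′ k) (inv (λ′ i))) (h k))))
          where eq : ∀ a r → 0ℚ - (a - 0ℚ) * r * 1ℚ ≡ 0ℚ - a * r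
                eq = solve-∀ ringℚ
        smaller : size b″ ℕ.< size b
        smaller = length-filter-< (inside? b″) (inside? b) shrink (allFin m) (∈-allFin (B b i))
          (λ k → subst (0ℚ ≤_) (sym (dual b k i)) (δ-nonneg k i)) lost

      private
        -- A basis whose simplex contains x and as few of the points A as possible is empty:
        -- otherwise a stellar subdivision at a further point of the simplex would lose a vertex.
        empty-covered′ : (∀ l l′ → (∀ t → A l t ≡ A l′ t) → l ≡ l′) → Basis → ∀ {x} → Cone A x →
                        ∃[ b ] Empty b × (∀ i → 0ℚ ≤ dot (U b i) x)
        empty-covered′ A-injective b₀ {x} cx = b , empty , b-pos
          where
          contains? : ∀ b → Dec (∀ i → 0ℚ ≤ dot (U b i) x)
          contains? b = all? (λ i → 0ℚ ≤? dot (U b i) x)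
          candidates = filter contains? bases
          initial : ∃[ b ] b ∈ candidates
          initial = let (g , _) = generic b₀
                        (b , b∈ , k) = Decomposition.covered g cx in
            b , ∈-filter⁺ contains? (proj₁ (∈-filter⁻ (feasible? (Generic.cost g)) {xs = bases} b∈)) (Decomposition.K⇒nonneg g {b} k)
          best = least size candidates (proj₂ initial)
          b = proj₁ best
          b-pos : ∀ i → 0ℚ ≤ dot (U b i) x
          b-pos = proj₂ (∈-filter⁻ contains? {xs = bases} (proj₁ (proj₂ best)))
          empty : Empty b
          empty l inside = decidable-stable (any? (λ i → l ≟ᶠ B b i)) λ nonbasic →
            absurd (stellar A-injective b cx b-pos l inside nonbasic)
            where
            absurd : ¬ (∃[ b′ ] b′ ∈ bases × (∀ i → 0ℚ ≤ dot (U b′ i) x) × size b′ ℕ.< size b)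
            absurd (b′ , b′∈ , pos , smaller) = ℕP.<⇒≱ smaller (proj₂ (proj₂ best) (∈-filter⁺ contains? b′∈ pos))

      abstract
        empty-covered : (∀ l l′ → (∀ t → A l t ≡ A l′ t) → l ≡ l′) → Basis → ∀ {x} → Cone A x →
                        ∃[ b ] Empty b × (∀ i → 0ℚ ≤ dot (U b i) x)
        empty-covered A-injective b₀ {x} cx = empty-covered′ A-injective b₀ {x} cx

-- Lattice points as graded elements of the cone

module LatticePoints where

  open Rationals
  open LinearAlgebra
  open BasesOfCones
  open Triangulations
  open import Data.Rational using (0ℚ; 1ℚ; _+_; _*_; _-_; -_; _≤_; _<_)
  open ℚP hiding (neg-pos)

  infixl 6 _⊕_ _⊖_
  infixl 7 _⊙_

  _⊕_ _⊖_ : ∀ {N} → Vec ℤ N → Vec ℤ N → Vec ℤ N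
  _⊕_ = V.zipWith ℤ._+_
  _⊖_ = V.zipWith ℤ._-_

  _⊙_ : ∀ {N} → ℤ → Vec ℤ N → Vec ℤ N
  k ⊙ v = V.map (k ℤ.*_) v

  vec-ext : ∀ {X : Set} {N} {a b : Vec X N} → (∀ t → lookup a t ≡ lookup b t) → a ≡ b
  vec-ext {a = []} {[]} h = refl
  vec-ext {a = x ∷ a} {y ∷ b} h = cong₂ _∷_ (h zero) (vec-ext (h ∘ suc))

  _≟ᵛ_ : ∀ {N} → DecidableEquality (Vec ℤ N)
  _≟ᵛ_ = V.≡-dec ℤ._≟_

  lookup-⊕ : ∀ {N} (a b : Vec ℤ N) t → lookup (a ⊕ b) t ≡ lookup a t ℤ.+ lookup b t
  lookup-⊕ a b t = V.lookup-zipWith ℤ._+_ t a b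

  lookup-⊖ : ∀ {N} (a b : Vec ℤ N) t → lookup (a ⊖ b) t ≡ lookup a t ℤ.- lookup b t
  lookup-⊖ a b t = V.lookup-zipWith ℤ._-_ t a b

  lookup-⊙ : ∀ {N} k (a : Vec ℤ N) t → lookup (k ⊙ a) t ≡ k ℤ.* lookup a t
  lookup-⊙ k a t = V.lookup-map t (k ℤ.*_) a

  lookup-zeros : ∀ {N} (t : Fin N) → lookup (zerosℤ {N}) t ≡ ℤ.+ 0
  lookup-zeros t = V.lookup-replicate t (ℤ.+ 0)

  ⊕-identityˡ : ∀ {N} (a : Vec ℤ N) → zerosℤ ⊕ a ≡ a
  ⊕-identityˡ a = V.zipWith-identityˡ ℤP.+-identityˡ a

  ⊕-identityʳ : ∀ {N} (a : Vec ℤ N) → a ⊕ zerosℤ ≡ a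
  ⊕-identityʳ a = V.zipWith-identityʳ ℤP.+-identityʳ a

  ⊕-assoc : ∀ {N} (a b c : Vec ℤ N) → (a ⊕ b) ⊕ c ≡ a ⊕ (b ⊕ c)
  ⊕-assoc = V.zipWith-assoc ℤP.+-assoc

  ⊕-comm : ∀ {N} (a b : Vec ℤ N) → a ⊕ b ≡ b ⊕ a
  ⊕-comm = V.zipWith-comm ℤP.+-comm

  ⊖-⊕ : ∀ {N} (a b : Vec ℤ N) → (a ⊖ b) ⊕ b ≡ a
  ⊖-⊕ a b = vec-ext λ t → lookup-⊕ (a ⊖ b) b t ∙ cong (ℤ._+ lookup b t) (lookup-⊖ a b t) ∙ eq (lookup a t) (lookup b t)
    where eq : ∀ x y → (x ℤ.- y) ℤ.+ y ≡ x
          eq = ℤR.solve-∀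

  ⊕-⊖ : ∀ {N} (a b : Vec ℤ N) → (a ⊕ b) ⊖ b ≡ a
  ⊕-⊖ a b = vec-ext λ t → lookup-⊖ (a ⊕ b) b t ∙ cong (ℤ._- lookup b t) (lookup-⊕ a b t) ∙ eq (lookup a t) (lookup b t)
    where eq : ∀ x y → (x ℤ.+ y) ℤ.- y ≡ x
          eq = ℤR.solve-∀

  lookup-sumVℚ : ∀ {k N} (c : Fin k → ℚ) (w : Fin k → Vec ℤ N) t →
                 lookup (sumVℚ (λ i → c i ·ℚ toℚv (w i))) t ≡ sumℚ (λ i → c i * ℤ→ℚ (lookup (w i) t))
  lookup-sumVℚ {zero}  c w t = V.lookup-replicate t 0ℚ
  lookup-sumVℚ {suc k} c w t = V.lookup-zipWith _+_ t (c zero ·ℚ toℚv (w zero)) (sumVℚ (λ i → c (suc i) ·ℚ toℚv (w (suc i))))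
    ∙ cong₂ _+_ (V.lookup-map t (c zero *_) (toℚv (w zero)) ∙ cong (c zero *_) (V.lookup-map t ℤ→ℚ (w zero)))
      (lookup-sumVℚ (c ∘ suc) (w ∘ suc) t)

  -- Homogenisation with the degree as coordinate 0: convexity and affine independence become
  -- statements about cones and linear independence.
  hom : ∀ {N} → Vec ℤ N → ℤ → Vect (suc N)
  hom a z zero    = ℤ→ℚ z
  hom a z (suc t) = ℤ→ℚ (lookup a t)

  hom-⊕ : ∀ {N} (a b : Vec ℤ N) z w t → hom (a ⊕ b) (z ℤ.+ w) t ≡ hom a z t + hom b w t
  hom-⊕ a b z w zero    = ℤ→ℚ-+ z w
  hom-⊕ a b z w (suc t) = cong ℤ→ℚ (lookup-⊕ a b t) ∙ ℤ→ℚ-+ (lookup a t) (lookup b t)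

  hom-⊙ : ∀ {N} k (a : Vec ℤ N) z t → hom (k ⊙ a) (k ℤ.* z) t ≡ ℤ→ℚ k * hom a z t
  hom-⊙ k a z zero    = ℤ→ℚ-* k z
  hom-⊙ k a z (suc t) = cong ℤ→ℚ (lookup-⊙ k a t) ∙ ℤ→ℚ-* k (lookup a t)

  hom-⊖ : ∀ {N} (a b : Vec ℤ N) z w t → hom (a ⊖ b) (z ℤ.- w) t ≡ hom a z t - hom b w t
  hom-⊖ a b z w zero    = ℤ→ℚ-+ z (ℤ.- w) ∙ cong (ℤ→ℚ z +_) (ℤ→ℚ-neg w)
  hom-⊖ a b z w (suc t) = cong ℤ→ℚ (lookup-⊖ a b t) ∙ ℤ→ℚ-+ (lookup a t) (ℤ.- lookup b t)
    ∙ cong (ℤ→ℚ (lookup a t) +_) (ℤ→ℚ-neg (lookup b t))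

  hom-injective : ∀ {N} {a b : Vec ℤ N} {z w} → (∀ t → hom a z t ≡ hom b w t) → a ≡ b
  hom-injective h = vec-ext (λ t → ℤ→ℚ-injective (h (suc t)))

  lc⇒sumV : ∀ {k N} (c : Fin k → ℚ) (w : Fin k → Vec ℤ N) {a z} → (∀ t → lc c (λ i → hom (w i) (ℤ.+ 1)) t ≡ hom a z t) →
            (sumℚ c ≡ ℤ→ℚ z) × (sumVℚ (λ i → c i ·ℚ toℚv (w i)) ≡ toℚv a)
  lc⇒sumV c w {a} h = sum-cong (λ i → sym (*-identityʳ (c i))) ∙ h zero ,
    vec-ext (λ t → lookup-sumVℚ c w t ∙ h (suc t) ∙ sym (V.lookup-map t ℤ→ℚ a))

  sumV⇒lc : ∀ {k N} (c : Fin k → ℚ) (w : Fin k → Vec ℤ N) {a z} → sumℚ c ≡ ℤ→ℚ z →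
            sumVℚ (λ i → c i ·ℚ toℚv (w i)) ≡ toℚv a → ∀ t → lc c (λ i → hom (w i) (ℤ.+ 1)) t ≡ hom a z t
  sumV⇒lc c w e f zero    = sum-cong (λ i → *-identityʳ (c i)) ∙ e
  sumV⇒lc c w {a} e f (suc t) = sym (lookup-sumVℚ c w t) ∙ cong (λ v → lookup v t) f ∙ V.lookup-map t ℤ→ℚ a

  affInd⇒independent : ∀ {k N} {w : Fin k → Vec ℤ N} → AffInd (λ i → toℚv (w i)) →
                       ∀ c → (∀ t → lc c (λ i → hom (w i) (ℤ.+ 1)) t ≡ 0ℚ) → ∀ i → c i ≡ 0ℚ
  affInd⇒independent {w = w} h c e = h c (sum-cong (λ i → sym (*-identityʳ (c i))) ∙ e zero)
    (vec-ext (λ t → lookup-sumVℚ c w t ∙ e (suc t) ∙ sym (V.lookup-replicate t 0ℚ)))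

  dual⇒affInd : ∀ {k N} {w : Fin k → Vec ℤ N} {U} → Dual U (λ i → hom (w i) (ℤ.+ 1)) → AffInd (λ i → toℚv (w i))
  dual⇒affInd {w = w} {U} d c e f = dual⇒independent {U = U} {b = λ i → hom (w i) (ℤ.+ 1)} d c eqn
    where eqn : ∀ t → lc c (λ i → hom (w i) (ℤ.+ 1)) t ≡ 0ℚ
          eqn zero    = sum-cong (λ i → *-identityʳ (c i)) ∙ e
          eqn (suc t) = sym (lookup-sumVℚ c w t) ∙ cong (λ v → lookup v t) f ∙ V.lookup-replicate t 0ℚ

  independent⇒dual : ∀ {k M} (b : Fin k → Vect M) → (∀ c → (∀ t → lc c b t ≡ 0ℚ) → ∀ i → c i ≡ 0ℚ) →
                     Σ[ U ∈ (Fin k → Vect M) ] Dual U b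
  independent⇒dual b h with dual-or-dependent b
  ... | inj₁ p = p
  ... | inj₂ (c , (i , nz) , e) = ⊥-elim (nz (h c e i))

  infixr 5 _◂_
  _◂_ : ∀ {X : Set} {k} → X → (Fin k → X) → Fin (suc k) → X
  (x ◂ f) zero    = x
  (x ◂ f) (suc i) = f i

  -- The coefficient of `p` cannot vanish, since the others would then form a dependency of the
  -- independent family `b`; dividing by it solves for `p`.
  dependent⇒span : ∀ {k M} {U b : Fin k → Vect M} {p} → Dual U b → ∀ c → (∃[ i ] c i ≢ 0ℚ) →
                   (∀ t → lc c (p ◂ b) t ≡ 0ℚ) → Σ[ c ∈ (Fin k → ℚ) ] ∀ t → lc c b t ≡ p t
  dependent⇒span {k} {U = U} {b} {p} d c (i , nz) e = (λ i → - inv c₀ * c (suc i)) , λ t →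
      sum-cong (λ i → *-assoc (- inv c₀) (c (suc i)) (b i t)) ∙ sum-*ˡ (- inv c₀) (λ i → c (suc i) * b i t)
        ∙ eq c₀ (inv c₀) (p t) (lc (c ∘ suc) b t) ∙ cong₂ (λ x y → x * p t - inv c₀ * y) (inv-* c₀≢0) (e t) ∙ eq′ (p t) (inv c₀)
    where
    c₀ = c zero
    eq : ∀ c r p s → - r * s ≡ (c * r) * p - r * (c * p + s)
    eq = solve-∀ ringℚ
    eq′ : ∀ p r → 1ℚ * p - r * 0ℚ ≡ p
    eq′ = solve-∀ ringℚ
    rest : c₀ ≡ 0ℚ → ∀ i → c (suc i) ≡ 0ℚ
    rest z = dual⇒independent {U = U} {b = b} d (c ∘ suc) λ t →
      sym (+-identityˡ (lc (c ∘ suc) b t)) ∙ cong (_+ lc (c ∘ suc) b t) (sym (cong (_* p t) z ∙ *-zeroˡ (p t))) ∙ e t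
    all0 : c₀ ≡ 0ℚ → ∀ i → c i ≡ 0ℚ
    all0 z zero    = z
    all0 z (suc i) = rest z i
    c₀≢0 : c₀ ≢ 0ℚ
    c₀≢0 z = nz (all0 z i)

  span-coordinates : ∀ {k M} {U b : Fin k → Vect M} {p} → Dual U b → ∀ c → (∀ t → lc c b t ≡ p t) →
                     ∀ t → p t ≡ lc (λ i → dot (U i) p) b t
  span-coordinates {U = U} {b} {p} d c e t = sym (e t) ∙ sum-cong (λ i → cong (_* b i t)
    (sym (dual-lc {U = U} {b = b} d c i) ∙ dot-congʳ (U i) e))

  unique-lookup : ∀ {X : Set} {xs : List X} → Unique xs → ∀ i j → L.lookup xs i ≡ L.lookup xs j → i ≡ j
  unique-lookup (h ∷ u) zero    zero    e = refl
  unique-lookup (h ∷ u) zero    (suc j) e = ⊥-elim (All.lookup h (∈-lookup j) e)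
  unique-lookup (h ∷ u) (suc i) zero    e = ⊥-elim (All.lookup h (∈-lookup i) (sym e))
  unique-lookup (h ∷ u) (suc i) (suc j) e = cong suc (unique-lookup u i j e)

  interval : ℕ → List ℤ
  interval R = map (ℤ.+_) (upTo (suc R)) L.++ map -[1+_] (upTo R)

  ∈-interval : ∀ {R} z → ℤ.∣ z ∣ ℕ.≤ R → z ∈ interval R
  ∈-interval (ℤ.+ n)  h = ∈-++⁺ˡ (∈-map⁺ (ℤ.+_) (∈-upTo⁺ (ℕ.s≤s h)))
  ∈-interval -[1+ n ] h = ∈-++⁺ʳ _ (∈-map⁺ -[1+_] (∈-upTo⁺ h))

  cube : ∀ N → ℕ → List (Vec ℤ N)
  cube zero    R = [] ∷ []
  cube (suc N) R = cartesianProductWith _∷_ (interval R) (cube N R)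

  ∈-cube : ∀ {N R} (a : Vec ℤ N) → (∀ t → ℤ.∣ lookup a t ∣ ℕ.≤ R) → a ∈ cube N R
  ∈-cube []      h = here refl
  ∈-cube (z ∷ a) h = ∈-cartesianProductWith⁺ _∷_ (∈-interval z (h zero)) (∈-cube a (h ∘ suc))

  sumℕ : ∀ {k} → (Fin k → ℕ) → ℕ
  sumℕ {zero}  f = 0
  sumℕ {suc k} f = f zero ℕ.+ sumℕ (f ∘ suc)

  ≤sumℕ : ∀ {k} (f : Fin k → ℕ) i → f i ℕ.≤ sumℕ f
  ≤sumℕ f zero    = ℕP.m≤m+n (f zero) _
  ≤sumℕ f (suc i) = ℕP.≤-trans (≤sumℕ (f ∘ suc) i) (ℕP.m≤n+m _ (f zero))

  ∣z∣≤⇒ : ∀ z {R} → z ℤ.≤ ℤ.+ R → ℤ.- z ℤ.≤ ℤ.+ R → ℤ.∣ z ∣ ℕ.≤ R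
  ∣z∣≤⇒ (ℤ.+ n)  h _ = ℤP.drop‿+≤+ h
  ∣z∣≤⇒ -[1+ n ] _ h = ℤP.drop‿+≤+ h

  ≤∣z∣ : ∀ z → z ℤ.≤ ℤ.+ ℤ.∣ z ∣
  ≤∣z∣ (ℤ.+ n)  = ℤP.≤-refl
  ≤∣z∣ -[1+ n ] = ℤ.-≤+

  -≤∣z∣ : ∀ z → ℤ.- z ℤ.≤ ℤ.+ ℤ.∣ z ∣
  -≤∣z∣ z = subst (λ n → ℤ.- z ℤ.≤ ℤ.+ n) (ℤP.∣-i∣≡∣i∣ z) (≤∣z∣ (ℤ.- z))

  module Lattices {N : ℕ} (P : Polytope N) where

    V⁺ : Fin (suc (m P)) → Vect (suc N)
    V⁺ i = hom (vert P i) (ℤ.+ 1)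

    -- The lattice points of k P, as elements of degree `k` of the cone. The record keeps `k` and
    -- `a` recoverable from the type, which the bare cone membership would not.
    record C (k : ℕ) (a : Vec ℤ N) : Set where
      constructor inC
      field cone : Cone V⁺ (hom a (ℤ.+ k))
    open C public

    inCone⇒cone : ∀ {a z} → InCone P (a , z) → Cone V⁺ (hom a z)
    inCone⇒cone (c , c≥0 , e , f) = c , c≥0 , sumV⇒lc c (vert P) e f

    cone⇒inCone : ∀ {a z} → Cone V⁺ (hom a z) → InCone P (a , z)
    cone⇒inCone {a} {z} (c , c≥0 , e) = c , c≥0 , lc⇒sumV c (vert P) e

    cone-degree : ∀ {a z} → Cone V⁺ (hom a z) → ∃[ k ] z ≡ ℤ.+ k
    cone-degree {z = z} (c , c≥0 , e) with z | ℤ→ℚ-cancel-≤ {ℤ.+ 0} {z} (subst (0ℚ ≤_) (e zero) (sum-nonneg (λ i → 0≤-* (c≥0 i) 0≤1)))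
    ... | ℤ.+ k | _ = k , refl

    C-⊕ : ∀ {k l a b} → C k a → C l b → C (k ℕ.+ l) (a ⊕ b)
    C-⊕ {k} {l} {a} {b} (inC p) (inC q) = inC (cone-resp {A = V⁺} (λ t → cong (hom a (ℤ.+ k) t +_) (*-identityˡ (hom b (ℤ.+ l) t))
        ∙ sym (hom-⊕ a b (ℤ.+ k) (ℤ.+ l) t))
      (cone-+ {A = V⁺} {hom a (ℤ.+ k)} {hom b (ℤ.+ l)} 0≤1 p q))

    C-zero : C 0 zerosℤ
    C-zero = inC ((λ _ → 0ℚ) , (λ _ → ≤-refl) , λ t → sum-zero (λ i → *-zeroˡ (V⁺ i t)) ∙ sym (eq t))
      where eq : ∀ t → hom (zerosℤ {N}) (ℤ.+ 0) t ≡ 0ℚ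
            eq zero    = refl
            eq (suc t) = cong ℤ→ℚ (lookup-zeros t)

    C-vert : ∀ i → C 1 (vert P i)
    C-vert i = inC (cone-gen V⁺ i)

    C-zero⁻¹ : ∀ {a} → C 0 a → a ≡ zerosℤ
    C-zero⁻¹ {a} (inC (c , c≥0 , e)) = vec-ext λ t → ℤ→ℚ-injective (sym (e (suc t))
        ∙ sum-zero (λ i → cong (_* V⁺ i (suc t)) (c≡0 i) ∙ *-zeroˡ (V⁺ i (suc t)))) ∙ sym (lookup-zeros t)
      where c≡0 : ∀ i → c i ≡ 0ℚ
            c≡0 = sum-zero⇒zero c≥0 (sum-cong (λ i → sym (*-identityʳ (c i))) ∙ e zero)

    C? : ∀ k a → Dec (C k a)
    C? k a = map′ inC cone (cone? V⁺ (hom a (ℤ.+ k)))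

    -- Stated for any family proportional to the vertices, so that it covers P, its dilations and
    -- dilations of dilations alike.
    scaled⇒C : ∀ r (w : Fin (suc (m P)) → Vec ℤ N) → (∀ i t → lookup (w i) t ≡ ℤ.+ r ℤ.* lookup (vert P i) t) →
               ∀ {a} → InConv w (toℚv a) → C r a
    scaled⇒C r w h {a} (c , c≥0 , e , f) = inC ((λ i → ℤ→ℚ (ℤ.+ r) * c i) ,
        (λ i → 0≤-* (ℤ→ℚ-mono-≤ {ℤ.+ 0} {ℤ.+ r} (ℤ.+≤+ ℕ.z≤n)) (c≥0 i)) , eqn)
      where
      eq : ∀ r c v → (r * c) * v ≡ c * (r * v)
      eq = solve-∀ ringℚ
      eqn : ∀ t → lc (λ i → ℤ→ℚ (ℤ.+ r) * c i) V⁺ t ≡ hom a (ℤ.+ r) t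
      eqn zero = sum-cong (λ i → *-identityʳ (ℤ→ℚ (ℤ.+ r) * c i))
        ∙ sum-*ˡ (ℤ→ℚ (ℤ.+ r)) c ∙ cong (ℤ→ℚ (ℤ.+ r) *_) e ∙ *-identityʳ (ℤ→ℚ (ℤ.+ r))
      eqn (suc t) = sum-cong (λ i → eq (ℤ→ℚ (ℤ.+ r)) (c i) (ℤ→ℚ (lookup (vert P i) t))
          ∙ cong (c i *_) (sym (ℤ→ℚ-* (ℤ.+ r) (lookup (vert P i) t)) ∙ cong ℤ→ℚ (sym (h i t))))
        ∙ sym (lookup-sumVℚ c w t) ∙ cong (λ v → lookup v t) f ∙ V.lookup-map t ℤ→ℚ a

    C⇒scaled : ∀ r (w : Fin (suc (m P)) → Vec ℤ N) → (∀ i t → lookup (w i) t ≡ ℤ.+ r ℤ.* lookup (vert P i) t) →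
               ∀ {a} → C r a → InConv w (toℚv a)
    -- For factor 0 all vertices are at the origin and the coefficients of the cone element cannot
    -- be normalised. Any convex weights do; the first vertex gets weight 1.
    C⇒scaled zero w h {a} p = (λ i → δ i zero) , (λ i → δ-nonneg i zero) ,
        δ-sum (zero {m P}) ,
        vec-ext (λ t → lookup-sumVℚ (λ i → δ i zero) w t ∙ trans
          (sum-zero (λ i → cong (δ i zero *_) (cong ℤ→ℚ (h i t ∙ ℤP.*-zeroˡ (lookup (vert P i) t))) ∙ *-zeroʳ (δ i zero)))
          (sym (V.lookup-map t ℤ→ℚ a ∙ cong ℤ→ℚ (cong (λ v → lookup v t) (C-zero⁻¹ p) ∙ lookup-zeros t))))
    C⇒scaled r@(suc r-1) w h {a} (inC (c , c≥0 , e)) = (λ i → s * c i) , (λ i → 0≤-* (<⇒≤ (0<-inv r>0)) (c≥0 i)) ,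
        sum-*ˡ s c ∙ cong (s *_) (sum-cong (λ i → sym (*-identityʳ (c i))) ∙ e zero) ∙ *-comm s r′ ∙ inv-* (0<⇒≢0 r>0) ,
        vec-ext (λ t → lookup-sumVℚ (λ i → s * c i) w t ∙ sum-cong (λ i →
            cong (s * c i *_) (cong ℤ→ℚ (h i t) ∙ ℤ→ℚ-* (ℤ.+ r) (lookup (vert P i) t))
              ∙ eq s (c i) r′ (ℤ→ℚ (lookup (vert P i) t)) ∙ cong (_* (c i * ℤ→ℚ (lookup (vert P i) t))) (inv-* (0<⇒≢0 r>0))
                ∙ *-identityˡ (c i * ℤ→ℚ (lookup (vert P i) t)))
          ∙ e (suc t) ∙ sym (V.lookup-map t ℤ→ℚ a))
      where
      r′ s : ℚ
      r′ = ℤ→ℚ (ℤ.+ r)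
      s = inv r′
      r>0 : 0ℚ < r′
      r>0 = ℤ→ℚ-mono-< {ℤ.+ 0} {ℤ.+ r} (ℤ.+<+ (ℕ.s≤s ℕ.z≤n))
      eq : ∀ s c r v → s * c * (r * v) ≡ (r * s) * (c * v)
      eq = solve-∀ ringℚ

    private
      once : ∀ i t → lookup (vert P i) t ≡ ℤ.+ 1 ℤ.* lookup (vert P i) t
      once i t = sym (ℤP.*-identityˡ (lookup (vert P i) t))

      dilated : ∀ k i t → lookup (vert (dilate k P) i) t ≡ ℤ.+ k ℤ.* lookup (vert P i) t
      dilated k i t = V.lookup-map t (ℤ.+ k ℤ.*_) (vert P i)

      dilated₂ : ∀ k n i t → lookup (vert (dilate k (dilate n P)) i) t ≡ ℤ.+ (k ℕ.* n) ℤ.* lookup (vert P i) t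
      dilated₂ k n i t = V.lookup-map t (ℤ.+ k ℤ.*_) (vert (dilate n P) i) ∙ cong (ℤ.+ k ℤ.*_) (dilated n i t)
        ∙ sym (ℤP.*-assoc (ℤ.+ k) (ℤ.+ n) (lookup (vert P i) t)) ∙ cong (ℤ._* lookup (vert P i) t) (sym (ℤP.pos-* k n))

    lattice⇒C : ∀ {a} → Lattice P a → C 1 a
    lattice⇒C = scaled⇒C 1 (vert P) once

    C⇒lattice : ∀ {a} → C 1 a → Lattice P a
    C⇒lattice = C⇒scaled 1 (vert P) once

    dilate⇒C : ∀ k {a} → Lattice (dilate k P) a → C k a
    dilate⇒C k = scaled⇒C k (vert (dilate k P)) (dilated k)

    C⇒dilate : ∀ k {a} → C k a → Lattice (dilate k P) a
    C⇒dilate k = C⇒scaled k (vert (dilate k P)) (dilated k)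

    dilate₂⇒C : ∀ k n {a} → Lattice (dilate k (dilate n P)) a → C (k ℕ.* n) a
    dilate₂⇒C k n = scaled⇒C (k ℕ.* n) (vert (dilate k (dilate n P))) (dilated₂ k n)

    C⇒dilate₂ : ∀ k n {a} → C (k ℕ.* n) a → Lattice (dilate k (dilate n P)) a
    C⇒dilate₂ k n = C⇒scaled (k ℕ.* n) (vert (dilate k (dilate n P))) (dilated₂ k n)

    private
      β : ℕ
      β = sumℕ (λ i → sumℕ (λ t → ℤ.∣ lookup (vert P i) t ∣))

      ≤β : ∀ i t → ℤ.∣ lookup (vert P i) t ∣ ℕ.≤ β
      ≤β i t = ℕP.≤-trans (≤sumℕ (λ t → ℤ.∣ lookup (vert P i) t ∣) t) (≤sumℕ (λ i → sumℕ (λ t → ℤ.∣ lookup (vert P i) t ∣)) i)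

    -- The weights of an element of degree `k` sum to `k`, and `β` bounds all coordinates of the
    -- vertices. Hence the elements of one degree can be listed by testing a cube.
    C-bounded : ∀ k {a} → C k a → ∀ t → ℤ.∣ lookup a t ∣ ℕ.≤ k ℕ.* β
    C-bounded k {a} (inC (c , c≥0 , e)) t = ∣z∣≤⇒ (lookup a t) (ℤ→ℚ-cancel-≤ upper) (ℤ→ℚ-cancel-≤ lower)
      where
      x : Fin (suc (m P)) → ℤ
      x i = lookup (vert P i) t
      total : sumℚ (λ i → c i * ℤ→ℚ (ℤ.+ β)) ≡ ℤ→ℚ (ℤ.+ (k ℕ.* β))
      total = sum-*ʳ (ℤ→ℚ (ℤ.+ β)) c ∙ cong (_* ℤ→ℚ (ℤ.+ β)) (sum-cong (λ i → sym (*-identityʳ (c i))) ∙ e zero)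
        ∙ sym (ℤ→ℚ-* (ℤ.+ k) (ℤ.+ β)) ∙ cong ℤ→ℚ (sym (ℤP.pos-* k β))
      *-mono : ∀ i {y} → y ℤ.≤ ℤ.+ β → c i * ℤ→ℚ y ≤ c i * ℤ→ℚ (ℤ.+ β)
      *-mono i {y} h = 0≤-⇒≤ (subst (0ℚ ≤_) (eq (c i) (ℤ→ℚ (ℤ.+ β)) (ℤ→ℚ y)) (0≤-* (c≥0 i) (≤⇒0≤- (ℤ→ℚ-mono-≤ h))))
        where eq : ∀ c b y → c * (b - y) ≡ c * b - c * y
              eq = solve-∀ ringℚ
      upper : ℤ→ℚ (lookup a t) ≤ ℤ→ℚ (ℤ.+ (k ℕ.* β))
      upper = subst₂ _≤_ (e (suc t)) total (sum-mono (λ i → *-mono i (ℤP.≤-trans (≤∣z∣ (x i)) (ℤ.+≤+ (≤β i t)))))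
      lower : ℤ→ℚ (ℤ.- lookup a t) ≤ ℤ→ℚ (ℤ.+ (k ℕ.* β))
      lower = subst₂ _≤_ (sum-cong (λ i → cong (c i *_) (ℤ→ℚ-neg (x i)) ∙ sym (neg-distribʳ-* (c i) (ℤ→ℚ (x i))))
          ∙ sum-neg (λ i → c i * ℤ→ℚ (x i)) ∙ cong -_ (e (suc t)) ∙ sym (ℤ→ℚ-neg (lookup a t)))
        total (sum-mono (λ i → *-mono i (ℤP.≤-trans (-≤∣z∣ (x i)) (ℤ.+≤+ (≤β i t)))))

    abstract
      pts : ℕ → List (Vec ℤ N)
      pts k = deduplicate _≟ᵛ_ (filter (C? k) (cube N (k ℕ.* β)))

      pts-unique : ∀ k → Unique (pts k)
      pts-unique k = deduplicate-! _≟ᵛ_ (filter (C? k) (cube N (k ℕ.* β)))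

      pts⁺ : ∀ {k a} → C k a → a ∈ pts k
      pts⁺ {k} {a} p = ∈-deduplicate⁺ _≟ᵛ_ (∈-filter⁺ (C? k) (∈-cube a (C-bounded k p)) p)

      pts⁻ : ∀ {k a} → a ∈ pts k → C k a
      pts⁻ {k} {a} p = proj₂ (∈-filter⁻ (C? k) {xs = cube N (k ℕ.* β)} (∈-deduplicate⁻ _≟ᵛ_ (filter (C? k) (cube N (k ℕ.* β))) p))

    #A : ℕ
    #A = length (pts 1)

    pt : Fin #A → Vec ℤ N
    pt = L.lookup (pts 1)

    -- All lattice points of P serve as generators, not only the vertices. A simplex of generators
    -- that contains no further generator is then an empty simplex.
    A : Fin #A → Vect (suc N)
    A j = hom (pt j) (ℤ.+ 1)

    C-pt : ∀ j → C 1 (pt j)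
    C-pt j = pts⁻ (∈-lookup j)

    find-pt : ∀ {a} → C 1 a → ∃[ j ] pt j ≡ a
    find-pt p = index (pts⁺ p) , sym (lookup-index (pts⁺ p))

    cone⇒coneA : ∀ {x} → Cone V⁺ x → Cone A x
    cone⇒coneA = cone-trans {A = A} {V⁺} λ i → let (j , e) = find-pt (C-vert i) in subst (λ v → Cone A (hom v (ℤ.+ 1))) e (cone-gen A j)

    coneA⇒cone : ∀ {x} → Cone A x → Cone V⁺ x
    coneA⇒cone = cone-trans {A = V⁺} {A} (λ j → cone (C-pt j))

    D : Vect (suc N)
    D s = δ s zero

    dot-D : ∀ x → dot D x ≡ x zero
    dot-D x = dot-δ zero x

    deg-A : ∀ l → dot D (A l) ≡ 1ℚ
    deg-A l = dot-D (A l)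

    module Simplices {d : ℕ} (isDim : IsDim P d) where
      open Bases {suc N} {#A} {suc d} A

      private
        f : Fin (suc d) → Fin (suc (m P))
        f = proj₁ (proj₁ isDim)

        F : Fin (suc d) → Vect (suc N)
        F i = V⁺ (f i)

        dualF : Σ[ U ∈ (Fin (suc d) → Vect (suc N)) ] Dual U F
        dualF = independent⇒dual F (affInd⇒independent {w = λ i → vert P (f i)} (proj₂ (proj₁ isDim)))

        -- By the maximality in `IsDim`, a vertex adjoined to the d + 1 chosen ones makes the family
        -- dependent.
        vert-span : ∀ j → Σ[ c ∈ (Fin (suc d) → ℚ) ] ∀ t → lc c F t ≡ V⁺ j t
        vert-span j with dual-or-dependent (V⁺ j ◂ F)
        ... | inj₂ (c , nz , e) = dependent⇒span {U = proj₁ dualF} {b = F} (proj₂ dualF) c nz e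
        ... | inj₁ (U , dual) = ⊥-elim (proj₂ isDim (j ◂ f) (dual⇒affInd {w = λ i → vert P ((j ◂ f) i)} {U} dual′))
          where dual′ : Dual U (λ i → V⁺ ((j ◂ f) i))
                dual′ i zero    = dual i zero
                dual′ i (suc k) = dual i (suc k)

        C-span : ∀ {k a} → C k a → Σ[ c ∈ (Fin (suc d) → ℚ) ] ∀ t → lc c F t ≡ hom a (ℤ.+ k) t
        C-span (inC (c , _ , e)) = (λ j → sumℚ (λ i → c i * proj₁ (vert-span i) j)) , λ t →
          lc-lc F c (λ i → proj₁ (vert-span i)) V⁺ (λ i → proj₂ (vert-span i)) t ∙ e t

      private
        -- The chosen vertices `F` are known to span; for other points `w` this is a dimension
        -- count. In terms of `F`, the vector `A l` and the `w i` have coordinates in ℚ^(d + 1), and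
        -- d + 2 such vectors are dependent.
        simplex-basis′ : (w : Fin (suc d) → Vec ℤ N) → (∀ i → C 1 (w i)) → AffInd (λ i → toℚv (w i)) →
                        ∃[ b ] ∀ i → pt (B b i) ≡ w i
        simplex-basis′ w w∈ ind = record { B = B′ ; U = U′ ; dual = dual′ ; span = span′ } , B′-eq
          where
          W : Fin (suc d) → Vect (suc N)
          W i = hom (w i) (ℤ.+ 1)
          dualW = independent⇒dual W (affInd⇒independent {w = w} ind)
          U′ = proj₁ dualW
          B′ : Fin (suc d) → Fin #A
          B′ i = proj₁ (find-pt (w∈ i))
          B′-eq : ∀ i → pt (B′ i) ≡ w i
          B′-eq i = proj₂ (find-pt (w∈ i))
          dual′ : Dual U′ (A ∘ B′)
          dual′ i j = cong (λ v → dot (U′ i) (hom v (ℤ.+ 1))) (B′-eq j) ∙ proj₂ dualW i j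
          pt-span : ∀ l → Σ[ c ∈ (Fin (suc d) → ℚ) ] ∀ t → lc c W t ≡ A l t
          pt-span l = let (c , nz , e) = dimension coords in
              dependent⇒span {U = U′} {b = W} (proj₂ dualW) c nz λ t →
                sym (lc-lc F c coords (A l ◂ W) coords-value t) ∙ sum-cong (λ j → cong (_* F j t) (e j)) ∙ sum-zero
                    (λ j → *-zeroˡ (F j t))
            where
            coords : Fin (suc (suc d)) → Vect (suc d)
            coords zero    = proj₁ (C-span {1} (C-pt l))
            coords (suc i) = proj₁ (C-span {1} (w∈ i))
            coords-value : ∀ i t → lc (coords i) F t ≡ (A l ◂ W) i t
            coords-value zero    = proj₂ (C-span {1} (C-pt l))
            coords-value (suc i) = proj₂ (C-span {1} (w∈ i))
          span′ : ∀ l t → A l t ≡ lc (λ i → dot (U′ i) (A l)) (A ∘ B′) t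
          span′ l t = span-coordinates {U = U′} {b = W} (proj₂ dualW) (proj₁ (pt-span l)) (proj₂ (pt-span l)) t
            ∙ sum-cong (λ i → cong (λ v → dot (U′ i) (A l) * hom v (ℤ.+ 1) t) (sym (B′-eq i)))

      abstract
        simplex-basis : (w : Fin (suc d) → Vec ℤ N) → (∀ i → C 1 (w i)) → AffInd (λ i → toℚv (w i)) →
                        ∃[ b ] ∀ i → pt (B b i) ≡ w i
        simplex-basis = simplex-basis′

      b₀ : Basis
      b₀ = proj₁ (simplex-basis (λ i → vert P (f i)) (λ i → C-vert (f i)) (proj₂ (proj₁ isDim)))

      basis-affInd : ∀ b → AffInd (λ i → toℚv (pt (B b i)))
      basis-affInd b = dual⇒affInd {w = λ i → pt (B b i)} {U b} (dual b)

      A-injective : ∀ l l′ → (∀ t → A l t ≡ A l′ t) → l ≡ l′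
      A-injective l l′ h = unique-lookup (pts-unique 1) l l′ (hom-injective {z = ℤ.+ 1} {ℤ.+ 1} h)

-- Sums of lattice points, reduction modulo a simplex, holes

module Boxes where

  open Rationals
  open LinearAlgebra
  open BasesOfCones
  open Triangulations
  open LatticePoints
  open import Data.Rational using (0ℚ; 1ℚ; _+_; _*_; _-_; -_; _≤_; _<_)
  open ℚP hiding (neg-pos)

  -- The given solution `K` makes the search terminate and at the same time bounds its result; the
  -- inequality between μ_idp and μ_hole is obtained in this way.
  leastPos : ∀ (Q : ℕ → Set) → (∀ k → 1 ℕ.≤ k → Dec (Q k)) → ∀ K → 1 ℕ.≤ K → Q K → ∃[ μ ] μ ℕ.≤ K × IsLeastPos Q μ
  leastPos Q Q? K 1≤K QK = go K 1 (ℕP.+-comm K 1) ℕP.≤-refl (λ k 1≤k k<1 _ → ℕP.<⇒≱ k<1 1≤k)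
    where
    go : ∀ fuel k → fuel ℕ.+ k ≡ suc K → 1 ℕ.≤ k → (∀ j → 1 ℕ.≤ j → j ℕ.< k → ¬ Q j) → ∃[ μ ] μ ℕ.≤ K × IsLeastPos Q μ
    go zero k e 1≤k below = ⊥-elim (below K 1≤K (ℕP.≤-reflexive (sym e)) QK)
    go (suc fuel) k e 1≤k below with Q? k 1≤k
    ... | yes q = k , ℕP.≤-trans (ℕP.m≤n+m k fuel) (ℕP.≤-reflexive (ℕP.suc-injective e)) , 1≤k , q , below
    ... | no ¬q = go fuel (suc k) (ℕP.+-suc fuel k ∙ e) (ℕP.m≤n⇒m≤1+n 1≤k) below′
      where below′ : ∀ j → 1 ℕ.≤ j → j ℕ.< suc k → ¬ Q j
            below′ j 1≤j j<sk with ℕP.m≤n⇒m<n∨m≡n (ℕ.s≤s⁻¹ j<sk)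
            ... | inj₁ j<k = below j 1≤j j<k
            ... | inj₂ refl = ¬q

  record SumOf {N : ℕ} (X : Vec ℤ N → Set) (k : ℕ) (a : Vec ℤ N) : Set where
    constructor sumOf
    field
      terms   : Fin k → Vec ℤ N
      terms∈  : ∀ i → X (terms i)
      terms-Σ : sumVℤ terms ≡ a

  module _ {N : ℕ} {X : Vec ℤ N → Set} where

    sum-nil : SumOf X 0 zerosℤ
    sum-nil = sumOf (λ ()) (λ ()) refl

    sum-cons : ∀ {k a b} → X b → SumOf X k a → SumOf X (suc k) (b ⊕ a)
    sum-cons {b = b} x (sumOf as xs e) = sumOf (b ◂ as) (λ { zero → x ; (suc i) → xs i }) (cong (b ⊕_) e)

    sum-uncons : ∀ {k a} → SumOf X (suc k) a → ∃[ b ] ∃[ a′ ] X b × SumOf X k a′ × b ⊕ a′ ≡ a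
    sum-uncons (sumOf as xs e) = as zero , sumVℤ (as ∘ suc) , xs zero , sumOf (as ∘ suc) (xs ∘ suc) refl , e

    sum-single : ∀ {a} → X a → SumOf X 1 a
    sum-single {a} x = subst (SumOf X 1) (⊕-identityʳ a) (sum-cons x sum-nil)

    sum-++ : ∀ {k l a b} → SumOf X k a → SumOf X l b → SumOf X (k ℕ.+ l) (a ⊕ b)
    sum-++ {zero} {l} {b = b} (sumOf _ _ e) s = subst (SumOf X l) (sym (⊕-identityˡ b) ∙ cong (_⊕ b) e) s
    sum-++ {suc k} {l} {b = b} s s′ with sum-uncons s
    ... | c , a′ , x , t , refl = subst (SumOf X (suc k ℕ.+ l)) (sym (⊕-assoc c a′ b)) (sum-cons x (sum-++ t s′))

    sum-split : ∀ k {l a} → SumOf X (k ℕ.+ l) a → ∃[ b ] ∃[ c ] SumOf X k b × SumOf X l c × b ⊕ c ≡ a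
    sum-split zero {a = a} s = zerosℤ , a , sum-nil , s , ⊕-identityˡ a
    sum-split (suc k) s with sum-uncons s
    ... | b , a′ , x , t , refl with sum-split k t
    ... | b′ , c , s₁ , s₂ , refl = b ⊕ b′ , c , sum-cons x s₁ , s₂ , ⊕-assoc b b′ c

    sum? : ∀ xs → (∀ {a} → X a → a ∈ xs) → (∀ {a} → a ∈ xs → X a) → ∀ k a → Dec (SumOf X k a)
    sum? xs into from zero a = map′ (sumOf (λ ()) (λ ())) (λ (sumOf _ _ e) → e) (zerosℤ ≟ᵛ a)
    sum? xs into from (suc k) a = map′ to fro (Any.any? (λ b → sum? xs into from k (a ⊖ b)) xs)
      where
      to : Any (λ b → SumOf X k (a ⊖ b)) xs → SumOf X (suc k) a
      to p = let (b , b∈ , s) = find p in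
        subst (SumOf X (suc k)) (⊕-comm b (a ⊖ b) ∙ (⊖-⊕ a b)) (sum-cons (from b∈) s)
      fro : SumOf X (suc k) a → Any (λ b → SumOf X k (a ⊖ b)) xs
      fro s = let (b , a′ , x , t , e) = sum-uncons s in
        lose (into x) (subst (SumOf X k) (sym (⊕-⊖ a′ b) ∙ cong (_⊖ b) (⊕-comm a′ b ∙ e)) t)

  hom-sum : ∀ {k N} (w : Fin k → Vec ℤ N) t → hom (sumVℤ w) (ℤ.+ k) t ≡ sumℚ (λ i → hom (w i) (ℤ.+ 1) t)
  hom-sum {zero}  w zero    = refl
  hom-sum {zero}  w (suc t) = cong ℤ→ℚ (lookup-zeros t)
  hom-sum {suc k} w t = hom-⊕ (w zero) (sumVℤ (w ∘ suc)) (ℤ.+ 1) (ℤ.+ k) t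
    ∙ cong (hom (w zero) (ℤ.+ 1) t +_) (hom-sum (w ∘ suc) t)

  module Holes {N : ℕ} (P : Polytope N) {d : ℕ} (isDim : IsDim P d) where
    open Lattices P public
    open Simplices {d} isDim public
    open Bases {suc N} {#A} {suc d} A public
    open HalfOpen {suc N} {#A} {suc d} A public
    open Graded D deg-A public

    -- Sums of lattice points

    sum⇒C : ∀ {e k a} → SumOf (C e) k a → C (k ℕ.* e) a
    sum⇒C {e} {zero}  (sumOf _ _ refl) = C-zero
    sum⇒C {e} {suc k} s with sum-uncons s
    ... | b , a′ , p , t , refl = C-⊕ p (sum⇒C t)

    sum₁⇒C : ∀ {k a} → SumOf (C 1) k a → C k a
    sum₁⇒C {k} {a} s = subst (λ k → C k a) (ℕP.*-identityʳ k) (sum⇒C s)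

    group : ∀ e k {a} → SumOf (C 1) (k ℕ.* e) a → SumOf (C e) k a
    group e zero (sumOf as _ eq) = sumOf as (λ ()) eq
    group e (suc k) s with sum-split e s
    ... | b , c , s₁ , s₂ , refl = sum-cons (sum₁⇒C s₁) (group e k s₂)

    C-sum? : ∀ e k a → Dec (SumOf (C e) k a)
    C-sum? e = sum? (pts e) pts⁺ pts⁻

    C-span′ : ∀ {k a} → C k a → InSpan (hom a (ℤ.+ k))
    C-span′ p = cone⇒span (cone⇒coneA (cone p))

    C-degree : ∀ b {k a} → C k a → sumℚ (λ i → dot (U b i) (hom a (ℤ.+ k))) ≡ ℤ→ℚ (ℤ.+ k)
    C-degree b {k} {a} p = sym (degree-sum b (C-span′ p)) ∙ dot-D (hom a (ℤ.+ k))

    coordinates : ∀ b {x} → InSpan x → ∀ t → lc (λ i → dot (U b i) x) (A ∘ B b) t ≡ x t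
    coordinates b {x} sp t = sum-cong (λ i → cong (dot (U b i) x *_) (sym (dot-δ t (A (B b i)))))
      ∙ sym (expand b sp (λ s → δ s t)) ∙ dot-δ t x

    nonneg⇒C : ∀ b {k a} → InSpan (hom a (ℤ.+ k)) → (∀ i → 0ℚ ≤ dot (U b i) (hom a (ℤ.+ k))) → C k a
    nonneg⇒C b {k} {a} sp h = inC (coneA⇒cone (cone-trans {A = A} {A ∘ B b} (λ i → cone-gen A (B b i))
      ((λ i → dot (U b i) (hom a (ℤ.+ k))) , h , coordinates b sp)))

    hom-minus-pt : ∀ a k l t → hom (a ⊖ pt l) (ℤ.+ k) t ≡ hom a (ℤ.+ suc k) t - A l t
    hom-minus-pt a k l t = hom-⊖ a (pt l) (ℤ.+ suc k) (ℤ.+ 1) t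

    span-minus : ∀ {x l} → InSpan x → InSpan (λ t → x t - A l t)
    span-minus {x} {l} (c , e) = (λ j → c j - δ j l) , λ t →
      sum-cong (λ j → eq (c j) (δ j l) (A j t)) ∙ sum-- (λ j → c j * A j t) (λ j → δ j l * A j t) ∙ cong₂ _-_ (e t) (lc-δ A l t)
      where eq : ∀ c d a → (c - d) * a ≡ c * a - d * a
            eq = solve-∀ ringℚ

    span-resp : ∀ {x y} → (∀ t → x t ≡ y t) → InSpan x → InSpan y
    span-resp h (c , e) = c , λ t → e t ∙ h t

    U-minus-pt : ∀ b i a k l → dot (U b i) (hom (a ⊖ pt l) (ℤ.+ k)) ≡ dot (U b i) (hom a (ℤ.+ suc k)) - dot (U b i) (A l)
    U-minus-pt b i a k l = dot-congʳ (U b i) (hom-minus-pt a k l)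
      ∙ dot-comm (U b i) (λ t → hom a (ℤ.+ suc k) t - A l t) ∙ dot-minus (hom a (ℤ.+ suc k)) (A l) (U b i)
        ∙ cong₂ _-_ (dot-comm (hom a (ℤ.+ suc k)) (U b i)) (dot-comm (A l) (U b i))

    Reduced : Basis → ℕ → Vec ℤ N → Set
    Reduced b e y = ∀ i → 0ℚ ≤ dot (U b i) (hom y (ℤ.+ e)) × dot (U b i) (hom y (ℤ.+ e)) < 1ℚ

    reduced? : ∀ b e y → Dec (Reduced b e y)
    reduced? b e y = all? (λ i → (0ℚ ≤? dot (U b i) (hom y (ℤ.+ e))) ×-dec (dot (U b i) (hom y (ℤ.+ e)) <? 1ℚ))

    Reduction : Basis → ℕ → Vec ℤ N → Set
    Reduction b k a =
      ∃[ e ] ∃[ l ] ∃[ y ] ∃[ s ] k ≡ e ℕ.+ l × C e y × Reduced b e y × SumOf (C 1) l s × y ⊕ s ≡ a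

    abstract
      reduce : ∀ b k {a} → C k a → (∀ i → 0ℚ ≤ dot (U b i) (hom a (ℤ.+ k))) → Reduction b k a
      reduce-by : ∀ b k {a} → C k a → (∀ i → 0ℚ ≤ dot (U b i) (hom a (ℤ.+ k))) →
                  Dec (∃[ i ] 1ℚ ≤ dot (U b i) (hom a (ℤ.+ k))) → Reduction b k a

      reduce b k {a} p pos = reduce-by b k p pos (any? (λ i → 1ℚ ≤? dot (U b i) (hom a (ℤ.+ k))))

      reduce-by b k {a} p pos (no none) = k , 0 , a , zerosℤ , sym (ℕP.+-identityʳ k) , p ,
        (λ i → pos i , ≰⇒> (λ le → none (i , le))) , sum-nil , ⊕-identityʳ a
      -- In degree 0 the coordinates are nonnegative with sum 0, so none of them reaches 1.
      reduce-by b zero {a} p pos (yes (i , le)) = ⊥-elim (<-irrefl refl (<-≤-trans 0<1 (≤-trans le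
        (subst (dot (U b i) (hom a (ℤ.+ 0)) ≤_) (C-degree b {0} {a} p) (term≤sum pos i)))))
      reduce-by b (suc k) {a} p pos (yes (i , le)) = extend (reduce b k {a ⊖ pt (B b i)} (nonneg⇒C b span′ pos′) pos′)
        where
        extend : Reduction b k (a ⊖ pt (B b i)) → Reduction b (suc k) a
        extend (e , l , y , s , eq , q , red , sm , f) =
          e , suc l , y , pt (B b i) ⊕ s , cong suc eq ∙ sym (ℕP.+-suc e l) , q , red , sum-cons (C-pt (B b i)) sm ,
          cong (y ⊕_) (⊕-comm (pt (B b i)) s) ∙ sym (⊕-assoc y s (pt (B b i))) ∙ cong (_⊕ pt (B b i)) f ∙ (⊖-⊕ a (pt (B b i)))
        span′ : InSpan (hom (a ⊖ pt (B b i)) (ℤ.+ k))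
        span′ = span-resp (λ t → sym (hom-minus-pt a k (B b i) t)) (span-minus {hom a (ℤ.+ suc k)} {B b i} (C-span′ p))
        by-cases : ∀ j → Dec (j ≡ i) → δ j i ≤ dot (U b j) (hom a (ℤ.+ suc k))
        by-cases j (yes refl) = subst (_≤ dot (U b j) (hom a (ℤ.+ suc k))) (sym (δ-refl j)) le
        by-cases j (no j≢i)   = subst (_≤ dot (U b j) (hom a (ℤ.+ suc k))) (sym (δ-≢ j≢i)) (pos j)
        pos′ : ∀ j → 0ℚ ≤ dot (U b j) (hom (a ⊖ pt (B b i)) (ℤ.+ k))
        pos′ j = subst (0ℚ ≤_) (sym (U-minus-pt b j a k (B b i) ∙ cong (λ z → dot (U b j) (hom a (ℤ.+ suc k)) - z) (dual b j i)))
          (≤⇒0≤- (by-cases j (j ≟ᶠ i)))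

    -- The degree is the sum of d + 1 coordinates, each below 1, so it is below d + 1.
    reduced-degree : ∀ b e {y} → C e y → (∀ i → dot (U b i) (hom y (ℤ.+ e)) < 1ℚ) → e ℕ.≤ d
    reduced-degree b e {y} p h = ℕ.s≤s⁻¹ (ℤP.drop‿+<+ (ℤ→ℚ-cancel-< {ℤ.+ e} {ℤ.+ suc d} (0<-⇒< (subst (0ℚ <_)
      (sum-- (λ _ → 1ℚ) (λ i → dot (U b i) (hom y (ℤ.+ e))) ∙ cong₂ _-_ (sum-const (suc d)) (C-degree b {e} {y} p))
      (sum-pos (λ i → <⇒≤ (<⇒0<- (h i))) zero (<⇒0<- (h zero)))))))

    -- Boxes and holes

    record Box (e : ℕ) (y : Vec ℤ N) : Set where
      constructor box
      field
        in-simplex  : ∃[ b ] Empty b × Reduced b e y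
        not-lattice : ¬ SumOf (C 1) e y

    record Split (k : ℕ) (a : Vec ℤ N) : Set where
      constructor split
      field
        {e l}  : ℕ
        {y s}  : Vec ℤ N
        degree : k ≡ e ℕ.+ l
        e≤d    : e ℕ.≤ d
        y∈C    : C e y
        core   : Box e y ⊎ SumOf (C 1) e y
        rest   : SumOf (C 1) l s
        total  : y ⊕ s ≡ a

    private
      classify : ∀ {b e y} → Empty b → Reduced b e y → Dec (SumOf (C 1) e y) → Box e y ⊎ SumOf (C 1) e y
      classify _  _   (yes sy) = inj₂ sy
      classify {b} em red (no ¬sy) = inj₁ (box (b , em , red) ¬sy)

      split-along : ∀ {k a} → C k a → ∃[ b ] Empty b × (∀ i → 0ℚ ≤ dot (U b i) (hom a (ℤ.+ k))) → Split k a
      split-along {k} {a} p (b , em , pos) = assemble (reduce b k {a} p pos)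
        where
        assemble : Reduction b k a → Split k a
        assemble (e , l , y , s , eq , q , red , sm , f) =
          split eq (reduced-degree b e {y} q (λ i → proj₂ (red i))) q (classify {b} {e} {y} em red (C-sum? 1 e y)) sm f

    abstract
      decompose : ∀ {k a} → C k a → Split k a
      decompose p = split-along p (empty-covered A-injective b₀ (cone⇒coneA (cone p)))

    box-pos : ∀ {e y} → C e y → Box e y → 1 ℕ.≤ e
    box-pos {zero} p (box _ ¬s) = ⊥-elim (¬s (subst (SumOf (C 1) 0) (sym (C-zero⁻¹ p)) sum-nil))
    box-pos {suc e} p _ = ℕ.s≤s ℕ.z≤n

    private
      another : ∀ {n} → 1 ℕ.≤ n → (i : Fin (suc n)) → ∃[ k ] k ≢ i
      another (ℕ.s≤s _) zero    = suc zero , λ ()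
      another (ℕ.s≤s _) (suc i) = zero , λ ()

      -- By emptiness the point is a vertex. Since d ≥ 1 there is a second vertex, and the
      -- coordinate of the first one there is 0, not positive.
      no-interior-point : 1 ℕ.≤ d → ∀ b → Empty b → ∀ z → C 1 z → ¬ (∀ k → 0ℚ < dot (U b k) (hom z (ℤ.+ 1)))
      no-interior-point 1≤d b empty z Cz pos = at (find-pt Cz)
       where
       vertex : ∀ {j} → (∀ k → 0ℚ < dot (U b k) (A j)) → ∃[ i ] j ≡ B b i → ⊥
       vertex {j} pos′ (i , e) = let (k , k≢i) = another 1≤d i in
         <-irrefl (sym (cong (λ l → dot (U b k) (A l)) e ∙ dual b k i ∙ δ-≢ k≢i)) (pos′ k)
       at : ∃[ j ] pt j ≡ z → ⊥
       at (j , e) = vertex {j} pos′ (empty j (λ k → <⇒≤ (pos′ k)))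
         where pos′ : ∀ k → 0ℚ < dot (U b k) (A j)
               pos′ k = subst (λ v → 0ℚ < dot (U b k) (hom v (ℤ.+ 1))) (sym e) (pos k)

      full-degree : 1 ℕ.≤ d → ∀ {b y} → C d y → Empty b → ¬ Reduced b d y
      full-degree 1≤d {b} {y} p empty red = no-interior-point 1≤d b empty z Cz U-z>0
       where
       w : Fin (suc d) → Vec ℤ N
       w i = pt (B b i)
       -- Reflection in the centre of the box: a coordinate u becomes 1 - u, which is positive
       -- because u < 1, and degree d becomes (d + 1) - d = 1.
       z : Vec ℤ N
       z = sumVℤ w ⊖ y
       hom-z : ∀ t → hom z (ℤ.+ 1) t ≡ sumℚ (λ i → A (B b i) t) - hom y (ℤ.+ d) t
       hom-z t = cong (λ k → hom z k t) (sym degree) ∙ hom-⊖ (sumVℤ w) y (ℤ.+ suc d) (ℤ.+ d) t ∙ cong (_- hom y (ℤ.+ d) t) (hom-sum w t)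
         where
         degree : ℤ.+ suc d ℤ.- ℤ.+ d ≡ ℤ.+ 1
         degree = ℤP.m-n≡m⊖n (suc d) d ∙ ℤP.⊖-≥ (ℕP.n≤1+n d) ∙ cong ℤ.+_ (ℕP.m+n∸n≡m 1 d)
       U-z : ∀ k → dot (U b k) (hom z (ℤ.+ 1)) ≡ 1ℚ - dot (U b k) (hom y (ℤ.+ d))
       U-z k = dot-congʳ (U b k) hom-z ∙ dot-comm (U b k) (λ t → sumℚ (λ i → A (B b i) t) - hom y (ℤ.+ d) t)
         ∙ dot-minus (λ t → sumℚ (λ i → A (B b i) t)) (hom y (ℤ.+ d)) (U b k)
           ∙ cong₂ _-_ (dot-comm (λ t → sumℚ (λ i → A (B b i) t)) (U b k) ∙ dot-congʳ (U b k)
               (λ t → sum-cong (λ i → sym (*-identityˡ (A (B b i) t))))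
             ∙ dot-lcʳ (U b k) (λ _ → 1ℚ) (A ∘ B b) ∙ sum-cong (λ i → cong (1ℚ *_) (dual b k i)) ∙ sum-δ′ (λ _ → 1ℚ) k)
             (dot-comm (hom y (ℤ.+ d)) (U b k))
       U-z>0 : ∀ k → 0ℚ < dot (U b k) (hom z (ℤ.+ 1))
       U-z>0 k = subst (0ℚ <_) (sym (U-z k)) (<⇒0<- (proj₂ (red k)))
       z-span : InSpan (hom z (ℤ.+ 1))
       z-span = let (c , f) = C-span′ {d} {y} p in (λ j → lc (λ _ → 1ℚ) (λ i j → δ j (B b i)) j - c j) , λ t →
         sum-cong (λ j → eq (lc (λ _ → 1ℚ) (λ i j → δ j (B b i)) j) (c j) (A j t))
           ∙ sum-- (λ j → lc (λ _ → 1ℚ) (λ i j → δ j (B b i)) j * A j t) (λ j → c j * A j t)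
             ∙ cong₂ _-_ (dot-lcˡ (λ _ → 1ℚ) (λ i j → δ j (B b i)) (λ j → A j t)
               ∙ sum-cong (λ i → *-identityˡ (dot (λ j → δ j (B b i)) (λ j → A j t)) ∙ dot-δ (B b i) (λ j → A j t))) (f t) ∙ sym
                   (hom-z t)
         where eq : ∀ c d a → (c - d) * a ≡ c * a - d * a
               eq = solve-∀ ringℚ
       Cz : C 1 z
       Cz = nonneg⇒C b {1} {z} z-span (λ k → <⇒≤ (U-z>0 k))

    box-degree : 1 ℕ.≤ d → ∀ {e y} → C e y → Box e y → e ℕ.≤ d ℕ.∸ 1
    box-degree 1≤d {e} {y} p (box (b , empty , red) _) = by-cases (ℕP.m≤n⇒m<n∨m≡n (reduced-degree b e {y} p (λ i → proj₂ (red i))))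
      where
      by-cases : e ℕ.< d ⊎ e ≡ d → e ℕ.≤ d ℕ.∸ 1
      by-cases (inj₁ e<d)  = ℕP.<⇒≤pred e<d
      by-cases (inj₂ refl) = ⊥-elim (full-degree 1≤d {b} p empty red)

    box⇒InBox : ∀ {e y} → C e y → Box e y → InBox P d (y , ℤ.+ e)
    box⇒InBox {e} {y} p (box (b , empty , red) ¬s) = ((λ i → pt (B b i)) ,
        ((λ i → C⇒lattice (C-pt (B b i))) , basis-affInd b , is-empty) ,
        (λ i → dot (U b i) (hom y (ℤ.+ e))) , red , proj₂ sums , proj₁ sums) , ¬span
      where
      sums = lc⇒sumV (λ i → dot (U b i) (hom y (ℤ.+ e))) (λ i → pt (B b i)) {y} {ℤ.+ e} (coordinates b (C-span′ {e} {y} p))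
      is-empty : ∀ a → InConv (λ i → pt (B b i)) (toℚv a) → ∃[ i ] a ≡ pt (B b i)
      is-empty a (c , c≥0 , e₁ , e₂) = let (j , e₃) = find-pt (inC (coneA⇒cone
                                             (cone-trans {A = A} {A ∘ B b} (λ i → cone-gen A (B b i)) (c , c≥0 , eqn))))
                                           (i , e₄) = empty j (λ i → subst (0ℚ ≤_) (sym (dual-lc {U = U b} {b = A ∘ B b} (dual b) c i)
                                                        ∙ dot-congʳ (U b i) (λ t → eqn t ∙ cong (λ v → hom v (ℤ.+ 1) t) (sym e₃)))
                                                            (c≥0 i)) in
          i , sym e₃ ∙ cong pt e₄
        where eqn : ∀ t → lc c (A ∘ B b) t ≡ hom a (ℤ.+ 1) t
              eqn = sumV⇒lc c (λ i → pt (B b i)) {a} {ℤ.+ 1} e₁ e₂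
      ¬span : ¬ InZSpan P (y , ℤ.+ e)
      ¬span (k , ps , ps∈ , e₁ , e₂) = ¬s (subst (λ k → SumOf (C 1) k y) (ℤP.+-injective e₂) (sumOf ps (λ i → lattice⇒C (ps∈ i)) e₁))

    private
      simplex⇒box : ∀ {y z} (w : Fin (suc d) → Vec ℤ N) → EmptySimplex P d w → InBoxS w (y , z) → ¬ InZSpan P (y , z) →
                    ∃[ b ] (∀ i → pt (B b i) ≡ w i) → ∃[ e ] z ≡ ℤ.+ e × C e y × Box e y
      simplex⇒box {y} {z} w (w∈ , ind , is-empty) (r , bounds , e₁ , e₂) ¬span (b , B≡) =
           k , z≡ , p , box (b , empty , λ i → subst (λ u → 0ℚ ≤ u × u < 1ℚ) (sym (coords i)) (bounds i))
           λ (sumOf ps ps∈ e) → ¬span (k , ps , (λ i → C⇒lattice (ps∈ i)) , e , sym z≡)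
       where
       W : Fin (suc d) → Vect (suc N)
       W i = hom (w i) (ℤ.+ 1)
       A≡W : ∀ i t → A (B b i) t ≡ W i t
       A≡W i t = cong (λ v → hom v (ℤ.+ 1) t) (B≡ i)
       eqn : ∀ t → lc r W t ≡ hom y z t
       eqn = sumV⇒lc r w {y} {z} e₂ e₁
       cone′ : Cone V⁺ (hom y z)
       cone′ = cone-trans {A = V⁺} {W} (λ i → cone (lattice⇒C (w∈ i))) (r , (λ i → proj₁ (bounds i)) , eqn)
       k = proj₁ (cone-degree {y} {z} cone′)
       z≡ : z ≡ ℤ.+ k
       z≡ = proj₂ (cone-degree {y} {z} cone′)
       p : C k y
       p = inC (subst (λ z → Cone V⁺ (hom y z)) z≡ cone′)
       dualW : Dual (U b) W
       dualW i j = sym (dot-congʳ (U b i) (A≡W j)) ∙ dual b i j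
       coords : ∀ i → dot (U b i) (hom y (ℤ.+ k)) ≡ r i
       coords i = dot-congʳ (U b i) (λ t → cong (λ z → hom y z t) (sym z≡) ∙ sym (eqn t)) ∙ dual-lc {U = U b} {b = W} dualW r i
       empty : Empty b
       empty l h = let (e , f) = lc⇒sumV (λ i → dot (U b i) (A l)) w {pt l} {ℤ.+ 1}
                         (λ t → sum-cong (λ i → cong (dot (U b i) (A l) *_) (sym (A≡W i t))) ∙ sym (span b l t))
                       (i , g) = is-empty (pt l) ((λ i → dot (U b i) (A l)) , h , e , f) in
         i , unique-lookup (pts-unique 1) l (B b i) (g ∙ sym (B≡ i))

    InBox⇒box : ∀ {y z} → InBox P d (y , z) → ∃[ e ] z ≡ ℤ.+ e × C e y × Box e y
    InBox⇒box {y} {z} ((w , empty , inBoxS) , ¬span) =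
      simplex⇒box {y} {z} w empty inBoxS ¬span (simplex-basis w (λ i → lattice⇒C (proj₁ empty i)) (proj₁ (proj₂ empty)))

    private
      empty? : ∀ b → Dec (Empty b)
      empty? b = all? λ l → implies? (inside? b l) (any? (λ i → l ≟ᶠ B b i))
        where
        implies? : ∀ {X Y : Set} → Dec X → Dec Y → Dec (X → Y)
        implies? _       (yes y) = yes (λ _ → y)
        implies? (yes x) (no ¬y) = no (λ f → ¬y (f x))
        implies? (no ¬x) (no _)  = yes (λ x → ⊥-elim (¬x x))

      tuple-empty : ∀ {b b′} → (∀ i → B b′ i ≡ B b i) → Empty b → Empty b′
      tuple-empty {b} {b′} h em l inside = let (i , e) = em l (λ i → subst (0ℚ ≤_) (U-unique b′ b h {A l} (gen-span l) i) (inside i)) in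
        i , e ∙ sym (h i)

    box? : ∀ {e y} → C e y → Dec (Box e y)
    box? {e} {y} p = map′ (λ (s , ¬l) → box s ¬l) (λ (box s ¬l) → s , ¬l)
        (map′ to fro (Any.any? (λ b → empty? b ×-dec reduced? b e y) bases) ×-dec ¬? (C-sum? 1 e y))
      where
      to : Any (λ b → Empty b × Reduced b e y) bases → ∃[ b ] Empty b × Reduced b e y
      to q = let (b , _ , h) = find q in b , h
      fro : ∃[ b ] Empty b × Reduced b e y → Any (λ b → Empty b × Reduced b e y) bases
      fro (b , em , red) = let (b′ , b′∈ , h) = bases-complete b in
        lose b′∈ (tuple-empty {b} {b′} h em , λ i → subst (λ u → 0ℚ ≤ u × u < 1ℚ) (sym (U-unique b′ b h (C-span′ {e} {y} p) i)) (red i))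

    private
      graded : ℕ → List (ℕ × Vec ℤ N)
      graded K = L.concat (map (λ e → map (e ,_) (pts e)) (upTo (suc K)))

    graded⁺ : ∀ {K e y} → e ℕ.≤ K → C e y → (e , y) ∈ graded K
    graded⁺ {K} {e} {y} le p = ∈-concat⁺′ (∈-map⁺ (e ,_) (pts⁺ p)) (∈-map⁺ (λ e → map (e ,_) (pts e)) (∈-upTo⁺ (ℕ.s≤s le)))

    graded⁻ : ∀ {K e y} → (e , y) ∈ graded K → e ℕ.≤ K × C e y
    graded⁻ {K} {e} {y} h with ∈-concat⁻′ (map (λ e → map (e ,_) (pts e)) (upTo (suc K))) h
    ... | ys , h₁ , h₂ with ∈-map⁻ (λ e → map (e ,_) (pts e)) h₂
    ... | e′ , e′∈ , refl with ∈-map⁻ (e′ ,_) h₁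
    ... | y′ , y′∈ , refl = ℕ.s≤s⁻¹ (∈-upTo⁻ e′∈) , pts⁻ y′∈

    abstract
      graded-list : ∀ K → Σ[ xs ∈ List (ℕ × Vec ℤ N) ] (∀ {e y} → e ℕ.≤ K → C e y → (e , y) ∈ xs) ×
          (∀ {e y} → (e , y) ∈ xs → e ℕ.≤ K × C e y)
      graded-list K = graded K , graded⁺ , graded⁻

    abstract
      -- A filter whose test may use a property `S` of the listed elements: `box?` decides only for
      -- elements known to lie in the cone.
      select : ∀ {X : Set} {Q S : X → Set} → (∀ {x} → S x → Dec (Q x)) → (xs : List X) → (∀ {x} → x ∈ xs → S x) →
               Σ[ ys ∈ List X ] (∀ {x} → x ∈ xs → Q x → x ∈ ys) × (∀ {x} → x ∈ ys → x ∈ xs × Q x)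
      select Q? [] h = [] , (λ ()) , λ ()
      select {Q = Q} Q? (x ∷ xs) h with select {Q = Q} Q? xs (λ i → h (there i)) | Q? (h (here refl))
      ... | ys , f , g | yes q = x ∷ ys , (λ { (here refl) _ → here refl ; (there i) q′ → there (f i q′) }) ,
                                 λ { (here refl) → here refl , q ; (there i) → there (proj₁ (g i)) , proj₂ (g i) }
      ... | ys , f , g | no ¬q = ys , (λ { (here refl) q → ⊥-elim (¬q q) ; (there i) q′ → f i q′ }) , λ i → there (proj₁ (g i)) ,
          proj₂ (g i)

    private
      box-list : Σ[ ys ∈ List (ℕ × Vec ℤ N) ] (∀ {e y} → C e y → Box e y → (e , y) ∈ ys) × (∀ {e y} → (e , y) ∈ ys → C e y × Box e y)
      box-list = let (xs , f , g) = graded-list d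
                     (ys , f′ , g′) = select {Q = λ (e , y) → Box e y} (λ {(e , y)} p → box? {e} {y} p) xs (λ h → proj₂ (g h)) in
        ys , (λ {e} {y} p bx → f′ (f (degree bx p) p) bx) , λ h → proj₂ (g (proj₁ (g′ h))) , proj₂ (g′ h)
        where degree : ∀ {e y} → Box e y → C e y → e ℕ.≤ d
              degree {e} {y} (box (b , _ , red) _) p = reduced-degree b e {y} p (λ i → proj₂ (red i))

    Holes : ℕ → Set
    Holes μ = MuHole P d μ × 1 ℕ.≤ μ × (∀ {e y} → C e y → Box e y → e ℕ.≤ μ) × (μ ≡ 1 ⊎ ∃[ y ] C μ y × Box μ y)

    private
      no-boxes : (∀ {e y} → C e y → ¬ Box e y) → Holes 1
      no-boxes none = inj₁ (outside , refl) , ℕP.≤-refl , (λ p bx → ⊥-elim (none p bx)) , inj₁ refl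
        where outside : ∀ x → ¬ InBox P d x
              outside (y , z) ib = let (e , _ , p , bx) = InBox⇒box {y} {z} ib in none p bx

      max-box : ∀ μ y → C μ y → Box μ y → (∀ {e y} → C e y → Box e y → e ℕ.≤ μ) → Holes μ
      max-box μ y p bx mx = inj₂ (bound , ((y , ℤ.+ μ) , box⇒InBox p bx , refl)) , box-pos p bx , mx , inj₂ (y , p , bx)
        where bound : ∀ x → InBox P d x → deg x ℤ.≤ ℤ.+ μ
              bound (y , z) ib = let (e , z≡ , q , by) = InBox⇒box {y} {z} ib in subst (ℤ._≤ ℤ.+ μ) (sym z≡) (ℤ.+≤+ (mx q by))

      holes-from : (ys : List (ℕ × Vec ℤ N)) → (∀ {e y} → C e y → Box e y → (e , y) ∈ ys) →
                   (∀ {e y} → (e , y) ∈ ys → C e y × Box e y) → ∃[ μ ] Holes μ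
      holes-from [] into from = 1 , no-boxes λ p bx → absurd (into p bx)
        where absurd : ∀ {x : ℕ × Vec ℤ N} → x ∈ [] → ⊥
              absurd ()
      holes-from xs@(_ ∷ _) into from =
        let ((μ , y) , μ∈ , mx) = greatest proj₁ xs (here refl)
            (p , bx) = from μ∈ in
        μ , max-box μ y p bx (λ q by → mx (into q by))

    abstract
      holes : ∃[ μ ] Holes μ
      holes = holes-from (proj₁ box-list) (proj₁ (proj₂ box-list)) (proj₂ (proj₂ box-list))

-- Deciding IDP of dilations; exposed generators of the cone

module Decompositions where

  open Rationals
  open LinearAlgebra
  open BasesOfCones
  open Triangulations
  open LatticePoints
  open Boxes
  open import Data.Rational using (0ℚ; 1ℚ; _+_; _*_; _-_; -_; _≤_; _<_)
  open ℚP hiding (neg-pos)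

  ℚ≤ℕ : ∀ q → ∃[ β ] q ≤ ℤ→ℚ (ℤ.+ β)
  ℚ≤ℕ q = β , subst (_≤ ℤ→ℚ (ℤ.+ β)) (sym q≡) (0≤-⇒≤ (subst (0ℚ ≤_) (eq (ℤ→ℚ (ℤ.+ β)) (ℤ→ℚ (ℚ.↥ q)) r)
      (0≤-+ (0≤-* (ℤ→ℚ-mono-≤ {ℤ.+ 0} {ℤ.+ β} (ℤ.+≤+ ℕ.z≤n)) (≤⇒0≤- r≤1)) (0≤-* (≤⇒0≤- (ℤ→ℚ-mono-≤ (≤∣z∣ (ℚ.↥ q)))) (<⇒≤ r>0)))))
    where
    β = ℤ.∣ ℚ.↥ q ∣
    D⁺ : ℚ
    D⁺ = ℤ→ℚ (ℚ.↧ q)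
    D≥1 : 1ℚ ≤ D⁺
    D≥1 = ℤ→ℚ-mono-≤ {ℤ.+ 1} {ℚ.↧ q} (ℤ.+≤+ (ℕ.s≤s ℕ.z≤n))
    D>0 : 0ℚ < D⁺
    D>0 = <-≤-trans 0<1 D≥1
    r : ℚ
    r = inv D⁺
    r>0 : 0ℚ < r
    r>0 = 0<-inv D>0
    r≤1 : r ≤ 1ℚ
    r≤1 = 0≤-⇒≤ (subst (0ℚ ≤_) (eq₁ D⁺ r ∙ cong (λ w → w - r) (inv-* (0<⇒≢0 D>0))) (0≤-* (≤⇒0≤- D≥1) (<⇒≤ r>0)))
      where eq₁ : ∀ D r → (D - 1ℚ) * r ≡ D * r - r
            eq₁ = solve-∀ ringℚ
    q≡ : q ≡ ℤ→ℚ (ℚ.↥ q) * r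
    q≡ = sym (*-identityʳ q) ∙ cong (q *_) (sym (inv-* (0<⇒≢0 D>0))) ∙ sym (*-assoc q D⁺ r) ∙ cong (_* r) clear
      where clear : q * D⁺ ≡ ℤ→ℚ (ℚ.↥ q)
            clear = *-denominator q
    eq : ∀ b n r → b * (1ℚ - r) + (b - n) * r ≡ b - n * r
    eq = solve-∀ ringℚ

  module _ {X : Set} where

    common-bound : ∀ {Q : X → ℕ → Set} (xs : List X) → (∀ {x} → x ∈ xs → ∃[ K ] Q x K) → ∃[ R ]
        (∀ {x} → x ∈ xs → ∃[ K ] K ℕ.≤ R × Q x K)
    common-bound [] h = 0 , λ ()
    common-bound (x ∷ xs) h =
      let (K , q) = h (here refl) ; (R , f) = common-bound xs (λ i → h (there i)) in
      K ℕ.+ R , λ { (here refl) → K , ℕP.m≤m+n K R , q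
                  ; (there i) → let (K′ , le , q′) = f i in K′ , ℕP.≤-trans le (ℕP.m≤n+m R K) , q′ }

    all-in? : ∀ {Q : X → Set} (xs : List X) → (∀ {x} → x ∈ xs → Dec (Q x)) → Dec (∀ {x} → x ∈ xs → Q x)
    all-in? [] h = yes λ ()
    all-in? {Q} (x ∷ xs) h with h (here refl) | all-in? {Q} xs (λ i → h (there i))
    ... | yes q | yes f = yes λ { (here refl) → q ; (there i) → f i }
    ... | no ¬q | _     = no λ f → ¬q (f (here refl))
    ... | _     | no ¬f = no λ f → ¬f (λ i → f (there i))

  all-below? : ∀ {Q : ℕ → Set} K → (∀ k → Dec (Q k)) → Dec (∀ k → k ℕ.< K → Q k)
  all-below? {Q} K Q? = map′ (λ f k k<K → f {k} (∈-upTo⁺ k<K)) (λ f {k} i → f k (∈-upTo⁻ i)) (all-in? {Q = Q} (upTo K) (λ {k} _ → Q? k))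

  module Ampleness {N : ℕ} (P : Polytope N) {d : ℕ} (isDim : IsDim P d) where
    open Holes P isDim public

    Decomp : ℕ → ℕ → Set
    Decomp n k = ∀ {a} → C (k ℕ.* n) a → SumOf (C n) k a

    decompAt⇒ : ∀ n k → DecompAt (dilate n P) k → Decomp n k
    decompAt⇒ n k h {a} p = let (as , as∈ , e) = h a (C⇒dilate₂ k n p) in sumOf as (λ i → dilate⇒C n (as∈ i)) e

    ⇒decompAt : ∀ n k → Decomp n k → DecompAt (dilate n P) k
    ⇒decompAt n k h a p = terms , (λ i → C⇒dilate n (terms∈ i)) , terms-Σ
      where open SumOf (h (dilate₂⇒C k n p))

    decomp? : ∀ n k → Dec (Decomp n k)
    decomp? n k = map′ (λ f {a} p → f {a} (pts⁺ p)) (λ f {a} i → f {a} (pts⁻ i))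
        (all-in? {Q = SumOf (C n) k} (pts (k ℕ.* n)) (λ {a} _ → C-sum? n k a))

    private
      shuffle : ∀ (b y s : Vec ℤ N) → b ⊕ (y ⊕ s) ≡ y ⊕ (b ⊕ s)
      shuffle b y s = sym (⊕-assoc b y s) ∙ cong (_⊕ s) (⊕-comm b y) ∙ ⊕-assoc y b s

    -- Write the point as y + s with `s` a sum of lattice points. If `y` is a hole, its degree e is
    -- at most n, so n - e of the lattice points complete it to one point of n P, and the others are
    -- taken in groups of n. If `y` is itself a sum of lattice points, grouping suffices.
    ≥hole⇒decomp : ∀ {μ} → Holes μ → ∀ n → μ ℕ.≤ n → ∀ k → 1 ℕ.≤ k → Decomp n k
    ≥hole⇒decomp (_ , _ , box≤ , _) n μ≤n (suc k) _ {a} p with decompose p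
    ... | split {e} {l} {y} {s} eq _ q (inj₂ sy) sm refl = group n (suc k) (subst (λ j → SumOf (C 1) j (y ⊕ s)) (sym eq) (sum-++ sy sm))
    ... | split {e} {l} {y} {s} eq _ q (inj₁ bx) sm refl = assemble (sum-split (n ℕ.∸ e) (subst (λ j → SumOf (C 1) j s) l≡ sm))
      where
      e≤n : e ℕ.≤ n
      e≤n = ℕP.≤-trans (box≤ q bx) μ≤n
      l≡ : l ≡ (n ℕ.∸ e) ℕ.+ k ℕ.* n
      l≡ = ℕP.+-cancelˡ-≡ e l _ (sym eq ∙ cong (ℕ._+ k ℕ.* n) (sym (ℕP.m+[n∸m]≡n e≤n)) ∙ ℕP.+-assoc e (n ℕ.∸ e) (k ℕ.* n))
      assemble : ∃[ s₁ ] ∃[ s₂ ] SumOf (C 1) (n ℕ.∸ e) s₁ × SumOf (C 1) (k ℕ.* n) s₂ × s₁ ⊕ s₂ ≡ s → SumOf (C n) (suc k) (y ⊕ s)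
      assemble (s₁ , s₂ , t₁ , t₂ , refl) = subst (SumOf (C n) (suc k)) (⊕-assoc y s₁ s₂)
        (sum-cons (subst (λ j → C j (y ⊕ s₁)) (ℕP.m+[n∸m]≡n e≤n) (C-⊕ q (sum₁⇒C t₁))) (group n k t₂))

    -- This makes IDP decidable. In degree (k + 1) n with k > d, the core has degree at most d,
    -- hence at most k n, and so at least n lattice points are split off. They form one summand, and
    -- the remainder has degree k n.
    decomp-stable : ∀ n → 1 ℕ.≤ n → (∀ k → k ℕ.< suc (suc d) → Decomp n k) → ∀ k → Decomp n k
    decomp-stable n 1≤n h zero = h 0 (ℕ.s≤s ℕ.z≤n)
    decomp-stable n 1≤n h (suc k) {a} p with suc k ℕP.<? suc (suc d)
    ... | yes lt = h (suc k) lt p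
    ... | no ¬lt with decompose p
    ... | split {e} {l} {y} {s} eq e≤d q _ sm refl = assemble (sum-split n (subst (λ j → SumOf (C 1) j s) l≡ sm))
      where
      e≤kn : e ℕ.≤ k ℕ.* n
      e≤kn = ℕP.≤-trans e≤d (ℕP.≤-trans (ℕP.≤-trans (ℕP.n≤1+n d) (ℕP.≤-pred (ℕP.≮⇒≥ ¬lt)))
               (ℕP.≤-trans (ℕP.≤-reflexive (sym (ℕP.*-identityʳ k))) (ℕP.*-monoʳ-≤ k 1≤n)))
      rest : ℕ
      rest = k ℕ.* n ℕ.∸ e
      l≡ : l ≡ n ℕ.+ rest
      l≡ = ℕP.+-cancelˡ-≡ e l _ (sym eq ∙ cong (n ℕ.+_) (sym (ℕP.m+[n∸m]≡n e≤kn)) ∙ swap n e rest)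
        where swap : ∀ n e r → n ℕ.+ (e ℕ.+ r) ≡ e ℕ.+ (n ℕ.+ r)
              swap = ℕR.solve-∀
      assemble : ∃[ s₁ ] ∃[ s₂ ] SumOf (C 1) n s₁ × SumOf (C 1) rest s₂ × s₁ ⊕ s₂ ≡ s → SumOf (C n) (suc k) (y ⊕ s)
      assemble (s₁ , s₂ , t₁ , t₂ , refl) = subst (SumOf (C n) (suc k)) (shuffle s₁ y s₂)
        (sum-cons (sum₁⇒C t₁) (decomp-stable n 1≤n h k (subst (λ j → C j (y ⊕ s₂)) (ℕP.m+[n∸m]≡n e≤kn) (C-⊕ q (sum₁⇒C t₂)))))

    abstract
      idp? : ∀ n → 1 ℕ.≤ n → Dec (IDP (dilate n P))
      idp? n 1≤n = map′ (λ f k _ → ⇒decompAt n k (decomp-stable n 1≤n f k)) below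
          (all-below? {Q = λ k → Decomp n k} (suc (suc d)) (decomp? n))
        where below : IDP (dilate n P) → ∀ k → k ℕ.< suc (suc d) → Decomp n k
              below f zero    _ (inC p) = sumOf (λ ()) (λ ()) (sym (C-zero⁻¹ (inC p)))
              below f (suc k) _ p = decompAt⇒ n (suc k) (f (suc k) (ℕ.s≤s ℕ.z≤n)) p

      ≥hole⇒idp : ∀ {μ} → Holes μ → ∀ n → μ ℕ.≤ n → IDP (dilate n P)
      ≥hole⇒idp H n μ≤n k 1≤k = ⇒decompAt n k (≥hole⇒decomp H n μ≤n k 1≤k)

    -- An irredundant set of generators of the cone: each generator is separated from the others.

    ConeOf : List (Fin #A) → Vect (suc N) → Set
    ConeOf xs = Cone (λ r → A (L.lookup xs r))

    coneOf-gen : ∀ {xs j} → j ∈ xs → ConeOf xs (A j)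
    coneOf-gen {xs} {j} j∈ = subst (λ j → ConeOf xs (A j)) (sym (lookup-index j∈)) (cone-gen (λ r → A (L.lookup xs r)) (index j∈))

    coneOf-trans : ∀ {xs ys} → (∀ {j} → j ∈ xs → ConeOf ys (A j)) → ∀ {x} → ConeOf xs x → ConeOf ys x
    coneOf-trans {xs} {ys} h {x} = cone-trans {A = λ r → A (L.lookup ys r)} {λ r → A (L.lookup xs r)}
        (λ r → h (∈-lookup {xs = xs} r)) {x}

    Separated : List (Fin #A) → Fin #A → Set
    Separated xs i = Σ[ y ∈ Vect (suc N) ] dot y (A i) < 0ℚ × (∀ {j} → j ∈ xs → j ≢ i → 0ℚ ≤ dot y (A j))

    -- Each generator is tested against those still to come and those already kept. Inside their
    -- cone it is dropped; otherwise Farkas' lemma separates it, and the separation survives because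
    -- later steps only remove generators.
    prune : ∀ todo kept → Σ[ xs ∈ List (Fin #A) ] (∀ {j} → j ∈ xs → j ∈ todo) ×
            (∀ {j} → j ∈ todo → ConeOf (xs ++ kept) (A j)) × (∀ {i} → i ∈ xs → Separated (xs ++ kept) i)
    prune [] kept = [] , (λ ()) , (λ ()) , λ ()
    prune (i ∷ rest) kept with farkas (λ r → A (L.lookup (rest ++ kept) r)) (A i)
    ... | inj₁ redundant with prune rest kept
    ...   | xs , sub , cov , sep = xs , (λ j∈ → there (sub j∈)) , cov′ , sep
      where
      gen : ∀ {j} → j ∈ rest ++ kept → ConeOf (xs ++ kept) (A j)
      gen j∈ with ∈-++⁻ rest j∈
      ... | inj₁ j∈rest = cov j∈rest
      ... | inj₂ j∈kept = coneOf-gen (∈-++⁺ʳ xs j∈kept)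
      cov′ : ∀ {j} → j ∈ i ∷ rest → ConeOf (xs ++ kept) (A j)
      cov′ (here refl) = coneOf-trans {rest ++ kept} {xs ++ kept} gen redundant
      cov′ (there j∈)  = cov j∈
    prune (i ∷ rest) kept | inj₂ (y , y≥0 , y<0) with prune rest (i ∷ kept)
    ...   | xs , sub , cov , sep = i ∷ xs , (λ { (here refl) → here refl ; (there j∈) → there (sub j∈) }) , cov′ , sep′
      where
      move : ∀ {j} → j ∈ xs ++ i ∷ kept → j ∈ i ∷ xs ++ kept
      move j∈ with ∈-++⁻ xs j∈
      ... | inj₁ p = there (∈-++⁺ˡ p)
      ... | inj₂ (here refl) = here refl
      ... | inj₂ (there p) = there (∈-++⁺ʳ xs p)
      move⁻¹ : ∀ {j} → j ∈ i ∷ xs ++ kept → j ∈ xs ++ i ∷ kept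
      move⁻¹ (here refl) = ∈-++⁺ʳ xs (here refl)
      move⁻¹ (there p) with ∈-++⁻ xs p
      ... | inj₁ q = ∈-++⁺ˡ q
      ... | inj₂ q = ∈-++⁺ʳ xs (there q)
      cov′ : ∀ {j} → j ∈ i ∷ rest → ConeOf (i ∷ xs ++ kept) (A j)
      cov′ (here refl) = coneOf-gen {i ∷ xs ++ kept} (here refl)
      cov′ (there j∈)  = coneOf-trans {xs ++ i ∷ kept} {i ∷ xs ++ kept} (λ p → coneOf-gen (move p)) (cov j∈)
      nonneg : ∀ {j} → j ∈ i ∷ xs ++ kept → j ≢ i → 0ℚ ≤ dot y (A j)
      nonneg (here refl) j≢i = ⊥-elim (j≢i refl)
      nonneg {j} (there p) _ = subst (λ j → 0ℚ ≤ dot y (A j)) (sym (lookup-index (in-rest (∈-++⁻ xs p))))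
          (y≥0 (index (in-rest (∈-++⁻ xs p))))
        where in-rest : j ∈ xs ⊎ j ∈ kept → j ∈ rest ++ kept
              in-rest (inj₁ q) = ∈-++⁺ˡ (sub q)
              in-rest (inj₂ q) = ∈-++⁺ʳ rest q
      sep′ : ∀ {i′} → i′ ∈ i ∷ xs → Separated (i ∷ xs ++ kept) i′
      sep′ (here refl) = y , y<0 , nonneg
      sep′ (there i′∈) = let (z , z<0 , z≥0) = sep i′∈ in z , z<0 , λ j∈ → z≥0 (move⁻¹ j∈)

    abstract
      irredundant : Σ[ gens ∈ List (Fin #A) ] (∀ {x} → Cone A x → ConeOf gens x) × (∀ {i} → i ∈ gens → Separated gens i)
      irredundant = let (xs , _ , cov , sep) = prune (allFin #A) [] in
          xs , (λ {x} → cone-trans {A = λ r → A (L.lookup xs r)} {A} (λ j → coneOf-trans {xs ++ []} {xs}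
              (λ p → coneOf-gen (unappend xs p)) (cov (∈-allFin j))) {x}) ,
          λ i∈ → let (z , z<0 , z≥0) = sep i∈ in z , z<0 , λ j∈ → z≥0 (∈-++⁺ˡ j∈)
        where unappend : ∀ {j : Fin #A} xs → j ∈ xs ++ [] → j ∈ xs
              unappend xs p with ∈-++⁻ xs p
              ... | inj₁ q = q

    gens : List (Fin #A)
    gens = proj₁ irredundant

    private
      module Exposed {i : Fin #A} (i∈ : i ∈ gens) where
       y : Vect (suc N)
       y = proj₁ (proj₂ (proj₂ irredundant) i∈)
       v : ℚ
       v = dot y (A i)
       -- The separating functional minus `v` times the degree, where v < 0. It vanishes on the ray
       -- of generator `i` and is positive at all other generators in `gens`.
       ℓ : Vect (suc N)
       ℓ t = y t - v * D t
       ℓ-value : ∀ x → dot ℓ x ≡ dot y x - v * dot D x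
       ℓ-value x = dot-subˡ y D v x
       ℓ-A : ∀ j → dot ℓ (A j) ≡ dot y (A j) - v
       ℓ-A j = ℓ-value (A j) ∙ cong (λ z → dot y (A j) - z) (cong (v *_) (deg-A j) ∙ *-identityʳ v)
       ℓ-i : dot ℓ (A i) ≡ 0ℚ
       ℓ-i = ℓ-A i ∙ +-inverseʳ v
       ℓ-pos : ∀ {j} → j ∈ gens → j ≢ i → 0ℚ < dot ℓ (A j)
       ℓ-pos {j} j∈ j≢i = subst (0ℚ <_) (+-comm (- v) (dot y (A j)) ∙ sym (ℓ-A j))
         (0<-+ (neg⁺ (proj₁ (proj₂ (proj₂ (proj₂ irredundant) i∈)))) (proj₂ (proj₂ (proj₂ (proj₂ irredundant) i∈)) j∈ j≢i))
       ℓ-nonneg : ∀ r → 0ℚ ≤ dot ℓ (A (L.lookup gens r))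
       ℓ-nonneg r = by-cases (L.lookup gens r ≟ᶠ i)
         where by-cases : Dec (L.lookup gens r ≡ i) → 0ℚ ≤ dot ℓ (A (L.lookup gens r))
               by-cases (yes e) = ≤-reflexive (sym (cong (λ j → dot ℓ (A j)) e ∙ ℓ-i))
               by-cases (no h)  = <⇒≤ (ℓ-pos (∈-lookup {xs = gens} r) h)

       -- If the functional vanished at `z`, every generator other than `i` would have coefficient
       -- 0, and the degree would force `z` to be k times `pt i`.
       strict : ∀ {k z} → C k z → z ≢ ℤ.+ k ⊙ pt i → 0ℚ < dot ℓ (hom z (ℤ.+ k))
       strict {k} {z} (inC p) z≢ = separate (proj₁ (proj₂ irredundant) (cone⇒coneA p))
         where
         separate : ConeOf gens (hom z (ℤ.+ k)) → 0ℚ < dot ℓ (hom z (ℤ.+ k))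
         separate (c , c≥0 , e) = ≤∧≢⇒< (subst (0ℚ ≤_) (sym value) (sum-nonneg terms≥0)) λ zero → z≢
             (hom-injective {z = ℤ.+ k} {ℤ.+ k} λ t →
             sym (e t) ∙ sum-cong (λ r → only r (sum-zero⇒zero terms≥0 (sym value ∙ sym zero) r) t (L.lookup gens r ≟ᶠ i))
               ∙ sum-*ʳ (A i t) c ∙ cong (_* A i t) total ∙ sym (hom-multiple t))
           where
           terms≥0 : ∀ r → 0ℚ ≤ c r * dot ℓ (A (L.lookup gens r))
           terms≥0 r = 0≤-* (c≥0 r) (ℓ-nonneg r)
           value : dot ℓ (hom z (ℤ.+ k)) ≡ sumℚ (λ r → c r * dot ℓ (A (L.lookup gens r)))
           value = dot-congʳ ℓ (λ t → sym (e t)) ∙ dot-lcʳ ℓ c (λ r → A (L.lookup gens r))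
           only : ∀ r → c r * dot ℓ (A (L.lookup gens r)) ≡ 0ℚ → ∀ t → Dec (L.lookup gens r ≡ i) → c r * A (L.lookup gens r) t ≡ c
               r * A i t
           only r z t (yes e) = cong (λ j → c r * A j t) e
           only r z t (no h)  = cong (_* A (L.lookup gens r) t) c≡0 ∙ *-zeroˡ (A (L.lookup gens r) t) ∙ sym
               (cong (_* A i t) c≡0 ∙ *-zeroˡ (A i t))
             where c≡0 : c r ≡ 0ℚ
                   c≡0 = no-zero-divisor (*-comm (dot ℓ (A (L.lookup gens r))) (c r) ∙ z) (0<⇒≢0 (ℓ-pos (∈-lookup {xs = gens} r) h))
           total : sumℚ c ≡ ℤ→ℚ (ℤ.+ k)
           total = sum-cong (λ r → sym (*-identityʳ (c r))) ∙ e zero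
           hom-multiple : ∀ t → hom (ℤ.+ k ⊙ pt i) (ℤ.+ k) t ≡ ℤ→ℚ (ℤ.+ k) * A i t
           hom-multiple t = cong (λ z → hom (ℤ.+ k ⊙ pt i) z t) (sym (ℤP.*-identityʳ (ℤ.+ k))) ∙ hom-⊙ (ℤ.+ k) (pt i) (ℤ.+ 1) t

       -- Only finitely many points have degree n, so `ℓ` has a positive minimum away from n times
       -- `pt i`. Dividing by it gives the bound 1, with which the functional counts summands; if
       -- there is no other point, the bound is vacuous.
       scaled : ∀ n → Σ[ ℓ ∈ Vect (suc N) ] dot ℓ (A i) ≡ 0ℚ × (∀ {z} → C n z → z ≢ ℤ.+ n ⊙ pt i → 1ℚ ≤ dot ℓ (hom z (ℤ.+ n)))
       scaled n = by-cases (filter (λ z → ¬? (z ≟ᵛ (ℤ.+ n ⊙ pt i))) (pts n)) refl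
         where
         others = filter (λ z → ¬? (z ≟ᵛ (ℤ.+ n ⊙ pt i))) (pts n)
         into : ∀ {z} → C n z → z ≢ ℤ.+ n ⊙ pt i → z ∈ others
         into p ne = ∈-filter⁺ (λ z → ¬? (z ≟ᵛ (ℤ.+ n ⊙ pt i))) (pts⁺ p) ne
         by-cases : ∀ xs → xs ≡ others → Σ[ ℓ ∈ Vect (suc N) ] dot ℓ (A i) ≡ 0ℚ ×
             (∀ {z} → C n z → z ≢ ℤ.+ n ⊙ pt i → 1ℚ ≤ dot ℓ (hom z (ℤ.+ n)))
         by-cases [] eq = ℓ , ℓ-i , λ {z} p ne → absurd (subst (z ∈_) (sym eq) (into p ne))
           where absurd : ∀ {z : Vec ℤ N} {X : Set} → z ∈ [] → X
                 absurd ()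
         by-cases xs@(_ ∷ _) eq with argmin (λ z → dot ℓ (hom z (ℤ.+ n))) xs (here refl)
         ... | z₀ , z₀∈ , mn = (λ t → s * ℓ t) , dot-scaleˡ s ℓ (A i) ∙ cong (s *_) ℓ-i ∙ *-zeroʳ s ,
               λ {z} p ne → subst₂ _≤_ (*-comm s ε ∙ inv-* (0<⇒≢0 ε>0)) (sym (dot-scaleˡ s ℓ (hom z (ℤ.+ n))))
                 (0≤-⇒≤ (subst (0ℚ ≤_) (distrib s (dot ℓ (hom z (ℤ.+ n))) ε)
                     (0≤-* (<⇒≤ (0<-inv ε>0)) (≤⇒0≤- (mn (subst (z ∈_) (sym eq) (into p ne)))))))
           where
           ε s : ℚ
           ε = dot ℓ (hom z₀ (ℤ.+ n))
           z₀-other : z₀ ∈ pts n × z₀ ≢ ℤ.+ n ⊙ pt i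
           z₀-other = ∈-filter⁻ (λ z → ¬? (z ≟ᵛ (ℤ.+ n ⊙ pt i))) {xs = pts n} (subst (z₀ ∈_) eq z₀∈)
           ε>0 : 0ℚ < ε
           ε>0 = strict (pts⁻ (proj₁ z₀-other)) (proj₂ z₀-other)
           s = inv ε
           distrib : ∀ s x e → s * (x - e) ≡ s * x - s * e
           distrib = solve-∀ ringℚ

    abstract
      exposing : ∀ {i} → i ∈ gens → ∀ n → Σ[ ℓ ∈ Vect (suc N) ] dot ℓ (A i) ≡ 0ℚ ×
          (∀ {z} → C n z → z ≢ ℤ.+ n ⊙ pt i → 1ℚ ≤ dot ℓ (hom z (ℤ.+ n)))
      exposing i∈ = Exposed.scaled i∈

-- Deciding very ampleness of dilations

module VeryAmpleDilations where

  open Rationals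
  open LinearAlgebra
  open BasesOfCones
  open Triangulations
  open LatticePoints
  open Boxes
  open Decompositions
  open import Data.Rational using (0ℚ; 1ℚ; _+_; _*_; _-_; -_; _≤_; _<_)
  open ℚP hiding (neg-pos)

  ⊙-distrib : ∀ {N} j k (p : Vec ℤ N) → (j ℤ.+ k) ⊙ p ≡ j ⊙ p ⊕ k ⊙ p
  ⊙-distrib j k p = vec-ext λ t → lookup-⊙ (j ℤ.+ k) p t ∙ ℤP.*-distribʳ-+ (lookup p t) j k
    ∙ sym (lookup-⊕ (j ⊙ p) (k ⊙ p) t ∙ cong₂ ℤ._+_ (lookup-⊙ j p t) (lookup-⊙ k p t))

  ⊙-assoc : ∀ {N} j k (p : Vec ℤ N) → j ⊙ (k ⊙ p) ≡ (j ℤ.* k) ⊙ p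
  ⊙-assoc j k p = vec-ext λ t → lookup-⊙ j (k ⊙ p) t ∙ cong (j ℤ.*_) (lookup-⊙ k p t)
    ∙ sym (ℤP.*-assoc j k (lookup p t)) ∙ sym (lookup-⊙ (j ℤ.* k) p t)

  ⊙-zero : ∀ {N} (p : Vec ℤ N) → (ℤ.+ 0) ⊙ p ≡ zerosℤ
  ⊙-zero p = vec-ext λ t → lookup-⊙ (ℤ.+ 0) p t ∙ sym (lookup-zeros t)

  ⊙-one : ∀ {N} (p : Vec ℤ N) → (ℤ.+ 1) ⊙ p ≡ p
  ⊙-one p = vec-ext λ t → lookup-⊙ (ℤ.+ 1) p t ∙ ℤP.*-identityˡ (lookup p t)

  sum-multiple : ∀ {N} {X : Vec ℤ N → Set} {p} → X p → ∀ k → SumOf X k (ℤ.+ k ⊙ p)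
  sum-multiple {X = X} {p} x zero    = subst (SumOf X 0) (sym (⊙-zero p)) sum-nil
  sum-multiple {X = X} {p} x (suc k) = subst (SumOf X (suc k)) (cong (_⊕ ℤ.+ k ⊙ p) (sym (⊙-one p)) ∙ sym (⊙-distrib (ℤ.+ 1) (ℤ.+ k) p))
    (sum-cons x (sum-multiple x k))

  module VeryAmpleness {N : ℕ} (P : Polytope N) {d : ℕ} (isDim : IsDim P d) where
    open Ampleness P isDim public

    EventuallyDecomp : ℕ → Set
    EventuallyDecomp n = ∃[ k₀ ] ∀ k → k₀ ℕ.≤ k → Decomp n k

    Absorbed : ℕ → Fin #A → ℕ → Vec ℤ N → ℕ → Set
    Absorbed n i e y K = ∃[ l ] e ℕ.+ K ≡ l ℕ.* n × SumOf (C n) l (y ⊕ ℤ.+ K ⊙ pt i)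

    -- Very ampleness as a local condition at each exposed generator: copies of `pt i` may be added
    -- until the sum decomposes in n P. Degrees up to d suffice, because the cores left by
    -- `decompose` have such degrees, and this leaves finitely many conditions.
    Criterion : ℕ → Set
    Criterion n = ∀ {i} → i ∈ gens → ∀ {e y} → e ℕ.≤ d → C e y → ∃[ K ] Absorbed n i e y K

    private
      grid : Σ[ xs ∈ List (ℕ × Vec ℤ N) ] (∀ {e y} → e ℕ.≤ d → C e y → (e , y) ∈ xs) × (∀ {e y} → (e , y) ∈ xs → e ℕ.≤ d × C e y)
      grid = graded-list d

    criterion-bound : ∀ n → Criterion n →
                      ∃[ R ] (∀ {i} → i ∈ gens → ∀ {e y} → e ℕ.≤ d → C e y → ∃[ K ] K ℕ.≤ R × Absorbed n i e y K)
    criterion-bound n crit =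
      let (R , f) = common-bound {Q = λ i R → ∀ {x} → x ∈ proj₁ grid → ∃[ K ] K ℕ.≤ R × Absorbed n i (proj₁ x) (proj₂ x) K} gens
                      (λ {i} i∈ → common-bound {Q = λ x K → Absorbed n i (proj₁ x) (proj₂ x) K} (proj₁ grid) (λ {x} x∈ →
                          let (le , p) = proj₂ (proj₂ grid) {proj₁ x} {proj₂ x} x∈ in crit i∈ le p)) in
      R , λ {i} i∈ {e} {y} le p → let (R′ , R′≤ , g) = f i∈ ; (K , K≤ , ab) = g {e , y} (proj₁ (proj₂ grid) le p) in
        K , ℕP.≤-trans K≤ R′≤ , ab

    private
      -- Pigeonhole: the coefficients sum to `k`, which exceeds the number of generators times `R`.
      heavy : ∀ R {x} k → ((c , c≥0 , e) : ConeOf gens x) → x zero ≡ ℤ→ℚ (ℤ.+ k) → length gens ℕ.* R ℕ.< k → ∃[ r ] ℤ→ℚ (ℤ.+ R) ≤ c r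
      heavy R {x} k (c , c≥0 , e) x₀ lt with any? (λ r → ℤ→ℚ (ℤ.+ R) ≤? c r)
      ... | yes p = p
      ... | no none = ⊥-elim (ℕP.<⇒≱ lt (ℤP.drop‿+≤+ (ℤ→ℚ-cancel-≤ {ℤ.+ k} {ℤ.+ (length gens ℕ.* R)}
          (subst₂ _≤_ total bound (sum-mono (λ r → <⇒≤ (≰⇒> (λ le → none (r , le)))))))))
        where
        total : sumℚ c ≡ ℤ→ℚ (ℤ.+ k)
        total = sum-cong (λ r → sym (*-identityʳ (c r))) ∙ e zero ∙ x₀
        bound : sumℚ {length gens} (λ _ → ℤ→ℚ (ℤ.+ R)) ≡ ℤ→ℚ (ℤ.+ (length gens ℕ.* R))
        bound = sum-cong {length gens} (λ _ → sym (*-identityˡ (ℤ→ℚ (ℤ.+ R)))) ∙ sum-*ʳ {length gens} (ℤ→ℚ (ℤ.+ R)) (λ _ → 1ℚ) ∙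
            cong (_* ℤ→ℚ (ℤ.+ R)) (sum-const (length gens))
          ∙ sym (ℤ→ℚ-* (ℤ.+ length gens) (ℤ.+ R)) ∙ cong ℤ→ℚ (sym (ℤP.pos-* (length gens) R))

      peel : ∀ R k {a} → C k a → length gens ℕ.* R ℕ.< k → ∃[ i ] i ∈ gens × R ℕ.≤ k × C (k ℕ.∸ R) (a ⊖ ℤ.+ R ⊙ pt i)
      peel R k {a} (inC p) lt = peel′ (proj₁ (proj₂ irredundant) (cone⇒coneA p))
        where
        peel′ : ConeOf gens (hom a (ℤ.+ k)) → _
        peel′ cc@(c , c≥0 , e) = let (r , le) = heavy R k cc refl lt in at r le
          where
          at : ∀ r → ℤ→ℚ (ℤ.+ R) ≤ c r → ∃[ i ] i ∈ gens × R ℕ.≤ k × C (k ℕ.∸ R) (a ⊖ ℤ.+ R ⊙ pt i)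
          at r le = i , ∈-lookup {xs = gens} r , R≤k , inC (coneA⇒cone
              (cone-trans {A = A} {λ r → A (L.lookup gens r)} (λ r → cone-gen A (L.lookup gens r)) cone′))
            where
            i : Fin #A
            i = L.lookup gens r
            R≤k : R ℕ.≤ k
            R≤k = ℤP.drop‿+≤+ (ℤ→ℚ-cancel-≤ {ℤ.+ R} {ℤ.+ k} (≤-trans le
                (subst (c r ≤_) (sum-cong (λ r → sym (*-identityʳ (c r))) ∙ e zero) (term≤sum c≥0 r))))
            c′ : Fin (length gens) → ℚ
            c′ r′ = c r′ - ℤ→ℚ (ℤ.+ R) * δ r′ r
            by-cases : ∀ r′ → Dec (r′ ≡ r) → 0ℚ ≤ c′ r′
            by-cases r′ (yes refl) = subst (λ z → 0ℚ ≤ c r - z) (sym (cong (ℤ→ℚ (ℤ.+ R) *_) (δ-refl r) ∙ *-identityʳ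
                (ℤ→ℚ (ℤ.+ R)))) (≤⇒0≤- le)
            by-cases r′ (no h) = subst (0ℚ ≤_) (sym (cong (λ z → c r′ - ℤ→ℚ (ℤ.+ R) * z) (δ-≢ h) ∙ eq (c r′) (ℤ→ℚ (ℤ.+ R)))) (c≥0 r′)
              where eq : ∀ c r → c - r * 0ℚ ≡ c
                    eq = solve-∀ ringℚ
            value : ∀ t → hom (a ⊖ ℤ.+ R ⊙ pt i) (ℤ.+ (k ℕ.∸ R)) t ≡ hom a (ℤ.+ k) t - ℤ→ℚ (ℤ.+ R) * A i t
            value t = cong (λ z → hom (a ⊖ ℤ.+ R ⊙ pt i) z t) (sym (ℤP.⊖-≥ R≤k) ∙ sym (ℤP.m-n≡m⊖n k R))
              ∙ hom-⊖ a (ℤ.+ R ⊙ pt i) (ℤ.+ k) (ℤ.+ R) t ∙ cong (λ z → hom a (ℤ.+ k) t - z)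
                (cong (λ z → hom (ℤ.+ R ⊙ pt i) z t) (sym (ℤP.*-identityʳ (ℤ.+ R))) ∙ hom-⊙ (ℤ.+ R) (pt i) (ℤ.+ 1) t)
            cone′ : ConeOf gens (hom (a ⊖ ℤ.+ R ⊙ pt i) (ℤ.+ (k ℕ.∸ R)))
            cone′ = c′ , (λ r′ → by-cases r′ (r′ ≟ᶠ r)) , λ t →
              sum-cong (λ r′ → eq (c r′) (ℤ→ℚ (ℤ.+ R)) (δ r′ r) (A (L.lookup gens r′) t))
                ∙ sum-- (λ r′ → c r′ * A (L.lookup gens r′) t) (λ r′ → ℤ→ℚ (ℤ.+ R) * (A (L.lookup gens r′) t * δ r′ r))
                  ∙ cong₂ _-_ (e t) (sum-*ˡ (ℤ→ℚ (ℤ.+ R)) (λ r′ → A (L.lookup gens r′) t * δ r′ r)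
                    ∙ cong (ℤ→ℚ (ℤ.+ R) *_) (sum-δ (λ r′ → A (L.lookup gens r′) t) r)) ∙ sym (value t)
              where eq : ∀ c R d a → (c - R * d) * a ≡ c * a - R * (a * d)
                    eq = solve-∀ ringℚ

    -- In large degree some generator `i` has coefficient at least `R`, and R copies of `pt i` are
    -- removed. The rest is a core of degree at most d plus lattice points. The core absorbs K ≤ R
    -- of the copies and becomes a sum of points of n P; the other R - K copies join the lattice
    -- points, whose number is then divisible by n.
    criterion⇒decomp : ∀ n → 1 ℕ.≤ n → Criterion n → EventuallyDecomp n
    criterion⇒decomp n 1≤n crit = suc (length gens ℕ.* R) , large
      where
      R = proj₁ (criterion-bound n crit)
      absorb : ∀ {i} → i ∈ gens → ∀ {e y} → e ℕ.≤ d → C e y → ∃[ K ] K ℕ.≤ R × Absorbed n i e y K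
      absorb = proj₂ (criterion-bound n crit)
      module _ (k : ℕ) {a : Vec ℤ N} (i : Fin #A) (i∈ : i ∈ gens) (R≤ : R ℕ.≤ k ℕ.* n) where
        finish : ∀ {e l y s K l′} → k ℕ.* n ℕ.∸ R ≡ e ℕ.+ l → SumOf (C 1) l s → y ⊕ s ≡ a ⊖ ℤ.+ R ⊙ pt i → K ℕ.≤ R →
                 e ℕ.+ K ≡ l′ ℕ.* n → SumOf (C n) l′ (y ⊕ ℤ.+ K ⊙ pt i) → SumOf (C n) k a
        finish {e} {l} {y} {s} {K} {l′} eq sm f K≤R deg′ core = subst₂ (SumOf (C n)) (ℕP.m+[n∸m]≡n l′≤k) vectors
            (sum-++ core (group n (k ℕ.∸ l′) (subst (λ j → SumOf (C 1) j (ℤ.+ (R ℕ.∸ K) ⊙ pt i ⊕ s)) remaining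
                (sum-++ (sum-multiple (C-pt i) (R ℕ.∸ K)) sm))))
          where
          total : k ℕ.* n ≡ l′ ℕ.* n ℕ.+ ((R ℕ.∸ K) ℕ.+ l)
          total = sym (ℕP.m∸n+n≡m R≤) ∙ cong₂ ℕ._+_ eq (sym (ℕP.m+[n∸m]≡n K≤R)) ∙ arrange e l K (R ℕ.∸ K) ∙ cong
              (ℕ._+ ((R ℕ.∸ K) ℕ.+ l)) deg′
            where arrange : ∀ e l K r → (e ℕ.+ l) ℕ.+ (K ℕ.+ r) ≡ (e ℕ.+ K) ℕ.+ (r ℕ.+ l)
                  arrange = ℕR.solve-∀
          l′≤k : l′ ℕ.≤ k
          l′≤k = ℕP.*-cancelʳ-≤ l′ k n {{ℕ.>-nonZero 1≤n}} (ℕP.≤-trans (ℕP.m≤m+n (l′ ℕ.* n) _) (ℕP.≤-reflexive (sym total)))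
          remaining : (R ℕ.∸ K) ℕ.+ l ≡ (k ℕ.∸ l′) ℕ.* n
          remaining = sym (ℕP.*-distribʳ-∸ n k l′ ∙ cong (ℕ._∸ l′ ℕ.* n) total ∙ ℕP.m+n∸m≡n (l′ ℕ.* n) ((R ℕ.∸ K) ℕ.+ l))
          R≡ : ℤ.+ R ≡ ℤ.+ K ℤ.+ ℤ.+ (R ℕ.∸ K)
          R≡ = cong ℤ.+_ (sym (ℕP.m+[n∸m]≡n K≤R)) ∙ ℤP.pos-+ K (R ℕ.∸ K)
          p = pt i
          vectors : (y ⊕ ℤ.+ K ⊙ p) ⊕ (ℤ.+ (R ℕ.∸ K) ⊙ p ⊕ s) ≡ a
          vectors = ⊕-assoc y (ℤ.+ K ⊙ p) _ ∙ cong (y ⊕_) (sym (⊕-assoc (ℤ.+ K ⊙ p) (ℤ.+ (R ℕ.∸ K) ⊙ p) s)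
              ∙ cong (_⊕ s) (sym (⊙-distrib (ℤ.+ K) (ℤ.+ (R ℕ.∸ K)) p) ∙ cong (_⊙ p) (sym R≡)) ∙ ⊕-comm (ℤ.+ R ⊙ p) s)
            ∙ sym (⊕-assoc y s (ℤ.+ R ⊙ p)) ∙ cong (_⊕ ℤ.+ R ⊙ p) f ∙ (⊖-⊕ a (ℤ.+ R ⊙ p))
        from-split : Split (k ℕ.* n ℕ.∸ R) (a ⊖ ℤ.+ R ⊙ pt i) → SumOf (C n) k a
        from-split (split {e} {l} {y} {s} eq e≤d q _ sm f) =
          let (K , K≤R , l′ , deg′ , core) = absorb i∈ e≤d q in finish {e} {l} {y} {s} {K} {l′} eq sm f K≤R deg′ core
      large : ∀ k → length gens ℕ.* R ℕ.< k → Decomp n k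
      large k lt {a} p = let (i , i∈ , R≤ , q) = peel R (k ℕ.* n) p (ℕP.<-≤-trans lt
                               (ℕP.≤-trans (ℕP.≤-reflexive (sym (ℕP.*-identityʳ k))) (ℕP.*-monoʳ-≤ k 1≤n))) in
        from-split k i i∈ R≤ (decompose q)

    private
      degree-cover : ∀ n → 1 ℕ.≤ n → ∀ e l → e ℕ.≤ (l ℕ.+ e) ℕ.* n
      degree-cover n 1≤n e l = ℕP.≤-trans (ℕP.m≤n+m e l) (ℕP.≤-trans (ℕP.≤-reflexive (sym (ℕP.*-identityʳ (l ℕ.+ e))))
          (ℕP.*-monoʳ-≤ (l ℕ.+ e) 1≤n))

    decomp⇒criterion : ∀ n → 1 ℕ.≤ n → EventuallyDecomp n → Criterion n
    decomp⇒criterion n 1≤n (k₀ , h) {i} i∈ {e} {y} e≤d q = K , k₀ ℕ.+ e , e+K≡ ,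
        h (k₀ ℕ.+ e) (ℕP.m≤m+n k₀ e) (subst (λ j → C j (y ⊕ ℤ.+ K ⊙ pt i)) e+K≡ (C-⊕ q (sum₁⇒C (sum-multiple (C-pt i) K))))
      where
      -- The extra summand `e` makes (k₀ + e) n at least `e`, so the truncated subtraction is exact.
      K = (k₀ ℕ.+ e) ℕ.* n ℕ.∸ e
      e+K≡ : e ℕ.+ K ≡ (k₀ ℕ.+ e) ℕ.* n
      e+K≡ = ℕP.m+[n∸m]≡n (degree-cover n 1≤n e k₀)

    -- Allowing negative multiples of pt i, absorption only has to be tested for boundedly many
    -- summands, since a functional exposing pt i bounds the number of summands different from n ⊙ pt i.
    private
      module Search {n : ℕ} (1≤n : 1 ℕ.≤ n) {i : Fin #A} (i∈ : i ∈ gens) {e : ℕ} {y : Vec ℤ N} (q : C e y) where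
       p : Vec ℤ N
       p = pt i
       p∈ : C n (ℤ.+ n ⊙ p)
       p∈ = sum₁⇒C (sum-multiple (C-pt i) n)
       target : ℕ → Vec ℤ N
       target l = y ⊕ (ℤ.+ (l ℕ.* n) ℤ.- ℤ.+ e) ⊙ p
       Q : ℕ → Set
       Q l = SumOf (C n) l (target l)

       shift : ∀ l r → target (l ℕ.+ r) ≡ target l ⊕ ℤ.+ (r ℕ.* n) ⊙ p
       shift l r = cong (λ z → y ⊕ z ⊙ p) coefficient ∙ cong (y ⊕_) (⊙-distrib (ℤ.+ (l ℕ.* n) ℤ.- ℤ.+ e) (ℤ.+ (r ℕ.* n)) p)
         ∙ sym (⊕-assoc y ((ℤ.+ (l ℕ.* n) ℤ.- ℤ.+ e) ⊙ p) (ℤ.+ (r ℕ.* n) ⊙ p))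
         where coefficient : ℤ.+ ((l ℕ.+ r) ℕ.* n) ℤ.- ℤ.+ e ≡ (ℤ.+ (l ℕ.* n) ℤ.- ℤ.+ e) ℤ.+ ℤ.+ (r ℕ.* n)
               coefficient = cong (λ z → ℤ.+ z ℤ.- ℤ.+ e) (ℕP.*-distribʳ-+ n l r) ∙ cong (ℤ._- ℤ.+ e)
                   (ℤP.pos-+ (l ℕ.* n) (r ℕ.* n)) ∙ eq (ℤ.+ (l ℕ.* n)) (ℤ.+ (r ℕ.* n)) (ℤ.+ e)
                 where eq : ∀ a b c → (a ℤ.+ b) ℤ.- c ≡ (a ℤ.- c) ℤ.+ b
                       eq = ℤR.solve-∀

       copies : ∀ r → SumOf (C n) r (ℤ.+ (r ℕ.* n) ⊙ p)
       copies r = subst (SumOf (C n) r) (⊙-assoc (ℤ.+ r) (ℤ.+ n) p ∙ cong (_⊙ p) (sym (ℤP.pos-* r n))) (sum-multiple p∈ r)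

       -- The multiple l n - e of `p` in `target l` may be negative; e further copies of n ⊙ p make
       -- it nonnegative.
       Q⇒absorbed : ∀ l → Q l → ∃[ K ] Absorbed n i e y K
       Q⇒absorbed l s = K , l ℕ.+ e , e+K≡ , subst (SumOf (C n) (l ℕ.+ e)) (sym (shift l e) ∙ cong (λ z → y ⊕ z ⊙ p) coefficient)
           (sum-++ s (copies e))
         where
         K = (l ℕ.+ e) ℕ.* n ℕ.∸ e
         le = degree-cover n 1≤n e l
         e+K≡ : e ℕ.+ K ≡ (l ℕ.+ e) ℕ.* n
         e+K≡ = ℕP.m+[n∸m]≡n le
         coefficient : ℤ.+ ((l ℕ.+ e) ℕ.* n) ℤ.- ℤ.+ e ≡ ℤ.+ K
         coefficient = ℤP.m-n≡m⊖n ((l ℕ.+ e) ℕ.* n) e ∙ ℤP.⊖-≥ le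

       absorbed⇒Q : ∀ {K} → Absorbed n i e y K → ∃[ l ] Q l
       absorbed⇒Q {K} (l , e+K≡ , s) = l , subst (λ z → SumOf (C n) l (y ⊕ z ⊙ p)) coefficient s
         where coefficient : ℤ.+ K ≡ ℤ.+ (l ℕ.* n) ℤ.- ℤ.+ e
               coefficient = eq (ℤ.+ K) (ℤ.+ e) ∙ cong (ℤ._- ℤ.+ e) (sym (ℤP.pos-+ e K) ∙ cong ℤ.+_ e+K≡)
                 where eq : ∀ a b → a ≡ (b ℤ.+ a) ℤ.- b
                       eq = ℤR.solve-∀

       ℓ : Vect (suc N)
       ℓ = proj₁ (exposing i∈ n)
       ℓ-i : dot ℓ (A i) ≡ 0ℚ
       ℓ-i = proj₁ (proj₂ (exposing i∈ n))
       ℓ≥1 : ∀ {z} → C n z → z ≢ ℤ.+ n ⊙ p → 1ℚ ≤ dot ℓ (hom z (ℤ.+ n))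
       ℓ≥1 = proj₂ (proj₂ (exposing i∈ n))

       ℓ-⊕ : ∀ {a b} j k → dot ℓ (hom (a ⊕ b) (j ℤ.+ k)) ≡ dot ℓ (hom a j) + dot ℓ (hom b k)
       ℓ-⊕ {a} {b} j k = dot-congʳ ℓ (λ t → hom-⊕ a b j k t ∙ cong (hom a j t +_) (sym (*-identityˡ (hom b k t))))
         ∙ dot-addʳ ℓ (hom a j) (hom b k) 1ℚ ∙ cong (dot ℓ (hom a j) +_) (*-identityˡ (dot ℓ (hom b k)))

       ℓ-⊙ : ∀ z → dot ℓ (hom (z ⊙ p) z) ≡ 0ℚ
       ℓ-⊙ z = dot-congʳ ℓ (λ t → cong (λ w → hom (z ⊙ p) w t) (sym (ℤP.*-identityʳ z)) ∙ hom-⊙ z p (ℤ.+ 1) t)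
         ∙ dot-comm ℓ (λ t → ℤ→ℚ z * A i t) ∙ dot-scaleˡ (ℤ→ℚ z) (A i) ℓ ∙ cong (ℤ→ℚ z *_) (dot-comm (A i) ℓ ∙ ℓ-i) ∙ *-zeroʳ (ℤ→ℚ z)

       Thinned : ℕ → Vec ℤ N → Set
       Thinned l Z = ∃[ l′ ] ∃[ r ] ∃[ Z′ ] l ≡ l′ ℕ.+ r × SumOf (C n) l′ Z′ × Z′ ⊕ ℤ.+ (r ℕ.* n) ⊙ p ≡ Z ×
                     ℤ→ℚ (ℤ.+ l′) ≤ dot ℓ (hom Z (ℤ.+ (l ℕ.* n)))

       ℓ-cons : ∀ l b Z → dot ℓ (hom (b ⊕ Z) (ℤ.+ (suc l ℕ.* n))) ≡ dot ℓ (hom b (ℤ.+ n)) + dot ℓ (hom Z (ℤ.+ (l ℕ.* n)))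
       ℓ-cons l b Z = cong (λ z → dot ℓ (hom (b ⊕ Z) z)) (ℤP.pos-+ n (l ℕ.* n)) ∙ ℓ-⊕ {b} {Z} (ℤ.+ n) (ℤ.+ (l ℕ.* n))

       thin-cons : ∀ {l b Z} → C n b → Dec (b ≡ ℤ.+ n ⊙ p) → Thinned l Z → Thinned (suc l) (b ⊕ Z)
       thin-cons {l} {b} {Z} b∈ (no b≢) (l′ , r , Z′ , eq , s , f , le) =
         suc l′ , r , b ⊕ Z′ , cong suc eq , sum-cons b∈ s , ⊕-assoc b Z′ (ℤ.+ (r ℕ.* n) ⊙ p) ∙ cong (b ⊕_) f ,
         subst₂ _≤_ (sym (ℤ→ℚ-+ (ℤ.+ 1) (ℤ.+ l′))) (sym (ℓ-cons l b Z)) (+-mono-≤ (ℓ≥1 b∈ b≢) le)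
       thin-cons {l} {b} {Z} b∈ (yes b≡) (l′ , r , Z′ , eq , s , f , le) =
         l′ , suc r , Z′ , cong suc eq ∙ sym (ℕP.+-suc l′ r) , s , vectors , subst (ℤ→ℚ (ℤ.+ l′) ≤_) (sym value) le
         where
         open ≡-Reasoning
         value : dot ℓ (hom (b ⊕ Z) (ℤ.+ (suc l ℕ.* n))) ≡ dot ℓ (hom Z (ℤ.+ (l ℕ.* n)))
         value = ℓ-cons l b Z ∙ cong (_+ dot ℓ (hom Z (ℤ.+ (l ℕ.* n)))) (cong (λ v → dot ℓ (hom v (ℤ.+ n))) b≡ ∙ ℓ-⊙ (ℤ.+ n))
           ∙ +-identityˡ (dot ℓ (hom Z (ℤ.+ (l ℕ.* n))))
         vectors : Z′ ⊕ ℤ.+ (suc r ℕ.* n) ⊙ p ≡ b ⊕ Z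
         vectors = begin
           Z′ ⊕ ℤ.+ (suc r ℕ.* n) ⊙ p                 ≡⟨ cong (λ z → Z′ ⊕ z ⊙ p) (ℤP.pos-+ n (r ℕ.* n)) ⟩
           Z′ ⊕ (ℤ.+ n ℤ.+ ℤ.+ (r ℕ.* n)) ⊙ p         ≡⟨ cong (Z′ ⊕_) (⊙-distrib (ℤ.+ n) (ℤ.+ (r ℕ.* n)) p) ⟩
           Z′ ⊕ (ℤ.+ n ⊙ p ⊕ ℤ.+ (r ℕ.* n) ⊙ p)       ≡⟨ cong (Z′ ⊕_) (⊕-comm (ℤ.+ n ⊙ p) (ℤ.+ (r ℕ.* n) ⊙ p)) ⟩
           Z′ ⊕ (ℤ.+ (r ℕ.* n) ⊙ p ⊕ ℤ.+ n ⊙ p)       ≡⟨ sym (⊕-assoc Z′ (ℤ.+ (r ℕ.* n) ⊙ p) (ℤ.+ n ⊙ p)) ⟩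
           (Z′ ⊕ ℤ.+ (r ℕ.* n) ⊙ p) ⊕ ℤ.+ n ⊙ p       ≡⟨ cong₂ _⊕_ f (sym b≡) ⟩
           Z ⊕ b                                       ≡⟨ ⊕-comm Z b ⟩
           b ⊕ Z ∎

       thin : ∀ l {Z} → SumOf (C n) l Z → Thinned l Z
       thin zero (sumOf _ _ refl) = 0 , 0 , zerosℤ , refl , sum-nil , ⊕-identityˡ (ℤ.+ 0 ⊙ p) ∙ ⊙-zero p ,
         ≤-reflexive (sym (cong (λ v → dot ℓ (hom v (ℤ.+ 0))) (sym (⊙-zero p)) ∙ ℓ-⊙ (ℤ.+ 0)))
       thin (suc l) s = let (b , Z , b∈ , s′ , e) = sum-uncons s in
         subst (Thinned (suc l)) e (thin-cons {l} {b} {Z} b∈ (b ≟ᵛ (ℤ.+ n ⊙ p)) (thin l s′))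

       bound : ∃[ β ] dot ℓ (hom y (ℤ.+ e)) ≤ ℤ→ℚ (ℤ.+ β)
       bound = ℚ≤ℕ (dot ℓ (hom y (ℤ.+ e)))

       -- Since `ℓ` vanishes on multiples of `p`, its value at every target is its value at `y`.
       -- After all copies of n ⊙ p are dropped, each remaining summand contributes at least 1 to
       -- it; and dropping r copies turns `target (l′ + r)` into `target l′`.
       Q-bounded : ∀ {l} → Q l → ∃[ l′ ] l′ ℕ.< suc (proj₁ bound) × Q l′
       Q-bounded {l} s with thin l s
       ... | l′ , r , Z′ , refl , s′ , f , le = l′ , ℕ.s≤s (ℤP.drop‿+≤+
           (ℤ→ℚ-cancel-≤ {ℤ.+ l′} {ℤ.+ proj₁ bound} (≤-trans le (subst (_≤ ℤ→ℚ (ℤ.+ proj₁ bound)) (sym value) (proj₂ bound))))) ,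
             subst (SumOf (C n) l′) (sym (⊕-⊖ Z′ (ℤ.+ (r ℕ.* n) ⊙ p)) ∙ cong (_⊖ ℤ.+ (r ℕ.* n) ⊙ p) (f ∙ shift l′ r) ∙
                 (⊕-⊖ (target l′) (ℤ.+ (r ℕ.* n) ⊙ p))) s′
         where
         w : ℤ
         w = ℤ.+ ((l′ ℕ.+ r) ℕ.* n) ℤ.- ℤ.+ e
         value : dot ℓ (hom (target (l′ ℕ.+ r)) (ℤ.+ ((l′ ℕ.+ r) ℕ.* n))) ≡ dot ℓ (hom y (ℤ.+ e))
         value = cong (λ z → dot ℓ (hom (target (l′ ℕ.+ r)) z)) (eq (ℤ.+ ((l′ ℕ.+ r) ℕ.* n)) (ℤ.+ e)) ∙ ℓ-⊕ {y} {w ⊙ p} (ℤ.+ e) w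
           ∙ cong (dot ℓ (hom y (ℤ.+ e)) +_) (ℓ-⊙ w) ∙ +-identityʳ (dot ℓ (hom y (ℤ.+ e)))
           where eq : ∀ a b → a ≡ b ℤ.+ (a ℤ.- b)
                 eq = ℤR.solve-∀

       absorbed? : Dec (∃[ K ] Absorbed n i e y K)
       absorbed? = map′ (λ (l , _ , s) → Q⇒absorbed l s) (λ (K , ab) → let (l , s) = absorbed⇒Q {K} ab in Q-bounded {l} s)
         (ℕP.anyUpTo? (λ l → C-sum? n l (target l)) (suc (proj₁ bound)))

    abstract
      criterion? : ∀ n → 1 ℕ.≤ n → Dec (Criterion n)
      criterion? n 1≤n = map′ (λ f {i} i∈ {e} {y} le q → f {i} i∈ {e , y} (proj₁ (proj₂ grid) le q))
        (λ f {i} i∈ {x} x∈ → let (le , q) = proj₂ (proj₂ grid) {proj₁ x} {proj₂ x} x∈ in f {i} i∈ {proj₁ x} {proj₂ x} le q)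
        (all-in? {Q = λ i → ∀ {x} → x ∈ proj₁ grid → ∃[ K ] Absorbed n i (proj₁ x) (proj₂ x) K} gens
          (λ {i} i∈ → all-in? {Q = λ x → ∃[ K ] Absorbed n i (proj₁ x) (proj₂ x) K} (proj₁ grid)
            (λ {x} x∈ → Search.absorbed? 1≤n {i} i∈ {proj₁ x} {proj₂ x} (proj₂ (proj₂ (proj₂ grid) {proj₁ x} {proj₂ x} x∈)))))

    criterion⇒veryAmple : ∀ n → 1 ℕ.≤ n → Criterion n → VeryAmple (dilate n P)
    criterion⇒veryAmple n 1≤n crit = let (k₀ , h) = criterion⇒decomp n 1≤n crit in k₀ , λ k le → ⇒decompAt n k (h k le)

    abstract
      veryAmple? : ∀ n → 1 ℕ.≤ n → Dec (VeryAmple (dilate n P))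
      veryAmple? n 1≤n = map′ (criterion⇒veryAmple n 1≤n) (λ (k₀ , h) → decomp⇒criterion n 1≤n
          (k₀ , λ k le → decompAt⇒ n k (h k le))) (criterion? n 1≤n)

-- Irreducible elements and the minimal Hilbert basis

module HilbertBases where

  open Rationals
  open LinearAlgebra
  open BasesOfCones
  open Triangulations
  open LatticePoints
  open Boxes
  open Decompositions
  open VeryAmpleDilations
  open import Data.Rational using (0ℚ; 1ℚ; _+_; _*_; _-_; -_; _≤_; _<_)
  open ℚP hiding (neg-pos)

  sumℤ-cong : ∀ {k} {f g : Fin k → ℤ} → (∀ i → f i ≡ g i) → sumℤ f ≡ sumℤ g
  sumℤ-cong {zero}  h = refl
  sumℤ-cong {suc k} h = cong₂ ℤ._+_ (h zero) (sumℤ-cong (h ∘ suc))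

  sumℤ-+ : ∀ {k} (f g : Fin k → ℤ) → sumℤ (λ i → f i ℤ.+ g i) ≡ sumℤ f ℤ.+ sumℤ g
  sumℤ-+ {zero}  f g = refl
  sumℤ-+ {suc k} f g = cong (λ w → (f zero ℤ.+ g zero) ℤ.+ w) (sumℤ-+ (f ∘ suc) (g ∘ suc))
    ∙ eq (f zero) (g zero) (sumℤ (f ∘ suc)) (sumℤ (g ∘ suc))
    where eq : ∀ a b c d → (a ℤ.+ b) ℤ.+ (c ℤ.+ d) ≡ (a ℤ.+ c) ℤ.+ (b ℤ.+ d)
          eq = ℤR.solve-∀

  sumVℤ-cong : ∀ {k N} {f g : Fin k → Vec ℤ N} → (∀ i → f i ≡ g i) → sumVℤ f ≡ sumVℤ g
  sumVℤ-cong {zero}  h = refl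
  sumVℤ-cong {suc k} h = cong₂ _⊕_ (h zero) (sumVℤ-cong (h ∘ suc))

  sumVℤ-⊕ : ∀ {k N} (f g : Fin k → Vec ℤ N) → sumVℤ (λ i → f i ⊕ g i) ≡ sumVℤ f ⊕ sumVℤ g
  sumVℤ-⊕ {zero}  f g = sym (⊕-identityˡ zerosℤ)
  sumVℤ-⊕ {suc k} f g = cong ((f zero ⊕ g zero) ⊕_) (sumVℤ-⊕ (f ∘ suc) (g ∘ suc))
    ∙ interchange (f zero) (g zero) (sumVℤ (f ∘ suc)) (sumVℤ (g ∘ suc))
    where
    interchange : ∀ {N} (a b c d : Vec ℤ N) → (a ⊕ b) ⊕ (c ⊕ d) ≡ (a ⊕ c) ⊕ (b ⊕ d)
    interchange a b c d = ⊕-assoc a b (c ⊕ d) ∙ cong (a ⊕_) (sym (⊕-assoc b c d) ∙ cong (_⊕ d) (⊕-comm b c) ∙ ⊕-assoc c b d)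
      ∙ sym (⊕-assoc a c (b ⊕ d))

  infixl 6 _⊞_
  _⊞_ : ∀ {N} → ZVec N → ZVec N → ZVec N
  (a , z) ⊞ (b , w) = a ⊕ b , z ℤ.+ w

  zeroZ : ∀ {N} → ZVec N
  zeroZ = zerosℤ , ℤ.+ 0

  ⊞-identityˡ : ∀ {N} (x : ZVec N) → zeroZ ⊞ x ≡ x
  ⊞-identityˡ (a , z) = cong₂ _,_ (⊕-identityˡ a) (ℤP.+-identityˡ z)

  ⊞-assoc : ∀ {N} (x y z : ZVec N) → (x ⊞ y) ⊞ z ≡ x ⊞ (y ⊞ z)
  ⊞-assoc (a , i) (b , j) (c , k) = cong₂ _,_ (⊕-assoc a b c) (ℤP.+-assoc i j k)

  ⊞-comm : ∀ {N} (x y : ZVec N) → x ⊞ y ≡ y ⊞ x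
  ⊞-comm (a , i) (b , j) = cong₂ _,_ (⊕-comm a b) (ℤP.+-comm i j)

  multiple : ∀ {N} → ℕ → ZVec N → ZVec N
  multiple c (a , z) = ℤ.+ c ⊙ a , ℤ.+ c ℤ.* z

  multiple-zero : ∀ {N} (x : ZVec N) → multiple 0 x ≡ zeroZ
  multiple-zero (a , z) = cong₂ _,_ (⊙-zero a) (ℤP.*-zeroˡ z)

  multiple-suc : ∀ {N} c (x : ZVec N) → multiple (suc c) x ≡ x ⊞ multiple c x
  multiple-suc c (a , z) = cong₂ _,_ (⊙-distrib (ℤ.+ 1) (ℤ.+ c) a ∙ cong (_⊕ ℤ.+ c ⊙ a) (⊙-one a))
    (ℤP.*-distribʳ-+ z (ℤ.+ 1) (ℤ.+ c) ∙ cong (ℤ._+ ℤ.+ c ℤ.* z) (ℤP.*-identityˡ z))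

  combination : ∀ {h N} → (Fin h → ℕ) → (Fin h → ZVec N) → ZVec N
  combination c H = sumVℤ (λ i → proj₁ (multiple (c i) (H i))) , sumℤ (λ i → proj₂ (multiple (c i) (H i)))

  combination-zero : ∀ {h N} (H : Fin h → ZVec N) → combination (λ _ → 0) H ≡ zeroZ
  combination-zero {zero}  H = refl
  combination-zero {suc h} H = cong₂ _⊞_ (multiple-zero (H zero)) (combination-zero (H ∘ suc)) ∙ ⊞-identityˡ zeroZ

  combination-+ : ∀ {h N} (c d : Fin h → ℕ) (H : Fin h → ZVec N) →
                  combination (λ i → c i ℕ.+ d i) H ≡ combination c H ⊞ combination d H
  combination-+ c d H = cong₂ _,_
    (sumVℤ-cong (λ i → cong (_⊙ proj₁ (H i)) (ℤP.pos-+ (c i) (d i)) ∙ ⊙-distrib (ℤ.+ c i) (ℤ.+ d i) (proj₁ (H i)))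
      ∙ sumVℤ-⊕ (λ i → ℤ.+ c i ⊙ proj₁ (H i)) (λ i → ℤ.+ d i ⊙ proj₁ (H i)))
    (sumℤ-cong (λ i → cong (ℤ._* proj₂ (H i)) (ℤP.pos-+ (c i) (d i)) ∙ ℤP.*-distribʳ-+ (proj₂ (H i)) (ℤ.+ c i) (ℤ.+ d i))
      ∙ sumℤ-+ (λ i → ℤ.+ c i ℤ.* proj₂ (H i)) (λ i → ℤ.+ d i ℤ.* proj₂ (H i)))

  combination-gen : ∀ {h N} (H : Fin h → ZVec N) j → ∃[ c ] combination c H ≡ H j
  combination-gen {suc h} H zero = (1 ◂ λ _ → 0) , cong₂ _⊞_ (multiple-suc 0 (H zero) ∙ cong (H zero ⊞_) (multiple-zero (H zero)))
      (combination-zero (H ∘ suc))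
    ∙ ⊞-assoc (H zero) zeroZ zeroZ ∙ cong (H zero ⊞_) (⊞-identityˡ zeroZ) ∙ ⊞-comm (H zero) zeroZ ∙ ⊞-identityˡ (H zero)
  combination-gen {suc h} H (suc j) = let (c , e) = combination-gen (H ∘ suc) j in
    (0 ◂ c) , cong₂ _⊞_ (multiple-zero (H zero)) e ∙ ⊞-identityˡ (H (suc j))

  combination-split : ∀ {h N} (c : Fin h → ℕ) (H : Fin h → ZVec N) →
                      combination c H ≡ zeroZ ⊎ ∃[ i ] ∃[ c′ ] combination c H ≡ H i ⊞ combination c′ H
  combination-split {zero}  c H = inj₁ refl
  combination-split {suc h} c H = by-cases (c zero) refl
    where
    by-cases : ∀ k → c zero ≡ k → combination c H ≡ zeroZ ⊎ ∃[ i ] ∃[ c′ ] combination c H ≡ H i ⊞ combination c′ H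
    by-cases (suc k) e = inj₂ (zero , (k ◂ (c ∘ suc)) , cong (λ j → multiple j (H zero) ⊞ combination (c ∘ suc) (H ∘ suc)) e
      ∙ cong (_⊞ combination (c ∘ suc) (H ∘ suc)) (multiple-suc k (H zero)) ∙ ⊞-assoc (H zero) (multiple k (H zero)) _)
    by-cases zero e = lift (combination-split (c ∘ suc) (H ∘ suc))
      where
      drop : combination c H ≡ combination (c ∘ suc) (H ∘ suc)
      drop = cong (λ j → multiple j (H zero) ⊞ combination (c ∘ suc) (H ∘ suc)) e
        ∙ cong (_⊞ combination (c ∘ suc) (H ∘ suc)) (multiple-zero (H zero)) ∙ ⊞-identityˡ _
      lift : _ ⊎ _ → _
      lift (inj₁ f) = inj₁ (drop ∙ f)
      lift (inj₂ (i , c′ , f)) = inj₂ (suc i , (0 ◂ c′) , drop ∙ f ∙ cong (H (suc i) ⊞_)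
        (sym (cong (_⊞ combination c′ (H ∘ suc)) (multiple-zero (H zero)) ∙ ⊞-identityˡ _)))

  homZ : ∀ {N} → ZVec N → Vect (suc N)
  homZ (a , z) = hom a z

  hom-combination : ∀ {h N} (c : Fin h → ℕ) (H : Fin h → ZVec N) t →
                    homZ (combination c H) t ≡ lc (λ i → ℤ→ℚ (ℤ.+ c i)) (λ i → homZ (H i)) t
  hom-combination {zero} c H zero    = refl
  hom-combination {zero} c H (suc t) = cong ℤ→ℚ (lookup-zeros t)
  hom-combination {suc h} c H t = hom-⊕ (ℤ.+ c zero ⊙ proj₁ (H zero)) (proj₁ (combination (c ∘ suc) (H ∘ suc)))
      (ℤ.+ c zero ℤ.* proj₂ (H zero)) (proj₂ (combination (c ∘ suc) (H ∘ suc))) t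
    ∙ cong₂ _+_ (hom-⊙ (ℤ.+ c zero) (proj₁ (H zero)) (proj₂ (H zero)) t) (hom-combination (c ∘ suc) (H ∘ suc) t)

  ZComb⇒≡ : ∀ {h N} {H : Fin h → ZVec N} {x} → ((c , _) : ZComb H x) → combination c H ≡ x
  ZComb⇒≡ (c , e , f) = cong₂ _,_ e f

  ≡⇒ZComb : ∀ {h N} {H : Fin h → ZVec N} {x} c → combination c H ≡ x → ZComb H x
  ≡⇒ZComb c e = c , cong proj₁ e , cong proj₂ e

  module HilbertBasis {N : ℕ} (P : Polytope N) {d : ℕ} (isDim : IsDim P d) where
    open VeryAmpleness P isDim public

    record Reducible (k : ℕ) (a : Vec ℤ N) : Set where
      constructor reducible
      field
        {e f}   : ℕ
        {b c}   : Vec ℤ N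
        1≤e     : 1 ℕ.≤ e
        1≤f     : 1 ℕ.≤ f
        degrees : e ℕ.+ f ≡ k
        b∈C     : C e b
        c∈C     : C f c
        vectors : b ⊕ c ≡ a

    Irreducible : ℕ → Vec ℤ N → Set
    Irreducible k a = 1 ℕ.≤ k × ¬ Reducible k a

    reducible? : ∀ k a → Dec (Reducible k a)
    reducible? k a = map′ to fro (Any.any? test? (proj₁ (graded-list k)))
      where
      Test : ℕ × Vec ℤ N → Set
      Test (e , b) = (1 ℕ.≤ e × 1 ℕ.≤ k ℕ.∸ e) × C (k ℕ.∸ e) (a ⊖ b)
      test? : ∀ x → Dec (Test x)
      test? (e , b) = (1 ℕP.≤? e ×-dec 1 ℕP.≤? k ℕ.∸ e) ×-dec C? (k ℕ.∸ e) (a ⊖ b)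
      to : Any Test (proj₁ (graded-list k)) → Reducible k a
      to p = let ((e , b) , x∈ , (1≤e , 1≤f) , q) = find p ; (e≤k , b∈) = proj₂ (proj₂ (graded-list k)) x∈ in
        reducible 1≤e 1≤f (ℕP.m+[n∸m]≡n e≤k) b∈ q (⊕-comm b (a ⊖ b) ∙ (⊖-⊕ a b))
      fro : Reducible k a → Any Test (proj₁ (graded-list k))
      fro (reducible {e} {f} {b} {c} 1≤e 1≤f refl b∈ c∈ refl) = lose (proj₁ (proj₂ (graded-list (e ℕ.+ f))) (ℕP.m≤m+n e f) b∈)
        ((1≤e , subst (1 ℕ.≤_) (sym (ℕP.m+n∸m≡n e f)) 1≤f) ,
         subst₂ C (sym (ℕP.m+n∸m≡n e f)) (sym (⊕-⊖ c b) ∙ cong (_⊖ b) (⊕-comm c b)) c∈)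

    irreducible? : ∀ k a → Dec (Irreducible k a)
    irreducible? k a = 1 ℕP.≤? k ×-dec ¬? (reducible? k a)

    -- Both parts of a reducible element have positive degree, hence smaller degree than the whole,
    -- so repeated splitting ends in irreducible elements.
    irreducible-induction : (Q : ℕ → Vec ℤ N → Set) → Q 0 zerosℤ → (∀ {k a} → C k a → Irreducible k a → Q k a) →
                            (∀ {e f b c} → Q e b → Q f c → Q (e ℕ.+ f) (b ⊕ c)) → ∀ {k a} → C k a → Q k a
    irreducible-induction Q q0 qirr q+ {k} {a} p = go k (<-wellFounded k) p
      where
      go : ∀ k → Acc ℕ._<_ k → ∀ {a} → C k a → Q k a
      go zero _ p = subst (Q 0) (sym (C-zero⁻¹ p)) q0
      go k@(suc _) (acc rec) {a} p with reducible? k a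
      ... | no ¬r = qirr p (ℕ.s≤s ℕ.z≤n , ¬r)
      ... | yes (reducible {e} {f} {b} {c} 1≤e 1≤f deq b∈ c∈ refl) = subst (λ k → Q k (b ⊕ c)) deq
              (q+ (go e (rec (subst (e ℕ.<_) deq (subst (ℕ._≤ e ℕ.+ f) (ℕP.+-comm e 1) (ℕP.+-monoʳ-≤ e 1≤f)))) b∈)
                  (go f (rec (subst (f ℕ.<_) deq (ℕP.+-monoˡ-≤ f 1≤e))) c∈))

    -- A lattice point split off by `decompose` would be a proper summand, as k ≥ 2; so the element
    -- is the core itself. A core that is a sum of k ≥ 2 lattice points is reducible, and what
    -- remains is a hole.
    irreducible⇒box : ∀ {k a} → C k a → Irreducible k a → 2 ℕ.≤ k → Box k a
    irreducible⇒box {k} {a} p (_ , ¬r) 2≤k with decompose p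
    ... | split {e} {zero} {y} eq _ q (inj₁ bx) (sumOf _ _ refl) f = subst₂ Box (sym (eq ∙ ℕP.+-identityʳ e))
        (sym (⊕-identityʳ y) ∙ f) bx
    ... | split {e} {zero} {y} eq _ q (inj₂ sy) (sumOf _ _ refl) f = ⊥-elim
        (¬r (from-sum k 2≤k (subst₂ (SumOf (C 1)) (sym (eq ∙ ℕP.+-identityʳ e)) (sym (⊕-identityʳ y) ∙ f) sy)))
      where
      from-sum : ∀ k → 2 ℕ.≤ k → SumOf (C 1) k a → Reducible k a
      from-sum (suc k) (ℕ.s≤s 1≤k) s with sum-uncons s
      ... | b , a′ , b∈ , s′ , g = reducible ℕP.≤-refl 1≤k refl b∈ (sum₁⇒C s′) g
    ... | split {e} {suc l} {y} eq _ q _ sm f with sum-uncons sm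
    ...   | b , s′ , b∈ , sm′ , refl = ⊥-elim (¬r (reducible ℕP.≤-refl
            (ℕ.s≤s⁻¹ (subst (2 ℕ.≤_) (eq ∙ ℕP.+-suc e l) 2≤k)) (sym (eq ∙ ℕP.+-suc e l)) b∈ (C-⊕ q (sum₁⇒C sm′))
            (sym (⊕-assoc b y s′) ∙ cong (_⊕ s′) (⊕-comm b y) ∙ ⊕-assoc y b s′ ∙ f)))

    irreducible≤hole : ∀ {μ} → Holes μ → ∀ {k a} → C k a → Irreducible k a → k ℕ.≤ μ
    irreducible≤hole (_ , 1≤μ , box≤ , _) {k} {a} p irr with 2 ℕP.≤? k
    ... | yes 2≤k = box≤ p (irreducible⇒box p irr 2≤k)
    ... | no ¬2≤k = ℕP.≤-trans (ℕP.≤-pred (ℕP.≰⇒> ¬2≤k)) 1≤μ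

    degree-one-irreducible : ∀ {a} → Irreducible 1 a
    degree-one-irreducible = ℕP.≤-refl , λ (reducible 1≤e 1≤f deq _ _ _) → ℕP.<-irrefl refl
        (ℕP.<-≤-trans (ℕP.+-mono-≤ 1≤e 1≤f) (ℕP.≤-reflexive deq))

    -- An irreducible element of degree k together with n - k copies of `pt i` is a single point of
    -- degree n. Absorption is additive, which extends this to sums of irreducible elements.
    irreducibles-of-degree≤⇒criterion : ∀ n → (∀ {k a} → C k a → Irreducible k a → k ℕ.≤ n) → Criterion n
    irreducibles-of-degree≤⇒criterion n bound {i} i∈ {e} {y} _ q = irreducible-induction (λ e y → ∃[ K ] Absorbed n i e y K) start
        single join q
      where
      p = pt i
      start : ∃[ K ] Absorbed n i 0 zerosℤ K
      start = 0 , 0 , refl , subst (SumOf (C n) 0) (sym (⊕-identityˡ (ℤ.+ 0 ⊙ p) ∙ ⊙-zero p)) sum-nil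
      single : ∀ {k a} → C k a → Irreducible k a → ∃[ K ] Absorbed n i k a K
      single {k} {a} r irr = n ℕ.∸ k , 1 , k+K≡ ∙ sym (ℕP.*-identityˡ n) ,
          sum-single (subst (λ j → C j (a ⊕ ℤ.+ (n ℕ.∸ k) ⊙ p)) k+K≡ (C-⊕ r (sum₁⇒C (sum-multiple (C-pt i) (n ℕ.∸ k)))))
        where k+K≡ : k ℕ.+ (n ℕ.∸ k) ≡ n
              k+K≡ = ℕP.m+[n∸m]≡n (bound r irr)
      join : ∀ {e f b c} → ∃[ K ] Absorbed n i e b K → ∃[ K ] Absorbed n i f c K → ∃[ K ] Absorbed n i (e ℕ.+ f) (b ⊕ c) K
      join {e} {f} {b} {c} (K , l , eq , s) (K′ , l′ , eq′ , s′) = K ℕ.+ K′ , l ℕ.+ l′ ,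
          arrange e f K K′ ∙ cong₂ ℕ._+_ eq eq′ ∙ sym (ℕP.*-distribʳ-+ n l l′) ,
          subst (SumOf (C n) (l ℕ.+ l′)) vectors (sum-++ s s′)
        where
        arrange : ∀ e f K K′ → (e ℕ.+ f) ℕ.+ (K ℕ.+ K′) ≡ (e ℕ.+ K) ℕ.+ (f ℕ.+ K′)
        arrange = ℕR.solve-∀
        interchange : ∀ (a b c d : Vec ℤ N) → (a ⊕ b) ⊕ (c ⊕ d) ≡ (a ⊕ c) ⊕ (b ⊕ d)
        interchange a b c d = ⊕-assoc a b (c ⊕ d) ∙ cong (a ⊕_) (sym (⊕-assoc b c d) ∙ cong (_⊕ d) (⊕-comm b c) ∙ ⊕-assoc c b d)
          ∙ sym (⊕-assoc a c (b ⊕ d))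
        vectors : (b ⊕ ℤ.+ K ⊙ p) ⊕ (c ⊕ ℤ.+ K′ ⊙ p) ≡ (b ⊕ c) ⊕ ℤ.+ (K ℕ.+ K′) ⊙ p
        vectors = interchange b (ℤ.+ K ⊙ p) c (ℤ.+ K′ ⊙ p) ∙ cong ((b ⊕ c) ⊕_)
            (sym (⊙-distrib (ℤ.+ K) (ℤ.+ K′) p) ∙ cong (_⊙ p) (sym (ℤP.pos-+ K K′)))

    module FromHoles {μ : ℕ} (H : Holes μ) where

      private
        listed : Σ[ ys ∈ List (ℕ × Vec ℤ N) ] (∀ {k a} → C k a → Irreducible k a → (k , a) ∈ ys) ×
            (∀ {k a} → (k , a) ∈ ys → C k a × Irreducible k a)
        listed = let (xs , f , g) = graded-list μ
                     (ys , f′ , g′) = select {Q = λ x → Irreducible (proj₁ x) (proj₂ x)} {S = λ x → C (proj₁ x) (proj₂ x)}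
                         (λ {x} _ → irreducible? (proj₁ x) (proj₂ x)) xs (λ {x} h → proj₂ (g {proj₁ x} {proj₂ x} h)) in
          ys , (λ {k} {a} p irr → f′ {k , a} (f (irreducible≤hole H p irr) p) irr) ,
          λ {k} {a} h → proj₂ (g {k} {a} (proj₁ (g′ {k , a} h))) , proj₂ (g′ {k , a} h)

      abstract
        hs : List (ℕ × Vec ℤ N)
        hs = proj₁ listed
        hs⁺ : ∀ {k a} → C k a → Irreducible k a → (k , a) ∈ hs
        hs⁺ = proj₁ (proj₂ listed)
        hs⁻ : ∀ {k a} → (k , a) ∈ hs → C k a × Irreducible k a
        hs⁻ = proj₂ (proj₂ listed)

      toZ : ℕ × Vec ℤ N → ZVec N
      toZ (k , a) = a , ℤ.+ k

      basis : Fin (length hs) → ZVec N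
      basis j = toZ (L.lookup hs j)

      basis-cone : ∀ j → Cone V⁺ (homZ (basis j))
      basis-cone j = cone (proj₁ (hs⁻ (∈-lookup {xs = hs} j)))

      isHilb : IsHilbBasis P basis
      isHilb (a , z) = comb⇒cone , cone⇒comb
        where
        comb⇒cone : ZComb basis (a , z) → InCone P (a , z)
        comb⇒cone zc@(c , _) = cone⇒inCone (cone-trans {A = V⁺} {λ j → homZ (basis j)} basis-cone {hom a z}
          ((λ j → ℤ→ℚ (ℤ.+ c j)) , (λ j → ℤ→ℚ-mono-≤ {ℤ.+ 0} {ℤ.+ c j} (ℤ.+≤+ ℕ.z≤n)) ,
           λ t → sym (hom-combination c basis t) ∙ cong (λ x → homZ x t) (ZComb⇒≡ zc)))
        generate : ∀ {k a} → C k a → ∃[ c ] combination c basis ≡ (a , ℤ.+ k)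
        generate = irreducible-induction (λ k a → ∃[ c ] combination c basis ≡ (a , ℤ.+ k))
          ((λ _ → 0) , combination-zero basis)
          (λ p irr → let j∈ = hs⁺ p irr ; (c , e) = combination-gen basis (index j∈) in c , e ∙ cong toZ (sym (lookup-index j∈)))
          (λ {e} {f} {b} {b′} (c , q) (c′ , q′) → (λ i → c i ℕ.+ c′ i) , combination-+ c c′ basis ∙ cong₂ _⊞_ q q′ ∙ cong
              (b ⊕ b′ ,_) (sym (ℤP.pos-+ e f)))
        cone⇒comb : InCone P (a , z) → ZComb basis (a , z)
        cone⇒comb ic = let (k , z≡) = cone-degree {a} {z} (inCone⇒cone ic) ; (c , e) = generate
                             (inC (subst (λ z → Cone V⁺ (hom a z)) z≡ (inCone⇒cone ic))) in
          ≡⇒ZComb {H = basis} c (e ∙ cong (a ,_) (sym z≡))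

      -- Write an irreducible element as a combination from `H′` and split off one member of `H′`.
      -- That member has positive degree, so irreducibility forces the remainder to degree 0, where
      -- the only element is zero; the element is that member.
      minimal : ∀ {h′} (H′ : Fin h′ → ZVec N) → (∀ i → ∃[ j ] H′ i ≡ basis j) → IsHilbBasis P H′ → ∀ j → ∃[ i ] basis j ≡ H′ i
      minimal H′ sub hilb j = from (proj₂ (hilb (basis j)) (cone⇒inCone (basis-cone j)))
        where
        k = proj₁ (L.lookup hs j)
        irr : Irreducible k (proj₂ (L.lookup hs j))
        irr = proj₂ (hs⁻ (∈-lookup {xs = hs} j))
        from : ZComb H′ (basis j) → ∃[ i ] basis j ≡ H′ i
        from zc@(c , _) = by-cases (combination-split c H′)
          where
          by-cases : combination c H′ ≡ zeroZ ⊎ ∃[ i ] ∃[ c′ ] combination c H′ ≡ H′ i ⊞ combination c′ H′ → ∃[ i ] basis j ≡ H′ i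
          by-cases (inj₁ e) = ⊥-elim (ℕP.<⇒≢ (proj₁ irr) (sym (ℤP.+-injective (cong proj₂ (sym (ZComb⇒≡ {H = H′} {basis j} zc) ∙ e)))))
          by-cases (inj₂ (i , c′ , e)) = finish (sub i) (combination c′ H′) refl (proj₁ (hilb (combination c′ H′)) (c′ , refl , refl))
            where
            finish : ∃[ j′ ] H′ i ≡ basis j′ → ∀ x → x ≡ combination c′ H′ → InCone P x → ∃[ i ] basis j ≡ H′ i
            finish (j′ , H≡) (b , w) x≡ ic = rest f refl
              where
              f = proj₁ (cone-degree {b} {w} (inCone⇒cone ic))
              w≡ : w ≡ ℤ.+ f
              w≡ = proj₂ (cone-degree {b} {w} (inCone⇒cone ic))
              b∈ : C f b
              b∈ = inC (subst (λ z → Cone V⁺ (hom b z)) w≡ (inCone⇒cone ic))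
              total : basis j′ ⊞ (b , ℤ.+ f) ≡ basis j
              total = cong₂ _⊞_ (sym H≡) (cong (b ,_) (sym w≡) ∙ x≡) ∙ sym e ∙ ZComb⇒≡ {H = H′} {basis j} zc
              rest : ∀ g → f ≡ g → ∃[ i ] basis j ≡ H′ i
              rest zero f≡ = i , sym total ∙ cong (basis j′ ⊞_) (cong₂ (λ b f → b , ℤ.+ f) (C-zero⁻¹ (subst (λ f → C f b) f≡ b∈))
                  f≡ ∙ refl)
                ∙ (⊞-comm (basis j′) zeroZ ∙ ⊞-identityˡ (basis j′)) ∙ sym H≡
              rest (suc g) f≡ = ⊥-elim (proj₂ irr (reducible (proj₁ (proj₂ (hs⁻ (∈-lookup {xs = hs} j′))))
                  (subst (1 ℕ.≤_) (sym f≡) (ℕ.s≤s ℕ.z≤n))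
                (ℤP.+-injective (ℤP.pos-+ (proj₁ (L.lookup hs j′)) f ∙ cong proj₂ total))
                (proj₁ (hs⁻ (∈-lookup {xs = hs} j′))) b∈ (cong proj₁ total)))

      private
        maximum : ∃[ x ] x ∈ hs × (∀ {y} → y ∈ hs → proj₁ y ℕ.≤ proj₁ x)
        maximum = greatest proj₁ hs (hs⁺ (C-vert zero) degree-one-irreducible)

      abstract
        hilb : ∃[ μ′ ] MuHilb P μ′ × 1 ℕ.≤ μ′ × μ′ ℕ.≤ μ × (∀ {k a} → C k a → Irreducible k a → k ℕ.≤ μ′)
        hilb = k , (length hs , basis , (isHilb , minimal) , (λ j → ℤ.+≤+ (proj₂ (proj₂ maximum) (∈-lookup {xs = hs} j))) ,
                    index x∈ , cong (λ x → ℤ.+ proj₁ x) (sym (lookup-index x∈))) ,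
               proj₁ (proj₂ (hs⁻ x∈)) , irreducible≤hole H (proj₁ (hs⁻ x∈)) (proj₂ (hs⁻ x∈)) , λ p irr → proj₂ (proj₂ maximum)
                   (hs⁺ p irr)
          where
          k : ℕ
          k = proj₁ (proj₁ maximum)
          x∈ : proj₁ maximum ∈ hs
          x∈ = proj₁ (proj₂ maximum)

-- The numerator of the Ehrhart series from half-open boxes

module EhrhartSeries where

  open Rationals
  open LinearAlgebra
  open BasesOfCones
  open Triangulations
  open LatticePoints
  open Boxes
  open Decompositions
  open HilbertBases
  open import Data.Rational using (0ℚ; 1ℚ; _+_; _*_; _-_; -_; _≤_; _<_)
  open ℚP hiding (neg-pos)

  -- Backward differences

  ∇ : (ℕ → ℤ) → ℕ → ℤ
  ∇ f zero    = f zero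
  ∇ f (suc i) = f (suc i) ℤ.- f i

  -- Since `∇` multiplies a generating function by 1 - t, with values before 0 read as 0, the (d +
  -- 1)-st difference of the lattice point counts is the numerator of the Ehrhart series.
  ∇^ : ℕ → (ℕ → ℤ) → ℕ → ℤ
  ∇^ zero    f = f
  ∇^ (suc p) f = ∇ (∇^ p f)

  ∇-cong : ∀ {f g} → (∀ i → f i ≡ g i) → ∀ i → ∇ f i ≡ ∇ g i
  ∇-cong h zero    = h zero
  ∇-cong h (suc i) = cong₂ ℤ._-_ (h (suc i)) (h i)

  ∇^-cong : ∀ p {f g} → (∀ i → f i ≡ g i) → ∀ i → ∇^ p f i ≡ ∇^ p g i
  ∇^-cong zero    h = h
  ∇^-cong (suc p) h = ∇-cong (∇^-cong p h)

  ∇-+ : ∀ f g i → ∇ (λ i → f i ℤ.+ g i) i ≡ ∇ f i ℤ.+ ∇ g i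
  ∇-+ f g zero    = refl
  ∇-+ f g (suc i) = eq (f (suc i)) (g (suc i)) (f i) (g i)
    where eq : ∀ a b c d → (a ℤ.+ b) ℤ.- (c ℤ.+ d) ≡ (a ℤ.- c) ℤ.+ (b ℤ.- d)
          eq = ℤR.solve-∀

  ∇^-+ : ∀ p f g i → ∇^ p (λ i → f i ℤ.+ g i) i ≡ ∇^ p f i ℤ.+ ∇^ p g i
  ∇^-+ zero    f g i = refl
  ∇^-+ (suc p) f g i = ∇-cong (∇^-+ p f g) i ∙ (∇-+ (∇^ p f) (∇^ p g) i)

  sumℤ-neg : ∀ {k} (f : Fin k → ℤ) → sumℤ (λ i → ℤ.- f i) ≡ ℤ.- sumℤ f
  sumℤ-neg {zero}  f = refl
  sumℤ-neg {suc k} f = cong (λ w → (ℤ.- f zero) ℤ.+ w) (sumℤ-neg (f ∘ suc)) ∙ sym (ℤP.neg-distrib-+ (f zero) (sumℤ (f ∘ suc)))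

  binomial-sum : ℕ → (ℕ → ℤ) → ℕ → ℤ
  binomial-sum p f i = sumℤ {suc i} (λ j → sgn (toℕ j) ℤ.* (ℤ.+ (p choose toℕ j) ℤ.* f (i ℕ.∸ toℕ j)))

  private
    Cn0 : ∀ p → p choose 0 ≡ 1
    Cn0 p = nCk≡nC[n∸k] {0} {p} ℕ.z≤n ∙ nCn≡1 p

  binomial-sum-zero : ∀ f i → binomial-sum 0 f i ≡ f i
  binomial-sum-zero f i = cong₂ ℤ._+_ (ℤP.*-identityˡ _ ∙ ℤP.*-identityˡ (f i)) (vanish i) ∙ ℤP.+-identityʳ (f i)
    where
    sumℤ-zero : ∀ {k} {f : Fin k → ℤ} → (∀ i → f i ≡ ℤ.+ 0) → sumℤ f ≡ ℤ.+ 0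
    sumℤ-zero {zero}  h = refl
    sumℤ-zero {suc k} h = cong₂ ℤ._+_ (h zero) (sumℤ-zero (h ∘ suc))
    vanish : ∀ i → sumℤ {i} (λ j → sgn (suc (toℕ j)) ℤ.* (ℤ.+ (0 choose suc (toℕ j)) ℤ.* f (i ℕ.∸ suc (toℕ j)))) ≡ ℤ.+ 0
    vanish i = sumℤ-zero {i} (λ j → cong (sgn (suc (toℕ j)) ℤ.*_) (ℤP.*-zeroˡ (f (i ℕ.∸ suc (toℕ j)))) ∙ ℤP.*-zeroʳ (sgn (suc (toℕ j))))

  -- Pascal's rule: one more factor 1 - t splits each binomial coefficient into the two of the row
  -- before.
  binomial-sum-suc : ∀ p f i → binomial-sum (suc p) f i ≡ ∇ (binomial-sum p f) i
  binomial-sum-suc p f zero = cong (λ c → ℤ.+ 1 ℤ.* (ℤ.+ c ℤ.* f 0) ℤ.+ ℤ.+ 0) (Cn0 (suc p) ∙ sym (Cn0 p))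
  binomial-sum-suc p f (suc i) = begin
    ℤ.+ 1 ℤ.* (ℤ.+ (suc p choose 0) ℤ.* f (suc i)) ℤ.+ sumℤ {suc i} (λ j → term (suc p) (suc (toℕ j)) j)
      ≡⟨ cong₂ ℤ._+_ (cong (λ c → ℤ.+ 1 ℤ.* (ℤ.+ c ℤ.* f (suc i))) (Cn0 (suc p) ∙ sym (Cn0 p)))
           (sumℤ-cong pascal ∙ sumℤ-+ (λ j → term p (suc (toℕ j)) j) (λ j → ℤ.-
               (sgn (toℕ j) ℤ.* (ℤ.+ (p choose toℕ j) ℤ.* f (i ℕ.∸ toℕ j))))
             ∙ cong (λ w → sumℤ {suc i} (λ j → term p (suc (toℕ j)) j) ℤ.+ w)
                 (sumℤ-neg {suc i} (λ j → sgn (toℕ j) ℤ.* (ℤ.+ (p choose toℕ j) ℤ.* f (i ℕ.∸ toℕ j))))) ⟩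
    ℤ.+ 1 ℤ.* (ℤ.+ (p choose 0) ℤ.* f (suc i)) ℤ.+ (sumℤ {suc i} (λ j → term p (suc (toℕ j)) j) ℤ.- binomial-sum p f i)
      ≡⟨ sym (ℤP.+-assoc (ℤ.+ 1 ℤ.* (ℤ.+ (p choose 0) ℤ.* f (suc i))) _ _) ⟩
    binomial-sum p f (suc i) ℤ.- binomial-sum p f i ∎
    where
    open ≡-Reasoning
    term : ℕ → ℕ → Fin (suc i) → ℤ
    term p k j = (ℤ.- sgn (toℕ j)) ℤ.* (ℤ.+ (p choose k) ℤ.* f (i ℕ.∸ toℕ j))
    pascal : ∀ j → term (suc p) (suc (toℕ j)) j ≡ term p (suc (toℕ j)) j ℤ.+ ℤ.-
        (sgn (toℕ j) ℤ.* (ℤ.+ (p choose toℕ j) ℤ.* f (i ℕ.∸ toℕ j)))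
    pascal j = cong (λ c → (ℤ.- sgn (toℕ j)) ℤ.* (c ℤ.* f (i ℕ.∸ toℕ j)))
        (cong ℤ.+_ (sym (nCk+nC[k+1]≡[n+1]C[k+1] p (toℕ j))) ∙ ℤP.pos-+ (p choose toℕ j) (p choose suc (toℕ j)))
      ∙ eq (sgn (toℕ j)) (ℤ.+ (p choose toℕ j)) (ℤ.+ (p choose suc (toℕ j))) (f (i ℕ.∸ toℕ j))
      where eq : ∀ s a b f → (ℤ.- s) ℤ.* ((a ℤ.+ b) ℤ.* f) ≡ (ℤ.- s) ℤ.* (b ℤ.* f) ℤ.+ ℤ.- (s ℤ.* (a ℤ.* f))
            eq = ℤR.solve-∀

  binomial-sum≡∇^ : ∀ p f i → binomial-sum p f i ≡ ∇^ p f i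
  binomial-sum≡∇^ zero    f i = binomial-sum-zero f i
  binomial-sum≡∇^ (suc p) f i = binomial-sum-suc p f i ∙ ∇-cong (binomial-sum≡∇^ p f) i

  delta≡∇^ : ∀ d L i → delta d L i ≡ ∇^ (suc d) (λ n → ℤ.+ L n) i
  delta≡∇^ d L i = binomial-sum≡∇^ (suc d) (λ n → ℤ.+ L n) i

  -- Counting

  injection-≤ : ∀ {X Y : Set} {xs : List X} {ys : List Y} (f : X → Y) → Unique xs → (∀ {x} → x ∈ xs → f x ∈ ys) →
                (∀ {x y} → f x ≡ f y → x ≡ y) → length xs ℕ.≤ length ys
  injection-≤ {xs = xs} {ys} f u into inj = injective⇒≤ {f = λ i → index (into (∈-lookup {xs = xs} i))} λ {i} {j} e →
    unique-lookup u i j (inj (lookup-index (into (∈-lookup {xs = xs} i)) ∙ cong (L.lookup ys) e ∙ sym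
        (lookup-index (into (∈-lookup {xs = xs} j)))))

  length-filter-cong : ∀ {X : Set} {P Q : Pred X 0ℓ} (P? : Decidable P) (Q? : Decidable Q) xs → (∀ {x} → x ∈ xs → P x → Q x) →
      (∀ {x} → x ∈ xs → Q x → P x) →
                       length (filter P? xs) ≡ length (filter Q? xs)
  length-filter-cong P? Q? [] f g = refl
  length-filter-cong P? Q? (x ∷ xs) f g with P? x | Q? x
  ... | yes p | yes q = cong suc (length-filter-cong P? Q? xs (λ i → f (there i)) (λ i → g (there i)))
  ... | yes p | no ¬q = ⊥-elim (¬q (f (here refl) p))
  ... | no ¬p | yes q = ⊥-elim (¬p (g (here refl) q))
  ... | no ¬p | no ¬q = length-filter-cong P? Q? xs (λ i → f (there i)) (λ i → g (there i))

  length-filter-split : ∀ {X : Set} {P R : Pred X 0ℓ} (P? : Decidable P) (R? : Decidable R) xs →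
                        length (filter P? xs) ≡ length (filter (λ x → P? x ×-dec ¬? (R? x)) xs) ℕ.+ length
                            (filter (λ x → P? x ×-dec R? x) xs)
  length-filter-split P? R? [] = refl
  length-filter-split P? R? (x ∷ xs) with P? x | R? x
  ... | yes p | yes r = cong suc (length-filter-split P? R? xs) ∙ sym (ℕP.+-suc _ _)
  ... | yes p | no ¬r = cong suc (length-filter-split P? R? xs)
  ... | no ¬p | yes r = length-filter-split P? R? xs
  ... | no ¬p | no ¬r = length-filter-split P? R? xs

  module Ehrhart {N : ℕ} (P : Polytope N) {d : ℕ} (isDim : IsDim P d) where
    open Holes P isDim public

    latticeCount : ℕ → ℕ
    latticeCount n = length (pts n)

    isCount : ∀ n → IsCount P n (latticeCount n)
    isCount n = L.lookup (pts n) , unique-lookup (pts-unique n) , (λ i → C⇒dilate n (pts⁻ (∈-lookup {xs = pts n} i))) ,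
      λ a p → index (pts⁺ (dilate⇒C n p)) , sym (lookup-index (pts⁺ (dilate⇒C n p)))

    count : {Q : ℕ → Vec ℤ N → Set} → (∀ k a → Dec (Q k a)) → ℕ → ℕ
    count Q? k = length (filter (Q? k) (pts k))

    count-cong : ∀ {Q R : ℕ → Vec ℤ N → Set} (Q? : ∀ k a → Dec (Q k a)) (R? : ∀ k a → Dec (R k a)) k →
                 (∀ {a} → C k a → Q k a → R k a) → (∀ {a} → C k a → R k a → Q k a) → count Q? k ≡ count R? k
    count-cong Q? R? k f g = length-filter-cong (Q? k) (R? k) (pts k) (λ i → f (pts⁻ i)) (λ i → g (pts⁻ i))

    module Counting (g : Generic) where
      open Decomposition g
      open Generic g using (start) renaming (cost to c; point to q)

      u : Basis → Fin (suc d) → ℕ → Vec ℤ N → ℚ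
      u b i k a = dot (U b i) (hom a (ℤ.+ k))

      -- One condition of the half-open cone, stated for a value rather than a point. Applied to v -
      -- 1 it says whether the vertex `i` can be subtracted within the half-open cone.
      Pos : Basis → Fin (suc d) → ℚ → Set
      Pos b i v = (0ℚ < v) ⊎ (v ≡ 0ℚ × 0ℚ < dot (U b i) q)

      pos? : ∀ b i v → Dec (Pos b i v)
      pos? b i v = (0ℚ <? v) ⊎-dec ((v ≟ 0ℚ) ×-dec (0ℚ <? dot (U b i) q))

      pos⇒nonneg : ∀ {b i v} → Pos b i v → 0ℚ ≤ v
      pos⇒nonneg (inj₁ p) = <⇒≤ p
      pos⇒nonneg (inj₂ (e , _)) = ≤-reflexive (sym e)

      -- Adding an index to is replaces the count of these points by its backward difference.
      record Free (b : Basis) (is : List (Fin (suc d))) (k : ℕ) (a : Vec ℤ N) : Set where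
        constructor free
        field
          inside  : ∀ i → Pos b i (u b i k a)
          minimal : ∀ {i} → i ∈ is → ¬ Pos b i (u b i k a - 1ℚ)

      free? : ∀ b is k a → Dec (Free b is k a)
      free? b is k a = map′ to fro
        (all? (λ i → pos? b i (u b i k a)) ×-dec all-in? {Q = λ i → ¬ Pos b i (u b i k a - 1ℚ)} is
            (λ {i} _ → ¬? (pos? b i (u b i k a - 1ℚ))))
        where
        Conditions : Set
        Conditions = (∀ i → Pos b i (u b i k a)) × (∀ {i} → i ∈ is → ¬ Pos b i (u b i k a - 1ℚ))
        to : Conditions → Free b is k a
        to (f , g) = free f g
        fro : Free b is k a → Conditions
        fro (free f g) = f , g

      private
        module Step (b : Basis) (is : List (Fin (suc d))) (i : Fin (suc d)) (i∉ : i ∉ is) where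
         w : Vec ℤ N
         w = pt (B b i)

         u-⊖ : ∀ j k a → u b j k (a ⊖ w) ≡ u b j (suc k) a - δ j i
         u-⊖ j k a = U-minus-pt b j a k (B b i) ∙ cong (λ z → u b j (suc k) a - z) (dual b j i)

         u-⊕ : ∀ j k a → u b j (suc k) (w ⊕ a) ≡ δ j i + u b j k a
         u-⊕ j k a = eq (u b j (suc k) (w ⊕ a)) (δ j i) ∙ cong (δ j i +_)
             (sym (u-⊖ j k (w ⊕ a)) ∙ cong (u b j k) (cong (_⊖ w) (⊕-comm w a) ∙ (⊕-⊖ a w)))
           where eq : ∀ x d → x ≡ d + (x - d)
                 eq = solve-∀ ringℚ

         off : ∀ {j} → j ≢ i → ∀ v → v - δ j i ≡ v
         off h v = cong (λ z → v - z) (δ-≢ h) ∙ minus-zero v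

         on : ∀ v → v - δ i i ≡ v - 1ℚ
         on v = cong (λ z → v - z) (δ-refl i)

         Subtractable : ℕ → Vec ℤ N → Set
         Subtractable k a = Pos b i (u b i k a - 1ℚ)

         both? : ∀ k a → Dec (Free b is k a × Subtractable k a)
         both? k a = free? b is k a ×-dec pos? b i (u b i k a - 1ℚ)

         is-irrelevant : ∀ {j} → j ∈ is → j ≢ i
         is-irrelevant j∈ refl = i∉ j∈

         down : ∀ {k a} → C (suc k) a → Free b is (suc k) a × Subtractable (suc k) a → C k (a ⊖ w) × Free b is k (a ⊖ w)
         down {k} {a} p (free f m , r) = nonneg⇒C b (span-resp (λ t → sym (hom-minus-pt a k (B b i) t))
             (span-minus {l = B b i} (C-span′ p))) (λ j → pos⇒nonneg {b} {j} (inside j (j ≟ᶠ i))) ,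
             free (λ j → inside j (j ≟ᶠ i)) λ {j} j∈ r′ → m j∈ (subst (λ v → Pos b j (v - 1ℚ))
                 (u-⊖ j k a ∙ off (is-irrelevant j∈) (u b j (suc k) a)) r′)
           where
           inside : ∀ j → Dec (j ≡ i) → Pos b j (u b j k (a ⊖ w))
           inside j (yes refl) = subst (Pos b j) (sym (u-⊖ j k a ∙ on (u b j (suc k) a))) r
           inside j (no h)     = subst (Pos b j) (sym (u-⊖ j k a ∙ off h (u b j (suc k) a))) (f j)

         up : ∀ {k a} → C k a → Free b is k a → C (suc k) (w ⊕ a) × Free b is (suc k) (w ⊕ a) × Subtractable (suc k) (w ⊕ a)
         up {k} {a} p (free f m) = C-⊕ (C-pt (B b i)) p ,
             free (λ j → inside j (j ≟ᶠ i)) (λ {j} j∈ r → m j∈ (subst (λ v → Pos b j (v - 1ℚ)) (same (is-irrelevant j∈)) r)) ,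
             subst (Pos b i) (sym (cong (λ z → z - 1ℚ) (u-⊕ i k a ∙ cong (_+ u b i k a) (δ-refl i)) ∙ eq (u b i k a))) (f i)
           where
           eq : ∀ v → (1ℚ + v) - 1ℚ ≡ v
           eq = solve-∀ ringℚ
           same : ∀ {j} → j ≢ i → u b j (suc k) (w ⊕ a) ≡ u b j k a
           same {j} h = u-⊕ j k a ∙ cong (_+ u b j k a) (δ-≢ h) ∙ +-identityˡ (u b j k a)
           inside : ∀ j → Dec (j ≡ i) → Pos b j (u b j (suc k) (w ⊕ a))
           inside j (yes refl) = inj₁ (subst (0ℚ <_) (sym (u-⊕ j k a ∙ cong (_+ u b j k a) (δ-refl j)))
               (0<-+ 0<1 (pos⇒nonneg {b} {j} (f j))))
           inside j (no h)     = subst (Pos b j) (sym (same h)) (f j)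

         -- Subtracting the vertex `w` is a bijection from the points of degree k + 1 that allow it
         -- onto all points of degree k. The difference of consecutive counts thus consists of the
         -- points that do not allow it.
         count-both : ∀ k → count both? (suc k) ≡ count (free? b is) k
         count-both k = ℕP.≤-antisym
           (injection-≤ (_⊖ w) (Unique.filter⁺ (both? (suc k)) (pts-unique (suc k)))
             (λ {a} a∈ → let (a∈′ , h) = ∈-filter⁻ (both? (suc k)) {xs = pts (suc k)} a∈ ; (p , h′) = down (pts⁻ a∈′) h in
                 ∈-filter⁺ (free? b is k) (pts⁺ p) h′)
             (λ {x} {y} e → sym (⊖-⊕ x w) ∙ cong (_⊕ w) e ∙ (⊖-⊕ y w)))
           (injection-≤ (w ⊕_) (Unique.filter⁺ (free? b is k) (pts-unique k))
             (λ {a} a∈ → let (a∈′ , h) = ∈-filter⁻ (free? b is k) {xs = pts k} a∈ ; (p , h′) = up (pts⁻ a∈′) h in ∈-filter⁺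
                 (both? (suc k)) (pts⁺ p) h′)
             (λ {x} {y} e → sym (⊕-⊖ x w) ∙ cong (_⊖ w) (⊕-comm x w ∙ e ∙ ⊕-comm w y) ∙ (⊕-⊖ y w)))

         none : ∀ {a} → C 0 a → Free b is 0 a → ¬ Subtractable 0 a
         none {a} p (free f _) r = <-irrefl refl (<-≤-trans 0<1 (≤-trans (0≤-⇒≤ (pos⇒nonneg {b} {i} r))
           (subst (u b i 0 a ≤_) (C-degree b {0} {a} p) (term≤sum (λ j → pos⇒nonneg {b} {j} (f j)) i))))

         count-rest : ∀ k → length (filter (λ a → free? b is k a ×-dec ¬? (pos? b i (u b i k a - 1ℚ))) (pts k)) ≡ count
             (free? b (i ∷ is)) k
         count-rest k = length-filter-cong (λ a → free? b is k a ×-dec ¬? (pos? b i (u b i k a - 1ℚ))) (free? b (i ∷ is) k) (pts k)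
           (λ _ (free f m , ¬r) → free f λ { (here refl) → ¬r ; (there j∈) → m j∈ })
           (λ _ (free f m) → free f (λ j∈ → m (there j∈)) , m (here refl))

         step : ∀ k → ℤ.+ count (free? b (i ∷ is)) k ≡ ∇ (λ k → ℤ.+ count (free? b is) k) k
         -- In degree 0 no vertex can be subtracted, which matches the convention that `∇` leaves
         -- the value at 0 unchanged.
         step zero = cong ℤ.+_ (sym (length-filter-split (free? b is 0) (λ a → pos? b i (u b i 0 a - 1ℚ)) (pts 0)
           ∙ cong₂ ℕ._+_ (count-rest 0) (length-filter-cong (both? 0) (λ _ → no (λ ())) (pts 0)
               (λ a∈ (f , r) → none (pts⁻ a∈) f r) (λ _ ()) ∙ filter-none (pts 0)) ∙ ℕP.+-identityʳ _))
           where filter-none : ∀ (xs : List (Vec ℤ N)) → length (filter {P = λ _ → ⊥} (λ _ → no (λ ())) xs) ≡ 0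
                 filter-none [] = refl
                 filter-none (x ∷ xs) = filter-none xs
         step (suc k) = eq (ℤ.+ count (free? b (i ∷ is)) (suc k)) (ℤ.+ count (free? b is) k) ∙ cong (ℤ._- ℤ.+ count (free? b is) k)
           (sym (ℤP.pos-+ (count (free? b (i ∷ is)) (suc k)) (count (free? b is) k)) ∙ cong ℤ.+_
               (sym (length-filter-split (free? b is (suc k)) (λ a → pos? b i (u b i (suc k) a - 1ℚ)) (pts (suc k))
             ∙ cong₂ ℕ._+_ (count-rest (suc k)) (count-both k))))
           where eq : ∀ x y → x ≡ (x ℤ.+ y) ℤ.- y
                 eq = ℤR.solve-∀

      -- The indices have to be distinct: subtracting vertex `i` changes coordinate `i` only, so the
      -- conditions already imposed at the other indices are preserved.
      free-∇ : ∀ b {is} → Unique is → ∀ k → ℤ.+ count (free? b is) k ≡ ∇^ (length is) (λ k → ℤ.+ count (free? b []) k) k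
      free-∇ b [] k = refl
      free-∇ b {i ∷ is} (h ∷ u) k = Step.step b is i (λ i∈ → All.lookup h i∈ refl) k ∙ ∇-cong (free-∇ b u) k

      all-indices : List (Fin (suc d))
      all-indices = allFin (suc d)

      boxCount : Basis → ℕ → ℕ
      boxCount b = count (free? b all-indices)

      boxCount-∇ : ∀ b k → ∇^ (suc d) (λ k → ℤ.+ count (free? b []) k) k ≡ ℤ.+ boxCount b k
      boxCount-∇ b k = sym (subst (λ p → ℤ.+ boxCount b k ≡ ∇^ p (λ k → ℤ.+ count (free? b []) k) k)
          (length-tabulate {n = suc d} (λ i → i)) (free-∇ b (Unique.allFin⁺ (suc d)) k))

      private
        empty-filter : ∀ {X : Set} {Q : Pred X 0ℓ} (Q? : Decidable Q) xs → (∀ {x} → x ∈ xs → ¬ Q x) → length (filter Q? xs) ≡ 0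
        empty-filter Q? [] h = refl
        empty-filter Q? (x ∷ xs) h with Q? x
        ... | yes p = ⊥-elim (h (here refl) p)
        ... | no _  = empty-filter Q? xs (λ i → h (there i))

      -- In a half-open box each of the d + 1 coordinates is at most 1, and it is below 1 where the
      -- generic point has a positive coordinate. Such an index exists, so the degree is below d +
      -- 1.
      boxCount-vanishes : ∀ b k → d ℕ.< k → boxCount b k ≡ 0
      boxCount-vanishes b k d<k = empty-filter (free? b all-indices k) (pts k) λ {a} a∈ fr → absurd (pts⁻ a∈) fr
        where
        absurd : ∀ {a} → C k a → ¬ Free b all-indices k a
        absurd {a} p (free f m) = ℕP.<⇒≱ d<k (ℕ.s≤s⁻¹ (ℤP.drop‿+<+ (ℤ→ℚ-cancel-< {ℤ.+ k} {ℤ.+ suc d} (0<-⇒< (subst (0ℚ <_)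
            (sum-- (λ _ → 1ℚ) (λ i → u b i k a) ∙ cong₂ _-_ (sum-const (suc d)) (C-degree b {k} {a} p))
            (sum-pos (λ j → ≤⇒0≤- (at-most j)) i (<⇒0<- (strictly))))))))
          where
          at-most : ∀ j → u b j k a ≤ 1ℚ
          at-most j = ≮⇒≥ λ lt → m (∈-allFin j) (inj₁ (<⇒0<- lt))
          positive = point-positive g zero b
          i : Fin (suc d)
          i = proj₁ positive
          strictly : u b i k a < 1ℚ
          strictly = ≤∧≢⇒< (at-most i) λ e → m (∈-allFin i) (inj₂ (cong (λ v → v - 1ℚ) e ∙ +-inverseʳ 1ℚ , proj₂ positive))

      -- Bases with the same dual solution have the same half-open cone; only the last of them is counted.

      Covered : List Basis → ℕ → Vec ℤ N → Set
      Covered bs k a = Any (λ b → Free b [] k a) bs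

      covered? : ∀ bs k a → Dec (Covered bs k a)
      covered? bs k a = Any.any? (λ b → free? b [] k a) bs

      -- The numerator has natural coefficients, as a sum of box counts. Nothing can cancel, so
      -- whatever the box of `s` contributes in some degree remains visible there.
      record Numerator (f : ℕ → ℕ) (s : Basis) : Set where
        field
          h          : ℕ → ℕ
          difference : ∀ i → ∇^ (suc d) (λ n → ℤ.+ f n) i ≡ ℤ.+ h i
          vanishes   : ∀ i → d ℕ.< i → h i ≡ 0
          contains   : ∀ i → boxCount s i ℕ.≤ h i

      free⇒K : ∀ {b k a} → Free b [] k a → K b (hom a (ℤ.+ k))
      free⇒K (free f _) = f

      K⇒free : ∀ {b k a} → K b (hom a (ℤ.+ k)) → Free b [] k a
      K⇒free f = free f λ ()

      -- The basis `s` stands at the end of the list because, of several bases with the same dual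
      -- solution, the last is the one counted. Its box is therefore part of the total, even if `bs`
      -- contains a copy of `s`.
      numerator : ∀ s → Feasible c s → ∀ bs → (∀ {b} → b ∈ bs → Feasible c b) → Numerator (count (covered? (bs ++ s ∷ []))) s
      numerator s feas-s [] _ = record
        { h = boxCount s
        ; difference = λ i → ∇^-cong (suc d) (λ n → cong ℤ.+_ (count-cong (covered? (s ∷ [])) (free? s []) n
            (λ _ → λ { (here fr) → fr }) (λ _ → here))) i ∙ boxCount-∇ s i
        ; vanishes = boxCount-vanishes s
        ; contains = λ i → ℕP.≤-refl }
      numerator s feas-s (b ∷ bs) feas = by-cases (Any.any? (sameDual? b) (bs ++ s ∷ []))
        where
        rest : List Basis
        rest = bs ++ s ∷ []
        module IH = Numerator (numerator s feas-s bs (λ i → feas (there i)))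
        feas-rest : ∀ xs → (∀ {b} → b ∈ xs → Feasible c b) → ∀ {b} → b ∈ xs ++ s ∷ [] → Feasible c b
        feas-rest [] h (here refl) = feas-s
        feas-rest (x ∷ xs) h (here refl) = h (here refl)
        feas-rest (x ∷ xs) h (there i) = feas-rest xs (λ i → h (there i)) i
        by-cases : Dec (Any (SameDual b) rest) → Numerator (count (covered? (b ∷ rest))) s
        by-cases (yes same) = record
          { h = IH.h
          ; difference = λ i → ∇^-cong (suc d) (λ n → cong ℤ.+_ (count-cong (covered? (b ∷ rest)) (covered? rest) n (shrink n)
              (λ _ → there))) i ∙ IH.difference i
          ; vanishes = IH.vanishes
          ; contains = IH.contains }
          where
          shrink : ∀ n {a} → C n a → Covered (b ∷ rest) n a → Covered rest n a
          shrink n {a} p (here fr) = Any.map (λ {b′} sd → K⇒free {b′} (sameDual⇒K {b} {b′} sd (C-span′ p) (free⇒K {b} fr))) same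
          shrink n p (there r) = r
        by-cases (no distinct) = record
          { h = λ i → boxCount b i ℕ.+ IH.h i
          ; difference = λ i → ∇^-cong (suc d) (λ n → cong ℤ.+_ (additive n) ∙ ℤP.pos-+ (count (free? b []) n)
              (count (covered? rest) n)) i
              ∙ (∇^-+ (suc d) (λ n → ℤ.+ count (free? b []) n) (λ n → ℤ.+ count (covered? rest) n) i)
                ∙ cong₂ ℤ._+_ (boxCount-∇ b i) (IH.difference i) ∙ sym (ℤP.pos-+ (boxCount b i) (IH.h i))
          ; vanishes = λ i lt → cong₂ ℕ._+_ (boxCount-vanishes b i lt) (IH.vanishes i lt)
          ; contains = λ i → ℕP.≤-trans (IH.contains i) (ℕP.m≤n+m (IH.h i) (boxCount b i)) }
          where
          disjoint : ∀ n {a} → C n a → Covered rest n a → ¬ Free b [] n a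
          disjoint n p cov fr = let (b′ , b′∈ , fr′) = find cov in
            distinct (lose b′∈ (overlap⇒sameDual {b} {b′} (feas (here refl)) (feas-rest bs (λ i → feas (there i)) b′∈) (C-span′ p)
                (free⇒K {b} fr) (free⇒K {b′} fr′)))
          additive : ∀ n → count (covered? (b ∷ rest)) n ≡ count (free? b []) n ℕ.+ count (covered? rest) n
          additive n = length-filter-split (covered? (b ∷ rest) n) (free? b [] n) (pts n) ∙ ℕP.+-comm
              (length (filter (λ a → covered? (b ∷ rest) n a ×-dec ¬? (free? b [] n a)) (pts n))) _ ∙ cong₂ ℕ._+_
            (length-filter-cong (λ a → covered? (b ∷ rest) n a ×-dec free? b [] n a) (free? b [] n) (pts n) (λ _ → proj₂)
                (λ _ fr → here fr , fr))
            (length-filter-cong (λ a → covered? (b ∷ rest) n a ×-dec ¬? (free? b [] n a)) (covered? rest n) (pts n)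
              (λ _ (cov , ¬fr) → Any.tail ¬fr cov) (λ a∈ cov → there cov , disjoint n (pts⁻ a∈) cov))

      everything : ∀ n → count (covered? (feasible-bases ++ start ∷ [])) n ≡ latticeCount n
      everything n = cong length (filter-all (covered? (feasible-bases ++ start ∷ []) n) (All.tabulate λ {a} a∈ →
        let (b , b∈ , k) = covered (cone⇒coneA (cone (pts⁻ a∈))) in lose (∈-++⁺ˡ b∈) (K⇒free {b} k)))

      ehrhart : Numerator latticeCount start
      ehrhart = record
        { h = M.h
        ; difference = λ i → ∇^-cong (suc d) (λ n → cong ℤ.+_ (sym (everything n))) i ∙ M.difference i
        ; vanishes = M.vanishes
        ; contains = M.contains }
        where module M = Numerator (numerator start (Generic.start-feasible g) feasible-bases
                (λ b∈ → proj₂ (∈-filter⁻ (feasible? c) {xs = bases} b∈)))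

      reduced⇒counted : ∀ {k a} → C k a → Reduced start k a → 1 ℕ.≤ boxCount start k
      reduced⇒counted {k} {a} p red = nonempty (∈-filter⁺ (free? start all-indices k) (pts⁺ p)
          (free (λ i → at i (0ℚ <? u start i k a)) λ {i} _ → below i))
        where
        nonempty : ∀ {xs : List (Vec ℤ N)} {x} → x ∈ xs → 1 ℕ.≤ length xs
        nonempty (here _)  = ℕ.s≤s ℕ.z≤n
        nonempty (there _) = ℕ.s≤s ℕ.z≤n
        at : ∀ i → Dec (0ℚ < u start i k a) → Pos start i (u start i k a)
        at i (yes lt) = inj₁ lt
        at i (no ¬lt) = inj₂ (≤-antisym (≮⇒≥ ¬lt) (proj₁ (red i)) , Generic.point-interior g i)
        below : ∀ i → ¬ Pos start i (u start i k a - 1ℚ)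
        below i r = <-irrefl refl (<-≤-trans (proj₂ (red i)) (0≤-⇒≤ (pos⇒nonneg {start} {i} r)))

    record HStar (s : Basis) : Set where
      field
        h        : ℕ → ℕ
        delta≡h  : ∀ i → delta d latticeCount i ≡ ℤ.+ h i
        vanishes : ∀ i → d ℕ.< i → h i ≡ 0
        positive : ∀ {k a} → C k a → Reduced s k a → 1 ℕ.≤ h k

    abstract
      h* : ∀ s → HStar s
      h* s = build (generic s)
        where
        build : Σ[ g ∈ Generic ] Generic.start g ≡ s → HStar s
        build (g , refl) = record
          { h = M.h
          ; delta≡h = λ i → delta≡∇^ d latticeCount i ∙ M.difference i
          ; vanishes = M.vanishes
          ; positive = λ {k} p red → ℕP.≤-trans (Counting.reduced⇒counted g p red) (M.contains k) }
          where module M = Counting.Numerator (Counting.ehrhart g)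

-- Existence of the invariants and the two chains of inequalities

open import Data.Nat using (ℕ; _≤_; _<_; _∸_; z≤n; s≤s)
open Boxes
open Decompositions
open VeryAmpleDilations
open HilbertBases
open EhrhartSeries

least-≤ : ∀ {Q : ℕ → Set} {μ k} → IsLeastPos Q μ → 1 ≤ k → Q k → μ ≤ k
least-≤ (_ , _ , least) 1≤k q = ℕP.≮⇒≥ (λ k<μ → least _ 1≤k k<μ q)

idp⇒veryAmple : ∀ {N} {Q : Polytope N} → IDP Q → VeryAmple Q
idp⇒veryAmple idp = 1 , idp

-- A search downwards from d, above which `h` vanishes. If no positive index has a nonzero
-- coefficient, the value is 1 by convention, and this is at most d when d ≥ 1.
degree-exists : ∀ {d L} (h : ℕ → ℕ) → (∀ i → delta d L i ≡ ℤ.+ h i) → (∀ i → d < i → h i ≡ 0) →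
                ∃[ μ ] MuEhr d L μ × 1 ≤ μ × (1 ≤ d → μ ≤ d) × (∀ i → 1 ≤ i → 1 ≤ h i → i ≤ μ)
degree-exists {d} {L} h δ≡h vanish = go d ℕP.≤-refl vanish
  where
  go : ∀ K → K ≤ d → (∀ i → K < i → h i ≡ 0) →
       ∃[ μ ] MuEhr d L μ × 1 ≤ μ × (1 ≤ d → μ ≤ d) × (∀ i → 1 ≤ i → 1 ≤ h i → i ≤ μ)
  go zero _ zeros = 1 , inj₂ (refl , λ i 1≤i → δ≡h i ∙ cong ℤ.+_ (zeros i 1≤i)) , ℕP.≤-refl , (λ 1≤d → 1≤d) ,
    λ i 1≤i 1≤h → ⊥-elim (ℕP.<⇒≢ 1≤h (sym (zeros i 1≤i)))
  go (suc K) K<d zeros with h (suc K) ℕP.≟ 0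
  ... | no h≢0 = suc K , inj₁ (s≤s z≤n , (λ e → h≢0 (ℤP.+-injective (sym (δ≡h (suc K)) ∙ e))) , λ i lt → δ≡h i ∙ cong ℤ.+_
      (zeros i lt)) ,
        s≤s z≤n , (λ _ → K<d) , λ i _ 1≤h → ℕP.≮⇒≥ (λ lt → ℕP.<⇒≢ 1≤h (sym (zeros i lt)))
  ... | yes h≡0 = go K (ℕP.<⇒≤ K<d) zeros′
    where zeros′ : ∀ i → K < i → h i ≡ 0
          zeros′ i K<i with ℕP.m≤n⇒m<n∨m≡n K<i
          ... | inj₁ lt   = zeros i lt
          ... | inj₂ refl = h≡0

theorem1p1 : ∀ {N} (P : Polytope N) (d : ℕ) → IsDim P d →
    Σ[ va ∈ ℕ ] Σ[ midp ∈ ℕ ] Σ[ idp ∈ ℕ ] Σ[ hilb ∈ ℕ ] Σ[ hole ∈ ℕ ]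
    Σ[ L ∈ (ℕ → ℕ) ] Σ[ ehr ∈ ℕ ]
    MuVa P va × MuMidp P midp × MuIdp P idp × MuHilb P hilb
    × MuHole P d hole × (∀ n → IsCount P n (L n)) × MuEhr d L ehr
    × (1 ≤ d → 1 ≤ va × va ≤ midp × midp ≤ idp × idp ≤ hole
    × hole ≤ ehr × ehr ≤ d)
    × (2 ≤ d → 1 ≤ va × va ≤ hilb × hilb ≤ hole × hole ≤ d ∸ 1)
theorem1p1 P d isDim =
  va , midp , idp , hilb , hole , latticeCount , ehr ,
  isVa , isMidp , isIdp , isHilb , isHole , isCount , isEhr ,
  (λ 1≤d → 1≤va , least-≤ isVa 1≤midp (idp⇒veryAmple {Q = dilate midp P} (proj₁ (proj₂ isMidp))) ,
           least-≤ isMidp (proj₁ isIdp) (proj₁ (proj₂ isIdp) idp ℕP.≤-refl) , idp≤hole , hole≤ehr hole-box , ehr≤d 1≤d) ,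
  (λ 2≤d → 1≤va , least-≤ isVa 1≤hilb (criterion⇒veryAmple hilb 1≤hilb (irreducibles-of-degree≤⇒criterion hilb irr≤hilb)) ,
           hilb≤hole , hole≤d-1 2≤d hole-box)
  where
  open HilbertBasis P isDim
  open Ehrhart P isDim using (latticeCount; isCount; HStar; h*)
  hole = proj₁ holes
  isHoles : Holes hole
  isHoles = proj₂ holes
  isHole = proj₁ isHoles
  1≤hole : 1 ≤ hole
  1≤hole = proj₁ (proj₂ isHoles)
  hole-box : hole ≡ 1 ⊎ ∃[ y ] C hole y × Box hole y
  hole-box = proj₂ (proj₂ (proj₂ isHoles))

  -- All dilations by at least `hole` have IDP, so the condition over infinitely many n reduces to
  -- those below `hole`.
  eventual-idp? : ∀ k → 1 ≤ k → Dec (∀ n → k ≤ n → IDP (dilate n P))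
  eventual-idp? k 1≤k = map′ extend (λ f n _ → f n) (all-below? {Q = λ n → k ≤ n → IDP (dilate n P)} hole at)
    where
    at : ∀ n → Dec (k ≤ n → IDP (dilate n P))
    at n with k ℕP.≤? n
    ... | no k≰n  = yes λ k≤n → ⊥-elim (k≰n k≤n)
    ... | yes k≤n = map′ (λ i _ → i) (λ f → f k≤n) (idp? n (ℕP.≤-trans 1≤k k≤n))
    extend : (∀ n → n < hole → k ≤ n → IDP (dilate n P)) → ∀ n → k ≤ n → IDP (dilate n P)
    extend f n k≤n with n ℕP.<? hole
    ... | yes n<hole = f n n<hole k≤n
    ... | no n≮hole  = ≥hole⇒idp isHoles n (ℕP.≮⇒≥ n≮hole)

  idp-result = leastPos (λ k → ∀ n → k ≤ n → IDP (dilate n P)) eventual-idp? hole 1≤hole (≥hole⇒idp isHoles)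
  idp = proj₁ idp-result
  idp≤hole : idp ≤ hole
  idp≤hole = proj₁ (proj₂ idp-result)
  isIdp : MuIdp P idp
  isIdp = proj₂ (proj₂ idp-result)
  midp-result = leastPos (λ k → IDP (dilate k P)) idp? hole 1≤hole (≥hole⇒idp isHoles hole ℕP.≤-refl)
  midp = proj₁ midp-result
  isMidp : MuMidp P midp
  isMidp = proj₂ (proj₂ midp-result)
  1≤midp : 1 ≤ midp
  1≤midp = proj₁ isMidp
  va-result = leastPos (λ k → VeryAmple (dilate k P)) veryAmple? midp 1≤midp (idp⇒veryAmple {Q = dilate midp P} (proj₁ (proj₂ isMidp)))
  va = proj₁ va-result
  isVa : MuVa P va
  isVa = proj₂ (proj₂ va-result)
  1≤va : 1 ≤ va
  1≤va = proj₁ isVa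

  hilb-result = FromHoles.hilb isHoles
  hilb = proj₁ hilb-result
  isHilb : MuHilb P hilb
  isHilb = proj₁ (proj₂ hilb-result)
  1≤hilb : 1 ≤ hilb
  1≤hilb = proj₁ (proj₂ (proj₂ hilb-result))
  hilb≤hole : hilb ≤ hole
  hilb≤hole = proj₁ (proj₂ (proj₂ (proj₂ hilb-result)))
  irr≤hilb : ∀ {k a} → C k a → Irreducible k a → k ≤ hilb
  irr≤hilb = proj₂ (proj₂ (proj₂ (proj₂ hilb-result)))

  ehr-result = degree-exists {d} {latticeCount} (HStar.h (h* b₀)) (HStar.delta≡h (h* b₀)) (HStar.vanishes (h* b₀))
  ehr = proj₁ ehr-result
  isEhr : MuEhr d latticeCount ehr
  isEhr = proj₁ (proj₂ ehr-result)
  ehr≤d : 1 ≤ d → ehr ≤ d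
  ehr≤d = proj₁ (proj₂ (proj₂ (proj₂ ehr-result)))

  -- The decomposition started at the simplex `b` of a hole of maximal degree has a positive
  -- coefficient in that degree. The degree `ehr` was found with the decomposition started at `b₀`,
  -- but both numerators equal `delta`, so the coefficient is positive there too.
  hole≤ehr : hole ≡ 1 ⊎ ∃[ y ] C hole y × Box hole y → hole ≤ ehr
  hole≤ehr (inj₁ e) = ℕP.≤-trans (ℕP.≤-reflexive e) (proj₁ (proj₂ (proj₂ ehr-result)))
  hole≤ehr (inj₂ (y , p , box (b , _ , red) _)) = proj₂ (proj₂ (proj₂ (proj₂ ehr-result))) hole 1≤hole
    (subst (1 ≤_) (ℤP.+-injective (sym (HStar.delta≡h (h* b) hole) ∙ HStar.delta≡h (h* b₀) hole)) (HStar.positive (h* b) p red))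

  -- If there are no holes, `hole` is 1 by convention, and this is at most d - 1 when d ≥ 2;
  -- otherwise the reflection argument bounds the degree of the hole.
  hole≤d-1 : 2 ≤ d → hole ≡ 1 ⊎ ∃[ y ] C hole y × Box hole y → hole ≤ d ∸ 1
  hole≤d-1 2≤d (inj₁ e) = ℕP.≤-trans (ℕP.≤-reflexive e) (ℕP.∸-monoˡ-≤ 1 2≤d)
  hole≤d-1 2≤d (inj₂ (y , p , bx)) = box-degree (ℕP.≤-trans (s≤s z≤n) 2≤d) p bx
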